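{- Let $L|K$ be a field extension with $(L^\times/K^\times)[\ell^\infty]=1$, i.e. $(L^{\times})^\ell\cap K^\times=(K^{\times})^\ell$, if $\operatorname{char}K=\ell>0$, and let $U\supseteq K^\times$ be a subgroup of $L^\times$. Let $x_i$, $i\in I$, be a full system of representatives for the elements of $U/K^\times$. Then $E:=\sum_{i\in I}Kx_i$ is a $K$-subalgebra of $L$ and the following conditions are equivalent: 1. $E$ is a field and the $x_i$, $i\in I$, are linearly independent over $K$. 2. $K^\times\hookrightarrow U$ is an essential extension of groups, and $1+i\notin U$ if $U$ contains a root of unity $i$ of order $4$ not in $K^\times$. If these conditions hold, $E$ is a separable algebraic field extension of $K$ of degree $[E:K]=[U:K^\times]$.
   Context: For a multiplicatively written abelian group $G$ and a prime $p$, $G[p^\infty]=\{x\in G: x^{p^k}=1\text{ for some }k\ge1\}$. An extension $H\subseteq G$ of abelian groups is essential if every subgroup $F\subseteq G$ with $F\cap H=1$ is trivial. (In condition 2, the symbol $i$ in $1+i$ denotes the root of unity of order $4$, not an index in $I$.) -}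

module Defs where

open import Algebra.Bundles using (AbelianGroup; CommutativeRing)
import Algebra.Definitions
import Algebra.Definitions.RawMonoid
open import Algebra.Morphism.Bundles using (RingHomomorphism)
import Algebra.Properties.AbelianGroup
open import Data.Fin.Base using (Fin)
open import Data.List.Base using (List; []; _∷_; map)
open import Data.Nat.Base as ℕ using (ℕ; zero; suc)
open import Data.Nat.Divisibility using (_∣_)
open import Data.Product.Base using (Σ; ∃-syntax; _×_; _,_; proj₁; proj₂)
open import Data.Vec.Base using (Vec; toList; _∷ʳ_)
open import Data.Vec.Functional using (Vector)
open import Function.Base using (_∘_)
open import Function.Bundles using (Func; _⇔_)
open import Function.Definitions using (Injective; Bijective)
open import Level using (Level; _⊔_) renaming (suc to lsuc)
open import Relation.Binary.Bundles using (Setoid)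
open import Relation.Binary.PropositionalEquality.Core using (_≡_)
import Relation.Binary.Reasoning.Setoid
open import Relation.Nullary.Negation using (¬_)
open import Relation.Unary using (Pred; _∈_)

private
  variable
    a aℓ h i iℓ k kℓ p s sℓ : Level

module _ (G : AbelianGroup a aℓ) where
  open AbelianGroup G

  record Subgroup p : Set (a ⊔ aℓ ⊔ lsuc p) where
    field
      member    : Pred Carrier p
      resp      : ∀ {x y} → x ≈ y → x ∈ member → y ∈ member
      ∙-closed  : ∀ {x y} → x ∈ member → y ∈ member → (x ∙ y) ∈ member
      ε-closed  : ε ∈ member
      ⁻¹-closed : ∀ {x} → x ∈ member → (x ⁻¹) ∈ member

  -- The library's iterated operation n × x is the power xⁿ here.
  power : ℕ → Carrier → Carrier
  power = Algebra.Definitions.RawMonoid._×_ rawMonoid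

  HasOrder : Carrier → ℕ → Set aℓ
  HasOrder x n = power n x ≈ ε × (∀ m → 0 ℕ.< m → m ℕ.< n → ¬ (power m x ≈ ε))

  IsTrivial : Pred Carrier p → Set (a ⊔ aℓ ⊔ p)
  IsTrivial F = ∀ {x} → x ∈ F → x ≈ ε

  _[_^∞] : ℕ → Pred Carrier aℓ
  _[_^∞] q x = ∃[ n ] (1 ℕ.≤ n × power (q ℕ.^ n) x ≈ ε)

  -- F ranges over subgroups at the level of G itself; this includes, up to
  -- lifting, all cyclic ones.
  IsEssential : Subgroup h → Set (lsuc a ⊔ lsuc aℓ ⊔ h)
  IsEssential H = (F : Subgroup (a ⊔ aℓ)) →
    IsTrivial (λ x → x ∈ Subgroup.member F × x ∈ Subgroup.member H) →
    IsTrivial (Subgroup.member F)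

module _ (G : AbelianGroup a aℓ) (H : Subgroup G h) where
  open AbelianGroup G
  open Subgroup H
  open Algebra.Properties.AbelianGroup G
  open Relation.Binary.Reasoning.Setoid setoid

  subgroupGroup : AbelianGroup (a ⊔ h) aℓ
  subgroupGroup = record
    { Carrier = Σ Carrier member
    ; _≈_     = λ x y → proj₁ x ≈ proj₁ y
    ; _∙_     = λ x y → proj₁ x ∙ proj₁ y , ∙-closed (proj₂ x) (proj₂ y)
    ; ε       = ε , ε-closed
    ; _⁻¹     = λ x → proj₁ x ⁻¹ , ⁻¹-closed (proj₂ x)
    ; isAbelianGroup = record
      { isGroup = record
        { isMonoid = record
          { isSemigroup = record
            { isMagma = record
              { isEquivalence = record { refl = refl ; sym = sym ; trans = trans }
              ; ∙-cong = ∙-cong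
              }
            ; assoc = λ x y z → assoc (proj₁ x) (proj₁ y) (proj₁ z)
            }
          ; identity = (λ x → identityˡ (proj₁ x)) , (λ x → identityʳ (proj₁ x))
          }
        ; inverse = (λ x → inverseˡ (proj₁ x)) , (λ x → inverseʳ (proj₁ x))
        ; ⁻¹-cong = ⁻¹-cong
        }
      ; comm = λ x y → comm (proj₁ x) (proj₁ y)
      }
    }

  infix 4 _~_
  _~_ : Carrier → Carrier → Set h
  x ~ y = (x ∙ y ⁻¹) ∈ member

  private
    ≈⇒~ : ∀ {x y} → x ≈ y → x ~ y
    ≈⇒~ {x} {y} x≈y = resp (trans (sym (inverseʳ y)) (∙-congʳ (sym x≈y))) ε-closed

    ~-sym : ∀ {x y} → x ~ y → y ~ x
    ~-sym {x} {y} x~y = resp eq (⁻¹-closed x~y)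
      where
      eq : (x ∙ y ⁻¹) ⁻¹ ≈ y ∙ x ⁻¹
      eq = begin
        (x ∙ y ⁻¹) ⁻¹    ≈⟨ ⁻¹-anti-homo-∙ x (y ⁻¹) ⟩
        y ⁻¹ ⁻¹ ∙ x ⁻¹   ≈⟨ ∙-congʳ (⁻¹-involutive y) ⟩
        y ∙ x ⁻¹         ∎

    ~-trans : ∀ {x y z} → x ~ y → y ~ z → x ~ z
    ~-trans {x} {y} {z} x~y y~z = resp eq (∙-closed x~y y~z)
      where
      eq : (x ∙ y ⁻¹) ∙ (y ∙ z ⁻¹) ≈ x ∙ z ⁻¹
      eq = begin
        (x ∙ y ⁻¹) ∙ (y ∙ z ⁻¹)  ≈⟨ assoc _ _ _ ⟩
        x ∙ (y ⁻¹ ∙ (y ∙ z ⁻¹))  ≈⟨ ∙-congˡ (assoc _ _ _) ⟨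
        x ∙ ((y ⁻¹ ∙ y) ∙ z ⁻¹)  ≈⟨ ∙-congˡ (∙-congʳ (inverseˡ y)) ⟩
        x ∙ (ε ∙ z ⁻¹)           ≈⟨ ∙-congˡ (identityˡ _) ⟩
        x ∙ z ⁻¹                 ∎

    ~-cong : ∀ {x x′ y y′} → x ~ x′ → y ~ y′ → x ∙ y ~ x′ ∙ y′
    ~-cong {x} {x′} {y} {y′} p q = resp eq (∙-closed p q)
      where
      eq : (x ∙ x′ ⁻¹) ∙ (y ∙ y′ ⁻¹) ≈ (x ∙ y) ∙ (x′ ∙ y′) ⁻¹
      eq = begin
        (x ∙ x′ ⁻¹) ∙ (y ∙ y′ ⁻¹)  ≈⟨ assoc _ _ _ ⟩
        x ∙ (x′ ⁻¹ ∙ (y ∙ y′ ⁻¹))  ≈⟨ ∙-congˡ (assoc _ _ _) ⟨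
        x ∙ ((x′ ⁻¹ ∙ y) ∙ y′ ⁻¹)  ≈⟨ ∙-congˡ (∙-congʳ (comm _ _)) ⟩
        x ∙ ((y ∙ x′ ⁻¹) ∙ y′ ⁻¹)  ≈⟨ ∙-congˡ (assoc _ _ _) ⟩
        x ∙ (y ∙ (x′ ⁻¹ ∙ y′ ⁻¹))  ≈⟨ assoc _ _ _ ⟨
        (x ∙ y) ∙ (x′ ⁻¹ ∙ y′ ⁻¹)  ≈⟨ ∙-congˡ (⁻¹-∙-comm x′ y′) ⟩
        (x ∙ y) ∙ (x′ ∙ y′) ⁻¹     ∎

    ~-inv : ∀ {x y} → x ~ y → x ⁻¹ ~ y ⁻¹
    ~-inv {x} {y} p = resp (sym (⁻¹-∙-comm x (y ⁻¹))) (⁻¹-closed p)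

  quotientGroup : AbelianGroup a h
  quotientGroup = record
    { Carrier = Carrier
    ; _≈_     = _~_
    ; _∙_     = _∙_
    ; ε       = ε
    ; _⁻¹     = _⁻¹
    ; isAbelianGroup = record
      { isGroup = record
        { isMonoid = record
          { isSemigroup = record
            { isMagma = record
              { isEquivalence = record { refl = ≈⇒~ refl ; sym = ~-sym ; trans = ~-trans }
              ; ∙-cong = ~-cong
              }
            ; assoc = λ x y z → ≈⇒~ (assoc x y z)
            }
          ; identity = (λ x → ≈⇒~ (identityˡ x)) , (λ x → ≈⇒~ (identityʳ x))
          }
        ; inverse = (λ x → ≈⇒~ (inverseˡ x)) , (λ x → ≈⇒~ (inverseʳ x))
        ; ⁻¹-cong = ~-inv
        }
      ; comm = λ x y → ≈⇒~ (comm x y)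
      }
    }

-- H ∩ U as a subgroup of U; it is H itself when H ⊆ U.
restrict : {G : AbelianGroup a aℓ} (U : Subgroup G p) → Subgroup G h →
           Subgroup (subgroupGroup G U) h
restrict U H = record
  { member    = λ x → proj₁ x ∈ member
  ; resp      = resp
  ; ∙-closed  = ∙-closed
  ; ε-closed  = ε-closed
  ; ⁻¹-closed = ⁻¹-closed
  }
  where open Subgroup H

-- A full system of representatives for the cosets of H; being indexed by a
-- setoid, the family must respect equality of indices.
IsRepresentativeSystem : {G : AbelianGroup a aℓ} (H : Subgroup G h) (I : Setoid i iℓ) →
                         Func I (AbelianGroup.setoid G) → Set (a ⊔ h ⊔ i ⊔ iℓ)
IsRepresentativeSystem {G = G} H I x =
  Bijective (Setoid._≈_ I) (AbelianGroup._≈_ (quotientGroup G H)) (Func.to x)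

module _ (R : CommutativeRing a aℓ) where
  open CommutativeRing R
  open Algebra.Definitions _≈_ using (Invertible)
  open Relation.Binary.Reasoning.Setoid setoid

  IsField : Set (a ⊔ aℓ)
  IsField = ¬ (0# ≈ 1#) × (∀ x → ¬ (x ≈ 0#) → Invertible 1# _*_ x)

  HasCharacteristic : ℕ → Set aℓ
  HasCharacteristic q = ∀ n → (n ·1 ≈ 0#) ⇔ (q ∣ n)
    where
    _·1 : ℕ → Carrier
    n ·1 = Algebra.Definitions.RawMonoid._×_ +-rawMonoid n 1#

  private
    *-interchange : ∀ w x y z → (w * x) * (y * z) ≈ (w * y) * (x * z)
    *-interchange w x y z = begin
      (w * x) * (y * z)  ≈⟨ *-assoc _ _ _ ⟩
      w * (x * (y * z))  ≈⟨ *-congˡ (*-assoc _ _ _) ⟨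
      w * ((x * y) * z)  ≈⟨ *-congˡ (*-congʳ (*-comm x y)) ⟩
      w * ((y * x) * z)  ≈⟨ *-congˡ (*-assoc _ _ _) ⟩
      w * (y * (x * z))  ≈⟨ *-assoc _ _ _ ⟨
      (w * y) * (x * z)  ∎

    *-≈1 : ∀ {w x y z} → w * x ≈ 1# → y * z ≈ 1# → (w * y) * (x * z) ≈ 1#
    *-≈1 {w} {x} {y} {z} p q = begin
      (w * y) * (x * z)  ≈⟨ *-interchange w x y z ⟨
      (w * x) * (y * z)  ≈⟨ *-cong p q ⟩
      1# * 1#            ≈⟨ *-identityˡ 1# ⟩
      1#                 ∎

  units : AbelianGroup (a ⊔ aℓ) aℓ
  units = record
    { Carrier = Σ Carrier (Invertible 1# _*_)
    ; _≈_     = λ x y → proj₁ x ≈ proj₁ y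
    ; _∙_     = λ { (x , x′ , l , r) (y , y′ , l′ , r′) →
                    x * y , x′ * y′ , *-≈1 l l′ , *-≈1 r r′ }
    ; ε       = 1# , 1# , *-identityˡ 1# , *-identityˡ 1#
    ; _⁻¹     = λ { (x , x′ , l , r) → x′ , x , r , l }
    ; isAbelianGroup = record
      { isGroup = record
        { isMonoid = record
          { isSemigroup = record
            { isMagma = record
              { isEquivalence = record { refl = refl ; sym = sym ; trans = trans }
              ; ∙-cong = *-cong
              }
            ; assoc = λ x y z → *-assoc (proj₁ x) (proj₁ y) (proj₁ z)
            }
          ; identity = (λ x → *-identityˡ (proj₁ x)) , (λ x → *-identityʳ (proj₁ x))
          }
        ; inverse = (λ { (_ , _ , l , _) → l }) , (λ { (_ , _ , _ , r) → r })
        ; ⁻¹-cong = λ { {x , x′ , l , r} {y , y′ , l′ , r′} x≈y → begin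
            x′             ≈⟨ *-identityʳ x′ ⟨
            x′ * 1#        ≈⟨ *-congˡ r′ ⟨
            x′ * (y * y′)  ≈⟨ *-assoc x′ y y′ ⟨
            (x′ * y) * y′  ≈⟨ *-congʳ (*-congˡ x≈y) ⟨
            (x′ * x) * y′  ≈⟨ *-congʳ l ⟩
            1# * y′        ≈⟨ *-identityˡ y′ ⟩
            y′             ∎ }
        }
      ; comm = λ x y → *-comm (proj₁ x) (proj₁ y)
      }
    }

-- A polynomial is the list of its coefficients, constant coefficient first.
module Polynomial (R : CommutativeRing a aℓ) where
  open CommutativeRing R

  Poly : Set a
  Poly = List Carrier

  coeff : Poly → ℕ → Carrier
  coeff []      _       = 0#
  coeff (c ∷ f) zero    = c
  coeff (c ∷ f) (suc n) = coeff f n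

  infix  4 _≈ₚ_
  infixl 6 _+ₚ_
  infixl 7 _*ₚ_

  -- Trailing zero coefficients are thereby ignored.
  _≈ₚ_ : Poly → Poly → Set aℓ
  f ≈ₚ g = ∀ n → coeff f n ≈ coeff g n

  _+ₚ_ : Poly → Poly → Poly
  []      +ₚ g       = g
  (c ∷ f) +ₚ []      = c ∷ f
  (c ∷ f) +ₚ (d ∷ g) = c + d ∷ f +ₚ g

  _*ₚ_ : Poly → Poly → Poly
  []      *ₚ g = []
  (c ∷ f) *ₚ g = map (c *_) g +ₚ (0# ∷ f *ₚ g)

  -- (c + X f)′ = f + X · f′
  derivative : Poly → Poly
  derivative []      = []
  derivative (c ∷ f) = f +ₚ (0# ∷ derivative f)

  -- f and f′ generate the unit ideal.
  IsSeparablePoly : Poly → Set (a ⊔ aℓ)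
  IsSeparablePoly f = ∃[ u ] ∃[ v ] (u *ₚ f +ₚ v *ₚ derivative f ≈ₚ 1# ∷ [])

  -- The monic polynomial of degree n with the given lower coefficients.
  monic : ∀ {n} → Vec Carrier n → Poly
  monic v = toList (v ∷ʳ 1#)

record CommutativeAlgebra (K : CommutativeRing k kℓ) a ℓ : Set (k ⊔ kℓ ⊔ lsuc (a ⊔ ℓ)) where
  field
    commutativeRing : CommutativeRing a ℓ

  open CommutativeRing commutativeRing public

  field
    homomorphism : RingHomomorphism (CommutativeRing.rawRing K) rawRing

module _ {K : CommutativeRing k kℓ} (A : CommutativeAlgebra K a aℓ) where
  private
    module K = CommutativeRing K
    module A = CommutativeAlgebra A
  open RingHomomorphism A.homomorphism using (⟦_⟧)
  open Algebra.Definitions.RawMonoid A.+-rawMonoid using (sum)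
  open Polynomial K

  lincomb : ∀ {n} → Vector K.Carrier n → Vector A.Carrier n → A.Carrier
  lincomb c x = sum (λ j → ⟦ c j ⟧ A.* x j)

  module _ (I : Setoid i iℓ) (x : Setoid.Carrier I → A.Carrier) where
    open Setoid I renaming (Carrier to Index; _≈_ to _≈ᵢ_)

    -- ∑ᵢ K xᵢ as the set of finite combinations; repeated indices are harmless.
    Span : Pred A.Carrier (k ⊔ aℓ ⊔ i)
    Span y = ∃[ n ] Σ (Vector K.Carrier n) λ c → Σ (Vector Index n) λ σ →
             y A.≈ lincomb c (x ∘ σ)

    IsLinearlyIndependent : Set (k ⊔ kℓ ⊔ aℓ ⊔ i ⊔ iℓ)
    IsLinearlyIndependent =
      ∀ {n} (σ : Vector Index n) → Injective _≡_ _≈ᵢ_ σ →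
      (c : Vector K.Carrier n) → lincomb c (x ∘ σ) A.≈ A.0# → ∀ j → c j K.≈ K.0#

    IsBasis : Set (k ⊔ kℓ ⊔ a ⊔ aℓ ⊔ i ⊔ iℓ)
    IsBasis = IsLinearlyIndependent × (∀ y → y ∈ Span)

  -- [A : K] = |S| as cardinals, finite or not: S indexes some basis of A, the
  -- cardinality of a basis being the dimension.
  HasDegree : Setoid s sℓ → Set (k ⊔ kℓ ⊔ a ⊔ aℓ ⊔ s ⊔ sℓ)
  HasDegree S = Σ (Func S A.setoid) λ b → IsBasis S (Func.to b)

  eval : Poly → A.Carrier → A.Carrier
  eval []      α = A.0#
  eval (c ∷ f) α = ⟦ c ⟧ A.+ α A.* eval f α

  IsAlgebraicElement : A.Carrier → Set (k ⊔ kℓ ⊔ aℓ)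
  IsAlgebraicElement α = ∃[ f ] (¬ (f ≈ₚ []) × eval f α A.≈ A.0#)

  IsMinimalPolynomial : A.Carrier → ∀ {n} → Vec K.Carrier n → Set (k ⊔ aℓ)
  IsMinimalPolynomial α {n} v =
    eval (monic v) α A.≈ A.0# ×
    (∀ {m} (w : Vec K.Carrier m) → m ℕ.< n → ¬ (eval (monic w) α A.≈ A.0#))

  IsSeparableElement : A.Carrier → Set (k ⊔ kℓ ⊔ aℓ)
  IsSeparableElement α = ∃[ n ] Σ (Vec K.Carrier n) λ v →
    IsMinimalPolynomial α v × IsSeparablePoly (monic v)

  IsAlgebraic : Set (k ⊔ kℓ ⊔ a ⊔ aℓ)
  IsAlgebraic = ∀ α → IsAlgebraicElement α

  IsSeparable : Set (k ⊔ kℓ ⊔ a ⊔ aℓ)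
  IsSeparable = ∀ α → IsSeparableElement α

  record IsSubalgebra (P : Pred A.Carrier p) : Set (k ⊔ a ⊔ aℓ ⊔ p) where
    field
      resp     : ∀ {x y} → x A.≈ y → x ∈ P → y ∈ P
      +-closed : ∀ {x y} → x ∈ P → y ∈ P → (x A.+ y) ∈ P
      *-closed : ∀ {x y} → x ∈ P → y ∈ P → (x A.* y) ∈ P
      -‿closed : ∀ {x} → x ∈ P → (A.- x) ∈ P
      0-closed : A.0# ∈ P
      1-closed : A.1# ∈ P
      ⟦⟧-closed : ∀ c → ⟦ c ⟧ ∈ P

  -- The image of Kˣ in Aˣ; for fields, Kˣ as a subgroup of Aˣ.
  baseUnits : Subgroup (units A.commutativeRing) (k ⊔ kℓ ⊔ aℓ)
  baseUnits = record
    { member    = λ x → Σ Kˣ.Carrier λ c → ⟦ proj₁ c ⟧ A.≈ proj₁ x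
    ; resp      = λ { x≈y (c , e) → c , A.trans e x≈y }
    ; ∙-closed  = λ { (c , e) (d , e′) → c Kˣ.∙ d , A.trans (*-homo _ _) (A.*-cong e e′) }
    ; ε-closed  = Kˣ.ε , 1#-homo
    ; ⁻¹-closed = λ { {x} (c , e) → c Kˣ.⁻¹ , Aˣ.⁻¹-cong {image c} {x} e }
    }
    where
    open RingHomomorphism A.homomorphism using (*-homo; 1#-homo; ⟦⟧-cong)
    module Kˣ = AbelianGroup (units K)
    module Aˣ = AbelianGroup (units A.commutativeRing)

    image : Kˣ.Carrier → Aˣ.Carrier
    image (c , d , l , r) = ⟦ c ⟧ , ⟦ d ⟧ ,
      A.trans (A.sym (*-homo d c)) (A.trans (⟦⟧-cong l) 1#-homo) ,
      A.trans (A.sym (*-homo c d)) (A.trans (⟦⟧-cong r) 1#-homo)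

module _ {K : CommutativeRing k kℓ} (A : CommutativeAlgebra K a aℓ)
         {P : Pred (CommutativeAlgebra.Carrier A) p} (P-sub : IsSubalgebra A P) where
  open CommutativeAlgebra A
  open IsSubalgebra P-sub

  private
    subring : CommutativeRing (a ⊔ p) aℓ
    subring = record
      { Carrier = Σ Carrier P
      ; _≈_     = λ x y → proj₁ x ≈ proj₁ y
      ; _+_     = λ x y → proj₁ x + proj₁ y , +-closed (proj₂ x) (proj₂ y)
      ; _*_     = λ x y → proj₁ x * proj₁ y , *-closed (proj₂ x) (proj₂ y)
      ; -_      = λ x → - proj₁ x , -‿closed (proj₂ x)
      ; 0#      = 0# , 0-closed
      ; 1#      = 1# , 1-closed
      ; isCommutativeRing = record
        { isRing = record
          { +-isAbelianGroup = record
            { isGroup = record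
              { isMonoid = record
                { isSemigroup = record
                  { isMagma = record
                    { isEquivalence = record { refl = refl ; sym = sym ; trans = trans }
                    ; ∙-cong = +-cong
                    }
                  ; assoc = λ x y z → +-assoc (proj₁ x) (proj₁ y) (proj₁ z)
                  }
                ; identity = (λ x → +-identityˡ (proj₁ x)) , (λ x → +-identityʳ (proj₁ x))
                }
              ; inverse = (λ x → -‿inverseˡ (proj₁ x)) , (λ x → -‿inverseʳ (proj₁ x))
              ; ⁻¹-cong = -‿cong
              }
            ; comm = λ x y → +-comm (proj₁ x) (proj₁ y)
            }
          ; *-cong = *-cong
          ; *-assoc = λ x y z → *-assoc (proj₁ x) (proj₁ y) (proj₁ z)
          ; *-identity = (λ x → *-identityˡ (proj₁ x)) , (λ x → *-identityʳ (proj₁ x))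
          ; distrib = (λ x y z → distribˡ (proj₁ x) (proj₁ y) (proj₁ z))
                    , (λ x y z → distribʳ (proj₁ x) (proj₁ y) (proj₁ z))
          }
        ; *-comm = λ x y → *-comm (proj₁ x) (proj₁ y)
        }
      }

  subalgebra : CommutativeAlgebra K (a ⊔ p) aℓ
  subalgebra = record { commutativeRing = subring ; homomorphism = record
    { ⟦_⟧ = λ c → ⟦ c ⟧ , ⟦⟧-closed c
    ; isRingHomomorphism = record
      { isSemiringHomomorphism = record
        { isNearSemiringHomomorphism = record
          { +-isMonoidHomomorphism = record
            { isMagmaHomomorphism = record
              { isRelHomomorphism = record { cong = ⟦⟧-cong }
              ; homo = +-homo
              }
            ; ε-homo = 0#-homo
            }
          ; *-homo = *-homo
          }
        ; 1#-homo = 1#-homo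
        }
      ; -‿homo = -‿homo
      }
    } }
    where open RingHomomorphism homomorphism

{-# OPTIONS --safe #-}

-- Write Ind for the statement that 1 is not a sum of elements of U outside K; up to scaling, it says that
-- representatives of U/Kˣ are linearly independent over K.
--
-- (2 ⇒ 1) Condition 2 says that U/Kˣ is torsion without elements of order char K, that the roots of unity of
-- prime order in U lie in K, and that 1 + i ∉ U for i ∈ U ∖ K with i² = −1. Let u ∈ U ∖ K with uᵖ = a ∈ K, p prime.
-- Then a ∉ Kᵖ, so taking norms shows that u has degree p over K. With M = K(u), norms from M to K, together with the
-- trace for p-th roots, show that U ∩ M is generated by u and Kˣ, and that (M, U Mˣ) inherits the three conditions;
-- only for p = 2 is 1 + i needed, because N(u) = −a. Given a relation 1 = ∑ uⱼ, induction on the sum of the orders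
-- of the uⱼ modulo Kˣ applies Ind to (M, U Mˣ): it remains to look at the terms in M, and for them the
-- independence of 1, u, …, u^(p−1) over K suffices.
--
-- (1 ⇒ 2) A subgroup F with F ∩ Kˣ = 1 embeds into U/Kˣ, so it is independent over K. For 1 ≠ w ∈ F, the inverse
-- of 1 − w is a finite sum of elements of U, which forces w to have finite order n; but then 1 + w + … + w^(n−1) = 0.
--
-- Every α ∈ E lies in a field obtained from K by successively adjoining u with uⁿ in the previous field and n ≠ 0
-- in K, so α is algebraic. In characteristic q, adjoining such u creates no new q-th roots of elements of the
-- ground field, hence α ∈ K(α^q), and this makes α separable.

module Submission where

open import Defs
open import Algebra.Bundles using (AbelianGroup; CommutativeRing)
open import Algebra.Bundles.Raw using (RawRing)
import Algebra.Definitions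
open import Algebra.Morphism.Bundles using (RingHomomorphism)
import Algebra.Properties.CommutativeSemiring.Binomial as Binomial
import Algebra.Solver.Ring as RingSolver
open import Algebra.Solver.Ring.AlmostCommutativeRing using (fromCommutativeRing; _-Raw-AlmostCommutative⟶_)
open import Axiom.ExcludedMiddle using (ExcludedMiddle)
open import Data.Empty using (⊥)
open import Data.Fin.Base as Fin using (Fin; zero; suc; toℕ; fromℕ; fromℕ<; inject₁; punchIn; combine; remQuot)
import Data.Fin.Properties as Fin
open import Data.Fin.Relation.Unary.Top using (view; ‵fromℕ; ‵inject₁)
open import Data.Integer.Base as ℤ using (ℤ; +_; -[1+_])
import Data.Integer.Properties as ℤ
open import Data.List.Base as List using (List; []; _∷_)
open import Data.List.Membership.Propositional.Properties using (∈-lookup)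
import Data.List.Properties as List
open import Data.List.Relation.Unary.All as All using (All; []; _∷_)
import Data.List.Relation.Unary.All.Properties as All
open import Data.List.Relation.Unary.Any as Any using (Any; here; there)
import Data.List.Relation.Unary.Any.Properties as Any
open import Data.Maybe.Base using (Maybe; just; nothing)
open import Data.Nat.Base as ℕ using (ℕ; zero; suc; _<_; z≤n; s≤s; _!)
open import Data.Nat.Combinatorics as ℕ using (_C_)
open import Data.Nat.Coprimality as Coprime using (Coprime)
open import Data.Nat.Divisibility as ℕ using (_∣_; divides)
import Data.Nat.DivMod as ℕ
open import Data.Nat.GCD using (module Bézout)
import Data.Nat.Induction as ℕ
open import Data.Nat.Primality as ℕ using (Prime; prime⇒nonZero; prime⇒irreducible)
open import Data.Nat.Primality.Factorisation using (factorise)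
import Data.Nat.Properties as ℕ
open import Data.Product.Base using (Σ; Σ-syntax; ∃-syntax; _×_; _,_; proj₁; proj₂; uncurry)
open import Data.Sum.Base using (_⊎_; inj₁; inj₂; [_,_]′)
open import Data.Unit.Polymorphic.Base using (⊤; tt)
open import Data.Vec.Base as Vec using (Vec; []; _∷_; map; tabulate)
open import Data.Vec.Functional as Vector using (Vector; insertAt)
open import Data.Vec.Functional.Properties using (insertAt-lookup; insertAt-punchIn)
open import Data.Vec.Properties as Vec using (map-∘; tabulate-∘)
open import Data.Vec.Relation.Unary.All as VecAll using ()
import Data.Vec.Relation.Unary.All.Properties as VecAll
open import Function.Base using (_∘_; id; case_of_)
open import Function.Bundles using (Func; _⇔_; mk⇔)
open import Function.Definitions using (Injective)
open import Induction.WellFounded using (Acc; acc)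
open import Level using (Level; _⊔_; Lift) renaming (suc to lsuc; lift to liftˡ)
open import Relation.Binary.Bundles using (Setoid)
open import Relation.Binary.Definitions using (Tri; tri<; tri≈; tri>)
import Relation.Binary.PropositionalEquality as ≡
open ≡ using (_≡_; _≢_)
open import Relation.Nullary.Decidable using (Dec; yes; no)
open import Relation.Nullary.Negation using (¬_; contradiction)
open import Relation.Unary using (_∈_; _∉_; _⊆_)

-- The crux is why the conditions pass from (K, U) to (M, U Mˣ). An element x of U Mˣ is known only
-- through w = x k with w ∈ U and k ∈ M. If x^q = 1, then w^q = k^q lies in U ∩ M = ⟨u⟩Kˣ, so
-- everything hinges on those k ∈ Mˣ with k^q ∈ ⟨u⟩Kˣ for a prime q. If q ≠ p, multiplying k by a
-- power of u brings k^q into K, and the norm, of degree p prime to q, makes it a q-th power in K.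
-- If q = p is odd, the norm shows that k^p itself is in K, and the trace puts k in ⟨u⟩Kˣ. If q = p
-- = 2, there are exceptions k = x (1 + ζ) with x ∈ K and ζ² = -1; this is the origin of 1 + i. For
-- elements of U the third condition excludes them, and that condition for U Mˣ again reduces to
-- squares of elements of M, because (1 + i)² = 2 i. Norms and traces are read off from matrices
-- over K, since the conjugates of u need not lie in L.

module IntegerSolver {c ℓ} (R : CommutativeRing c ℓ) where
  open CommutativeRing R hiding (zero)
  open import Algebra.Properties.Ring ring
  open import Algebra.Properties.Semiring.Mult.TCOptimised semiring renaming (_×_ to _×′_)
  open import Relation.Binary.Reasoning.Setoid setoid

  private
    -- `×′` is the multiple for which 1 ×′ 1# is 1# by definition, so that the constants `:0` and
    -- `:1` denote 0# and 1# on the nose in solved goals.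
    fromℤ : ℤ → Carrier
    fromℤ (+ n)    = n ×′ 1#
    fromℤ -[1+ n ] = - (suc n ×′ 1#)

    cancel : ∀ x y z → (x + y) - (x + z) ≈ y - z
    cancel x y z = begin
      (x + y) - (x + z)  ≈⟨ +-cong (+-comm x y) (sym (-‿+-comm x z)) ⟩
      (y + x) + (- x - z)  ≈⟨ +-assoc _ _ _ ⟩
      y + (x + (- x - z))  ≈⟨ +-congˡ (+-assoc _ _ _) ⟨
      y + ((x - x) - z)  ≈⟨ +-congˡ (+-congʳ (-‿inverseʳ x)) ⟩
      y + (0# - z)  ≈⟨ +-congˡ (+-identityˡ _) ⟩
      y - z  ∎

    fromℤ-⊖ : ∀ m n → fromℤ (m ℤ.⊖ n) ≈ m ×′ 1# - n ×′ 1#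
    fromℤ-⊖ zero    zero    = sym (-‿inverseʳ 0#)
    fromℤ-⊖ (suc m) zero    = sym (trans (+-congˡ -0#≈0#) (+-identityʳ _))
    fromℤ-⊖ zero    (suc n) = sym (+-identityˡ _)
    fromℤ-⊖ (suc m) (suc n) = begin
      fromℤ (suc m ℤ.⊖ suc n)  ≡⟨ ≡.cong fromℤ (ℤ.[1+m]⊖[1+n]≡m⊖n m n) ⟩
      fromℤ (m ℤ.⊖ n)  ≈⟨ fromℤ-⊖ m n ⟩
      m ×′ 1# - n ×′ 1#  ≈⟨ cancel 1# _ _ ⟨
      (1# + m ×′ 1#) - (1# + n ×′ 1#)  ≈⟨ +-cong (×-homo-+ 1# 1 m) (-‿cong (×-homo-+ 1# 1 n)) ⟨
      suc m ×′ 1# - suc n ×′ 1#  ∎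

    fromℤ-+ : ∀ i j → fromℤ (i ℤ.+ j) ≈ fromℤ i + fromℤ j
    fromℤ-+ (+ m)    (+ n)    = ×-homo-+ 1# m n
    fromℤ-+ (+ m)    -[1+ n ] = fromℤ-⊖ m (suc n)
    fromℤ-+ -[1+ m ] (+ n)    = trans (fromℤ-⊖ n (suc m)) (+-comm _ _)
    fromℤ-+ -[1+ m ] -[1+ n ] = begin
      - (suc (suc (m ℕ.+ n)) ×′ 1#)  ≡⟨ ≡.cong (λ k → - (suc k ×′ 1#)) (ℕ.+-suc m n) ⟨
      - ((suc m ℕ.+ suc n) ×′ 1#)  ≈⟨ -‿cong (×-homo-+ 1# (suc m) (suc n)) ⟩
      - (suc m ×′ 1# + suc n ×′ 1#)  ≈⟨ -‿+-comm _ _ ⟨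
      - (suc m ×′ 1#) - suc n ×′ 1#  ∎

    fromℤ-neg : ∀ i → fromℤ (ℤ.- i) ≈ - fromℤ i
    fromℤ-neg (+ zero)  = sym -0#≈0#
    fromℤ-neg (+ suc n) = refl
    fromℤ-neg -[1+ n ]  = sym (-‿involutive _)

    fromℤ-*⁺ : ∀ m j → fromℤ (+ m ℤ.* j) ≈ m ×′ 1# * fromℤ j
    fromℤ-*⁺ m (+ n)    = trans (reflexive (≡.cong fromℤ (≡.sym (ℤ.pos-* m n)))) (×1-homo-* m n)
    fromℤ-*⁺ m -[1+ n ] = begin
      fromℤ (+ m ℤ.* -[1+ n ])  ≡⟨ ≡.cong fromℤ (ℤ.neg-distribʳ-* (+ m) (+ suc n)) ⟨
      fromℤ (ℤ.- (+ m ℤ.* + suc n))  ≈⟨ fromℤ-neg (+ m ℤ.* + suc n) ⟩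
      - fromℤ (+ m ℤ.* + suc n)  ≈⟨ -‿cong (fromℤ-*⁺ m (+ suc n)) ⟩
      - (m ×′ 1# * (suc n ×′ 1#))  ≈⟨ -‿distribʳ-* _ _ ⟩
      m ×′ 1# * - (suc n ×′ 1#)  ∎

    fromℤ-* : ∀ i j → fromℤ (i ℤ.* j) ≈ fromℤ i * fromℤ j
    fromℤ-* (+ m)    j = fromℤ-*⁺ m j
    fromℤ-* -[1+ m ] j = begin
      fromℤ (-[1+ m ] ℤ.* j)  ≡⟨ ≡.cong fromℤ (ℤ.neg-distribˡ-* (+ suc m) j) ⟨
      fromℤ (ℤ.- (+ suc m ℤ.* j))  ≈⟨ fromℤ-neg (+ suc m ℤ.* j) ⟩
      - fromℤ (+ suc m ℤ.* j)  ≈⟨ -‿cong (fromℤ-*⁺ (suc m) j) ⟩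
      - (suc m ×′ 1# * fromℤ j)  ≈⟨ -‿distribˡ-* _ _ ⟩
      - (suc m ×′ 1#) * fromℤ j  ∎

    ℤ-rawRing : RawRing _ _
    ℤ-rawRing = record
      { Carrier = ℤ ; _≈_ = _≡_ ; _+_ = ℤ._+_ ; _*_ = ℤ._*_ ; -_ = ℤ.-_ ; 0# = ℤ.0ℤ ; 1# = ℤ.1ℤ }

    homomorphism : ℤ-rawRing -Raw-AlmostCommutative⟶ fromCommutativeRing R
    homomorphism = record
      { ⟦_⟧ = fromℤ ; +-homo = fromℤ-+ ; *-homo = fromℤ-* ; -‿homo = fromℤ-neg
      ; 0-homo = refl ; 1-homo = refl }

    -- Coefficients are compared as integers, which is decidable, so the solver can cancel terms in
    -- a ring whose own equality is not.
    decide : ∀ i j → Maybe (fromℤ i ≈ fromℤ j)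
    decide i j with i ℤ.≟ j
    ... | yes i≡j = just (reflexive (≡.cong fromℤ i≡j))
    ... | no  _   = nothing

  open RingSolver ℤ-rawRing (fromCommutativeRing R) homomorphism decide using (Polynomial; con)
  open RingSolver ℤ-rawRing (fromCommutativeRing R) homomorphism decide public
    using (solve; _:=_; _:+_; _:*_; _:-_; :-_)

  :0 :1 : ∀ {n} → Polynomial n
  :0 = con (+ 0)
  :1 = con (+ 1)

-- Determinants and alternating forms.

module Determinant {c ℓ} (R : CommutativeRing c ℓ) where
  open CommutativeRing R hiding (zero)
  open import Algebra.Properties.Ring ring
  open import Algebra.Properties.Semiring.Sum semiring
  open import Algebra.Properties.Semiring.Exp semiring
  open import Relation.Binary.Reasoning.Setoid setoid
  open IntegerSolver R using (solve; _:=_; _:+_; _:*_; _:-_)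

  Row : ℕ → Set c
  Row n = Fin n → Carrier

  infix 4 _≋_
  _≋_ : ∀ {n} → Row n → Row n → Set ℓ
  v ≋ w = ∀ i → v i ≈ w i

  head : ∀ {n} → Row (suc n) → Carrier
  head v = v zero

  tail : ∀ {n} → Row (suc n) → Row n
  tail v = v ∘ suc

  -- The exterior product of a functional, given by its values cs on the arguments, with the form ω.
  wedge : ∀ {a} {A : Set a} {n} → Vec Carrier (suc n) → (Vec A n → Carrier) → Vec A (suc n) → Carrier
  wedge {n = zero}  (c ∷ _)  ω _        = c * ω []
  wedge {n = suc n} (c ∷ cs) ω (v ∷ vs) = c * ω vs - wedge cs (λ ws → ω (v ∷ ws)) vs

  -- Laplace expansion along the first column: the first coordinate is wedged with the determinant
  -- of the remaining ones.
  det : ∀ n → Vec (Row n) n → Carrier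
  det zero    _  = 1#
  det (suc n) vs = wedge (map head vs) (det n) (map tail vs)

  Adjacent : ∀ {m} n → (Vec (Row m) (suc n) → Carrier) → Set (c ⊔ ℓ)
  Adjacent zero    ω = ⊤
  Adjacent (suc n) ω = ∀ v vs → ω (v ∷ v ∷ vs) ≈ 0#

  -- Fixing the first argument must leave an alternating form, so linearity and vanishing are
  -- demanded only at the front; the recursion supplies the later positions.
  IsAlternating : ∀ {m} n → (Vec (Row m) n → Carrier) → Set (c ⊔ ℓ)
  IsAlternating     zero    ω = ⊤
  IsAlternating {m} (suc n) ω =
    (∀ v → IsAlternating n (λ ws → ω (v ∷ ws))) ×
    (∀ {v w : Row m} → v ≋ w → ∀ vs → ω (v ∷ vs) ≈ ω (w ∷ vs)) ×
    (∀ a (v w : Row m) vs → ω ((λ i → a * v i + w i) ∷ vs) ≈ a * ω (v ∷ vs) + ω (w ∷ vs)) ×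
    Adjacent n ω

  private
    variable
      a : Level
      A B : Set a
      m n : ℕ

  wedge-cong : ∀ {A : Set a} (cs : Vec Carrier (suc n)) {ω ω′ : Vec A n → Carrier} →
               (∀ ws → ω ws ≈ ω′ ws) → ∀ vs → wedge cs ω vs ≈ wedge cs ω′ vs
  wedge-cong {n = zero}  (c ∷ _)  eq _        = *-congˡ (eq [])
  wedge-cong {n = suc n} (c ∷ cs) eq (v ∷ vs) =
    +-cong (*-congˡ (eq vs)) (-‿cong (wedge-cong cs (λ ws → eq (v ∷ ws)) vs))

  wedge-linear : ∀ {A : Set a} (cs : Vec Carrier (suc n)) x (ω ω′ : Vec A n → Carrier) vs →
                 wedge cs (λ ws → x * ω ws + ω′ ws) vs ≈ x * wedge cs ω vs + wedge cs ω′ vs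
  wedge-linear {n = zero} (c ∷ _) x ω ω′ _ = begin
    c * (x * ω [] + ω′ [])  ≈⟨ solve 4 (λ c x y z → c :* (x :* y :+ z) := x :* (c :* y) :+ c :* z) refl c x (ω []) (ω′ []) ⟩
    x * (c * ω []) + c * ω′ []  ∎
  wedge-linear {n = suc n} (c ∷ cs) x ω ω′ (v ∷ vs) = begin
    c * (x * ω vs + ω′ vs) - wedge cs (λ ws → x * ω (v ∷ ws) + ω′ (v ∷ ws)) vs
      ≈⟨ +-congˡ (-‿cong (wedge-linear cs x _ _ vs)) ⟩
    c * (x * ω vs + ω′ vs) - (x * p + q)
      ≈⟨ solve 6 (λ c x y z p q → c :* (x :* y :+ z) :- (x :* p :+ q) := x :* (c :* y :- p) :+ (c :* z :- q)) refl c x (ω vs) (ω′ vs) p q ⟩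
    x * (c * ω vs - p) + (c * ω′ vs - q) ∎
    where
    p = wedge cs (λ ws → ω (v ∷ ws)) vs
    q = wedge cs (λ ws → ω′ (v ∷ ws)) vs

  wedge-zero : ∀ {A : Set a} (cs : Vec Carrier (suc n)) {ω : Vec A n → Carrier} →
               (∀ ws → ω ws ≈ 0#) → ∀ vs → wedge cs ω vs ≈ 0#
  wedge-zero {n = zero}  (c ∷ _)  eq _        = trans (*-congˡ (eq [])) (zeroʳ c)
  wedge-zero {n = suc n} (c ∷ cs) eq (v ∷ vs) = begin
    c * _ - _  ≈⟨ +-cong (trans (*-congˡ (eq vs)) (zeroʳ c)) (-‿cong (wedge-zero cs (λ ws → eq (v ∷ ws)) vs)) ⟩
    0# - 0#  ≈⟨ -‿inverseʳ 0# ⟩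
    0#  ∎

  wedge-scale : ∀ {A : Set a} (cs : Vec Carrier (suc n)) x (ω : Vec A n → Carrier) vs →
                wedge cs (λ ws → ω ws * x) vs ≈ wedge cs ω vs * x
  wedge-scale cs x ω vs = begin
    wedge cs (λ ws → ω ws * x) vs  ≈⟨ wedge-cong cs (λ ws → trans (*-comm _ _) (sym (+-identityʳ _))) vs ⟩
    wedge cs (λ ws → x * ω ws + 0#) vs  ≈⟨ wedge-linear cs x ω (λ _ → 0#) vs ⟩
    x * wedge cs ω vs + wedge cs (λ _ → 0#) vs  ≈⟨ +-congˡ (wedge-zero cs (λ _ → refl) vs) ⟩
    x * wedge cs ω vs + 0#  ≈⟨ +-identityʳ _ ⟩
    x * wedge cs ω vs  ≈⟨ *-comm _ _ ⟩
    wedge cs ω vs * x  ∎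

  wedge-map : ∀ {A B : Set a} (cs : Vec Carrier (suc n)) (f : A → B) (ω : Vec B n → Carrier) vs →
              wedge cs ω (map f vs) ≈ wedge cs (λ ws → ω (map f ws)) vs
  wedge-map {n = zero}  (c ∷ _)  f ω _        = refl
  wedge-map {n = suc n} (c ∷ cs) f ω (v ∷ vs) = +-congˡ (-‿cong (wedge-map cs f (λ ws → ω (f v ∷ ws)) vs))

  -- Alternating forms

  -- A zero row v equals -1 · v + v, on which linearity gives -ω + ω.
  alternating-zero : (ω : Vec (Row m) (suc n) → Carrier) → IsAlternating (suc n) ω →
                     ∀ {v} → (∀ i → v i ≈ 0#) → ∀ vs → ω (v ∷ vs) ≈ 0#
  alternating-zero ω (_ , cong , lin , _) {v} v≈0 vs = begin
    ω (v ∷ vs)  ≈⟨ cong (λ i → trans (v≈0 i) (sym (trans (+-congʳ (-1*x≈-x _)) (-‿inverseˡ _)))) vs ⟩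
    ω ((λ i → - 1# * v i + v i) ∷ vs)  ≈⟨ lin (- 1#) v v vs ⟩
    - 1# * ω (v ∷ vs) + ω (v ∷ vs)  ≈⟨ +-congʳ (-1*x≈-x _) ⟩
    - ω (v ∷ vs) + ω (v ∷ vs)  ≈⟨ -‿inverseˡ _ ⟩
    0#  ∎

  -- Polarisation: expand ω at (s, s) with s = v + w. The factor 1# in `s` matches the form in which
  -- linearity is stated.
  alternating-swap : (ω : Vec (Row m) (suc (suc n)) → Carrier) → IsAlternating (suc (suc n)) ω →
                     ∀ v w vs → ω (v ∷ w ∷ vs) ≈ - ω (w ∷ v ∷ vs)
  alternating-swap ω (rest , _ , lin , adj) v w vs = +-inverseˡ-unique _ _ (begin
    ω (v ∷ w ∷ vs) + ω (w ∷ v ∷ vs)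
      ≈⟨ +-cong (expand v (adj v vs)) (expand′ w (adj w vs)) ⟨
    ω (v ∷ s ∷ vs) + ω (w ∷ s ∷ vs)
      ≈⟨ +-congʳ (*-identityˡ _) ⟨
    1# * ω (v ∷ s ∷ vs) + ω (w ∷ s ∷ vs)
      ≈⟨ lin 1# v w (s ∷ vs) ⟨
    ω (s ∷ s ∷ vs)
      ≈⟨ adj s vs ⟩
    0# ∎)
    where
    s : Row _
    s i = 1# * v i + w i
    lin₂ : ∀ x → ω (x ∷ s ∷ vs) ≈ ω (x ∷ v ∷ vs) + ω (x ∷ w ∷ vs)
    lin₂ x = trans (proj₁ (proj₂ (proj₂ (rest x))) 1# v w vs) (+-congʳ (*-identityˡ _))
    expand : ∀ x → ω (x ∷ v ∷ vs) ≈ 0# → ω (x ∷ s ∷ vs) ≈ ω (x ∷ w ∷ vs)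
    expand x eq = trans (lin₂ x) (trans (+-congʳ eq) (+-identityˡ _))
    expand′ : ∀ x → ω (x ∷ w ∷ vs) ≈ 0# → ω (x ∷ s ∷ vs) ≈ ω (x ∷ v ∷ vs)
    expand′ x eq = trans (lin₂ x) (trans (+-congˡ eq) (+-identityʳ _))

  -- The combination x ω - ω′ is what `wedge` becomes once its first vector is fixed.
  alternating-comb : ∀ x (ω ω′ : Vec (Row m) n → Carrier) → IsAlternating n ω → IsAlternating n ω′ →
                     IsAlternating n (λ vs → x * ω vs - ω′ vs)
  alternating-comb {n = zero}  x ω ω′ _ _ = tt
  alternating-comb {n = suc n} x ω ω′ (r , cg , li , ad) (r′ , cg′ , li′ , ad′) =
    (λ v → alternating-comb x _ _ (r v) (r′ v)) ,
    (λ eq vs → +-cong (*-congˡ (cg eq vs)) (-‿cong (cg′ eq vs))) ,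
    (λ y v w vs → trans (+-cong (*-congˡ (li y v w vs)) (-‿cong (li′ y v w vs))) (rearr y (ω (v ∷ vs)) (ω (w ∷ vs)) (ω′ (v ∷ vs)) (ω′ (w ∷ vs)))) ,
    adj n ω ω′ ad ad′
    where
    adj : ∀ n (ω ω′ : Vec (Row _) (suc n) → Carrier) → Adjacent n ω → Adjacent n ω′ → Adjacent n (λ vs → x * ω vs - ω′ vs)
    adj zero    _ _ _ _ = tt
    adj (suc n) _ _ p q v vs = trans (+-cong (trans (*-congˡ (p v vs)) (zeroʳ x)) (-‿cong (q v vs))) (-‿inverseʳ 0#)
    rearr : ∀ y p q p′ q′ → x * (y * p + q) - (y * p′ + q′) ≈ y * (x * p - p′) + (x * q - q′)
    rearr = solve 6 (λ x y p q p′ q′ → x :* (y :* p :+ q) :- (y :* p′ :+ q′) := y :* (x :* p :- p′) :+ (x :* q :- q′)) refl x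

  alternating-tail : (ω : Vec (Row m) n → Carrier) → IsAlternating n ω →
                     IsAlternating n (λ vs → ω (map tail vs))
  alternating-tail {n = zero}  ω _ = tt
  alternating-tail {n = suc n} ω (r , cg , li , ad) =
    (λ v → alternating-tail _ (r (tail v))) ,
    (λ eq vs → cg (eq ∘ suc) _) ,
    (λ y v w vs → li y (tail v) (tail w) _) ,
    adj n ω ad
    where
    adj : ∀ n (ω : Vec (Row _) (suc n) → Carrier) → Adjacent n ω → Adjacent n (λ vs → ω (map tail vs))
    adj zero    _ _ = tt
    adj (suc n) _ p v vs = p (tail v) (map tail vs)

  -- With two equal leading vectors, the two terms in which the functional takes one of them cancel,
  -- and every other term evaluates ω at a repeated vector.
  wedge-alternating : (ω : Vec (Row m) n → Carrier) → IsAlternating n ω →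
                      IsAlternating (suc n) (λ vs → wedge (map head vs) ω (map tail vs))
  wedge-alternating {n = zero} ω _ =
    (λ _ → tt) ,
    (λ { eq [] → *-congʳ (eq zero) }) ,
    (λ { y v w [] → trans (distribʳ _ _ _) (+-congʳ (*-assoc _ _ _)) }) ,
    tt
  wedge-alternating {n = suc n} ω alt@(r , cg , li , ad) =
    (λ v → alternating-comb (head v) _ _ (alternating-tail ω alt) (wedge-alternating _ (r (tail v)))) ,
    (λ eq vs → +-cong (*-congʳ (eq zero)) (-‿cong (wedge-cong (map head vs) (cg (eq ∘ suc)) (map tail vs)))) ,
    (λ y v w vs → begin
      (y * head v + head w) * ω (map tail vs) - wedge (map head vs) (λ ws → ω ((λ i → y * tail v i + tail w i) ∷ ws)) (map tail vs)
        ≈⟨ +-congˡ (-‿cong (trans (wedge-cong (map head vs) (li y (tail v) (tail w)) (map tail vs)) (wedge-linear (map head vs) y _ _ (map tail vs)))) ⟩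
      (y * head v + head w) * ω (map tail vs) - (y * wedge (map head vs) (λ ws → ω (tail v ∷ ws)) (map tail vs) + wedge (map head vs) (λ ws → ω (tail w ∷ ws)) (map tail vs))
        ≈⟨ rearr y (head v) (head w) (ω (map tail vs)) _ _ ⟩
      _ ∎) ,
    adj n ω alt
    where
    rearr : ∀ y p q s t u → (y * p + q) * s - (y * t + u) ≈ y * (p * s - t) + (q * s - u)
    rearr = solve 6 (λ y p q s t u → (y :* p :+ q) :* s :- (y :* t :+ u) := y :* (p :* s :- t) :+ (q :* s :- u)) refl
    adj : ∀ n (ω : Vec (Row _) (suc n) → Carrier) → IsAlternating (suc n) ω →
          ∀ v vs → wedge (map head (v ∷ v ∷ vs)) ω (map tail (v ∷ v ∷ vs)) ≈ 0#
    adj zero    ω _ v [] = -‿inverseʳ _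
    adj (suc n) ω (_ , _ , _ , p) v vs = begin
      x - (x - y)  ≈⟨ +-congˡ (-‿cong (+-congˡ (-‿cong (wedge-zero (map head vs) (λ ws → p (tail v) ws) (map tail vs))))) ⟩
      x - (x - 0#)  ≈⟨ +-congˡ (-‿cong (trans (+-congˡ -0#≈0#) (+-identityʳ _))) ⟩
      x - x  ≈⟨ -‿inverseʳ _ ⟩
      0#  ∎
      where
      x = head v * ω (tail v ∷ map tail vs)
      y = wedge (map head vs) (λ ws → ω (tail v ∷ tail v ∷ ws)) (map tail vs)

  det-alternating : ∀ n → IsAlternating n (det n)
  det-alternating zero    = tt
  det-alternating (suc n) = wedge-alternating (det n) (det-alternating n)

  -- In the multilinear expansion, terms with b in two places vanish; those with b in one place,
  -- moved to the front with its sign, make up the wedge.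
  alternating-expand : ∀ {A : Set a} (ω : Vec (Row m) (suc n) → Carrier) → IsAlternating (suc n) ω →
    ∀ b (x : A → Carrier) (f : A → Row m) rs →
    ω (map (λ r i → x r * b i + f r i) rs) ≈ ω (map f rs) + wedge (map x rs) (λ ws → ω (b ∷ ws)) (map f rs)
  alternating-expand {n = zero}  ω (_ , _ , li , _) b x f (r ∷ []) = trans (li (x r) b (f r) []) (+-comm _ _)
  alternating-expand {n = suc n} ω alt@(rest , _ , li , ad) b x f (r ∷ rs) = begin
    ω ((λ i → x r * b i + f r i) ∷ X)  ≈⟨ li (x r) b (f r) X ⟩
    x r * ω (b ∷ X) + ω (f r ∷ X)  ≈⟨ +-cong (*-congˡ bX) fX ⟩
    x r * ω (b ∷ F) + (ω (f r ∷ F) - w)  ≈⟨ +-assoc _ _ _ ⟨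
    x r * ω (b ∷ F) + ω (f r ∷ F) - w  ≈⟨ +-congʳ (+-comm _ _) ⟩
    ω (f r ∷ F) + x r * ω (b ∷ F) - w  ≈⟨ +-assoc _ _ _ ⟩
    ω (f r ∷ F) + (x r * ω (b ∷ F) - w)  ∎
    where
    X = map (λ r i → x r * b i + f r i) rs
    F = map f rs
    w = wedge (map x rs) (λ ws → ω (b ∷ f r ∷ ws)) F
    bX : ω (b ∷ X) ≈ ω (b ∷ F)
    bX = trans (alternating-expand _ (rest b) b x f rs)
               (trans (+-congˡ (wedge-zero (map x rs) (ad b) F)) (+-identityʳ _))
    fX : ω (f r ∷ X) ≈ ω (f r ∷ F) - w
    fX = trans (alternating-expand _ (rest (f r)) b x f rs) (+-congˡ (begin
      wedge (map x rs) (λ ws → ω (f r ∷ b ∷ ws)) F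
        ≈⟨ wedge-cong (map x rs) (λ ws → trans (alternating-swap ω alt (f r) b ws) (trans (sym (-1*x≈-x _)) (*-comm _ _))) F ⟩
      wedge (map x rs) (λ ws → ω (b ∷ f r ∷ ws) * - 1#) F
        ≈⟨ wedge-scale (map x rs) (- 1#) _ F ⟩
      w * - 1#  ≈⟨ *-comm _ _ ⟩
      - 1# * w  ≈⟨ -1*x≈-x w ⟩
      - w  ∎))

  infixl 7 _·_
  _·_ : Row n → (Fin n → Row m) → Row m
  (r · b) t = sum (λ j → r j * b j t)

  -- Induction on k: expanding along `b zero` leaves either the same number of arguments in the span
  -- of one row fewer, or one argument fewer as well.
  alternating-vanish : ∀ k n (b : Fin k → Row m) (ω : Vec (Row m) n → Carrier) → IsAlternating n ω →
                       k ℕ.< n → ∀ rs → ω (map (_· b) rs) ≈ 0#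
  alternating-vanish zero    (suc n) b ω alt k<n (r ∷ rs) = alternating-zero ω alt (λ _ → refl) _
  alternating-vanish (suc k) (suc n) b ω alt k<n rs = begin
    ω (map (_· b) rs)
      ≈⟨ alternating-expand ω alt (b zero) head (λ r → tail r · (b ∘ suc)) rs ⟩
    ω (map (λ r → tail r · (b ∘ suc)) rs) + wedge (map head rs) (λ ws → ω (b zero ∷ ws)) (map (λ r → tail r · (b ∘ suc)) rs)
      ≈⟨ +-cong (trans (reflexive (≡.cong ω (map-∘ _ tail rs))) (alternating-vanish k (suc n) (b ∘ suc) ω alt (ℕ.<-trans (ℕ.n<1+n k) k<n) (map tail rs)))
                (trans (wedge-map (map head rs) (λ r → tail r · (b ∘ suc)) _ rs)
                       (wedge-zero (map head rs) (λ ws → trans (reflexive (≡.cong (λ z → ω (b zero ∷ z)) (map-∘ _ tail ws)))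
                         (alternating-vanish k n (b ∘ suc) _ (proj₁ alt (b zero)) (ℕ.≤-pred k<n) (map tail ws))) rs)) ⟩
    0# + 0#  ≈⟨ +-identityˡ 0# ⟩
    0#  ∎

  -- Uniqueness of top-degree alternating forms. Along `b zero`, the term without it vanishes for
  -- lack of rows, and the wedge that remains is the Laplace expansion defining `det`.
  alternating-det : ∀ n (b : Fin n → Row m) (ω : Vec (Row m) n → Carrier) → IsAlternating n ω →
                    ∀ rs → ω (map (_· b) rs) ≈ det n rs * ω (tabulate b)
  alternating-det zero    b ω alt [] = sym (*-identityˡ _)
  alternating-det (suc n) b ω alt rs = begin
    ω (map (_· b) rs)
      ≈⟨ alternating-expand ω alt (b zero) head (λ r → tail r · (b ∘ suc)) rs ⟩
    ω (map (λ r → tail r · (b ∘ suc)) rs) + wedge (map head rs) (λ ws → ω (b zero ∷ ws)) (map (λ r → tail r · (b ∘ suc)) rs)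
      ≈⟨ +-cong (trans (reflexive (≡.cong ω (map-∘ _ tail rs))) (alternating-vanish n (suc n) (b ∘ suc) ω alt (ℕ.n<1+n n) (map tail rs)))
                (reflexive (≡.cong (wedge (map head rs) _) (map-∘ _ tail rs))) ⟩
    0# + wedge (map head rs) (λ ws → ω (b zero ∷ ws)) (map (_· (b ∘ suc)) (map tail rs))
      ≈⟨ +-identityˡ _ ⟩
    wedge (map head rs) (λ ws → ω (b zero ∷ ws)) (map (_· (b ∘ suc)) (map tail rs))
      ≈⟨ wedge-map (map head rs) (_· (b ∘ suc)) _ (map tail rs) ⟩
    wedge (map head rs) (λ ws → ω (b zero ∷ map (_· (b ∘ suc)) ws)) (map tail rs)
      ≈⟨ wedge-cong (map head rs) (alternating-det n (b ∘ suc) _ (proj₁ alt (b zero))) (map tail rs) ⟩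
    wedge (map head rs) (λ ws → det n ws * ω (tabulate b)) (map tail rs)
      ≈⟨ wedge-scale (map head rs) _ (det n) (map tail rs) ⟩
    det (suc n) rs * ω (tabulate b) ∎

  alternating-cong : (ω : Vec (Row m) n → Carrier) → IsAlternating n ω →
                     ∀ {b b′ : Fin n → Row m} → (∀ i → b i ≋ b′ i) → ω (tabulate b) ≈ ω (tabulate b′)
  alternating-cong {n = zero}  ω _ eq = refl
  alternating-cong {n = suc n} ω (r , cg , _) {b} {b′} eq =
    trans (cg (eq zero) _) (alternating-cong _ (r (b′ zero)) (eq ∘ suc))

  Matrix : ℕ → Set c
  Matrix n = Fin n → Row n

  ∣_∣ : Matrix n → Carrier
  ∣ A ∣ = det _ (tabulate A)

  infixl 7 _∙_
  _∙_ : Matrix n → Matrix n → Matrix n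
  (A ∙ B) i = A i · B

  ∣∣-cong : {A B : Matrix n} → (∀ i → A i ≋ B i) → ∣ A ∣ ≈ ∣ B ∣
  ∣∣-cong = alternating-cong (det _) (det-alternating _)

  -- Uniqueness of alternating forms, applied to `det` itself and the rows of B.
  ∣∣-homo : (A B : Matrix n) → ∣ A ∙ B ∣ ≈ ∣ A ∣ * ∣ B ∣
  ∣∣-homo {n} A B = begin
    det n (tabulate (λ i → A i · B))  ≡⟨ ≡.cong (det n) (tabulate-∘ (_· B) A) ⟩
    det n (map (_· B) (tabulate A))  ≈⟨ alternating-det n B (det n) (det-alternating n) (tabulate A) ⟩
    ∣ A ∣ * ∣ B ∣  ∎

  δ : Fin m → Fin m → Carrier
  δ zero    zero    = 1#
  δ zero    (suc j) = 0#
  δ (suc i) zero    = 0#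
  δ (suc i) (suc j) = δ i j

  scalar : Carrier → Matrix n
  scalar x i j = x * δ i j

  private
    wedge-zeros : ∀ {A : Set a} {n k} (f : Fin (suc n) → Row (suc k)) → (∀ i → f i zero ≈ 0#) →
                  ∀ (ω : Vec A n → Carrier) vs → wedge (map head (tabulate f)) ω vs ≈ 0#
    wedge-zeros {n = zero}  f eq ω vs = trans (*-congʳ (eq zero)) (zeroˡ _)
    wedge-zeros {n = suc n} f eq ω (v ∷ vs) = begin
      f zero zero * ω vs - _  ≈⟨ +-cong (trans (*-congʳ (eq zero)) (zeroˡ _)) (-‿cong (wedge-zeros (f ∘ suc) (eq ∘ suc) _ vs)) ⟩
      0# - 0#  ≈⟨ -‿inverseʳ 0# ⟩
      0#  ∎

    x-0 : ∀ x → x - 0# ≈ x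
    x-0 x = trans (+-congˡ -0#≈0#) (+-identityʳ x)

  det-first-column : ∀ (A : Matrix (suc n)) → (∀ i → A (suc i) zero ≈ 0#) →
                     ∣ A ∣ ≈ A zero zero * ∣ (λ i → tail (A (suc i))) ∣
  det-first-column {zero}  A eq = refl
  det-first-column {suc n} A eq = begin
    A zero zero * det (suc n) (map tail (tabulate (A ∘ suc))) - _
      ≈⟨ +-congˡ (-‿cong (wedge-zeros (A ∘ suc) eq _ _)) ⟩
    A zero zero * det (suc n) (map tail (tabulate (A ∘ suc))) - 0#  ≈⟨ x-0 _ ⟩
    A zero zero * det (suc n) (map tail (tabulate (A ∘ suc)))
      ≡⟨ ≡.cong (λ z → A zero zero * det (suc n) z) (tabulate-∘ tail (A ∘ suc)) ⟨
    A zero zero * ∣ (λ i → tail (A (suc i))) ∣  ∎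

  ∣scalar∣ : ∀ n x → ∣ scalar {n} x ∣ ≈ x ^ n
  ∣scalar∣ zero    x = refl
  ∣scalar∣ (suc n) x = trans (det-first-column (scalar {suc n} x) (λ _ → zeroʳ x))
                             (*-cong (*-identityʳ x) (∣scalar∣ n x))

  -- The matrix of multiplication by u⁻¹ in the basis 1, u, …, uⁿ, where x = u^-(n+1).
  shift : Carrier → Matrix (suc n)
  shift x zero    j = x * δ (fromℕ _) j
  shift x (suc i)   = δ (inject₁ i)

  -- The first column has its only nonzero entry, 1, in the second row; expanding there costs a sign
  -- and leaves the same kind of matrix one size smaller.
  ∣shift∣ : ∀ n x → ∣ shift {n} x ∣ ≈ (- 1#) ^ n * x
  ∣shift∣ zero    x = trans (*-identityʳ _) (trans (*-identityʳ x) (sym (*-identityˡ x)))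
  ∣shift∣ (suc n) x = begin
    x * 0# * _ - wedge (map head (tabulate S)) ω (map tail (tabulate S))
      ≈⟨ +-congʳ (trans (*-congʳ (zeroʳ x)) (zeroˡ _)) ⟩
    0# - wedge (map head (tabulate S)) ω (map tail (tabulate S))
      ≈⟨ +-identityˡ _ ⟩
    - wedge (map head (tabulate S)) ω (map tail (tabulate S))
      ≈⟨ -‿cong (wedge-unit n) ⟩
    - ω (map tail (tabulate (S ∘ suc)))
      ≡⟨ ≡.cong (λ z → - ω z) (tabulate-∘ tail (S ∘ suc)) ⟨
    - ∣ shift {n} x ∣  ≈⟨ -‿cong (∣shift∣ n x) ⟩
    - ((- 1#) ^ n * x)  ≈⟨ -1*x≈-x _ ⟨
    - 1# * ((- 1#) ^ n * x)  ≈⟨ *-assoc _ _ _ ⟨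
    (- 1#) ^ suc n * x  ∎
    where
    S : Fin (suc n) → Row (suc (suc n))
    S i = shift x (suc i)
    ω : Vec (Row (suc n)) n → Carrier
    ω ws = det (suc n) (tail (shift x zero) ∷ ws)
    wedge-unit : ∀ n {ω : Vec (Row (suc n)) n → Carrier} →
      wedge (map head (tabulate {n = suc n} (λ i → shift x (suc i)))) ω (map tail (tabulate {n = suc n} (λ i → shift x (suc i))))
      ≈ ω (map tail (tabulate {n = n} (λ i → shift x (suc (suc i)))))
    wedge-unit zero    = *-identityˡ _
    wedge-unit (suc n) = trans (+-cong (*-identityˡ _) (-‿cong (wedge-zeros {n = n} (λ i → shift x (suc (suc i))) (λ _ → refl) _ _))) (x-0 _)

  module _ {p} (P : Carrier → Set p) (P-resp : ∀ {x y} → x ≈ y → P x → P y)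
           (P-* : ∀ {x y} → P x → P y → P (x * y)) (P-- : ∀ {x y} → P x → P y → P (x - y)) (P-1 : P 1#) where

    wedge-closed : ∀ {A : Set a} {Q : A → Set p} {cs : Vec Carrier (suc n)} {ω : Vec A n → Carrier} {vs} →
      VecAll.All P cs → (∀ {ws} → VecAll.All Q ws → P (ω ws)) → VecAll.All Q vs → P (wedge cs ω vs)
    wedge-closed {n = zero}  (p VecAll.∷ _)  q _        = P-* p (q VecAll.[])
    wedge-closed {n = suc n} (p VecAll.∷ ps) q (r VecAll.∷ rs) = P-- (P-* p (q rs)) (wedge-closed ps (λ s → q (r VecAll.∷ s)) rs)

    det-closed : ∀ n {vs} → VecAll.All (λ v → ∀ i → P (v i)) vs → P (det n vs)
    det-closed zero    _  = P-1
    det-closed (suc n) ps = wedge-closed (VecAll.map⁺ (VecAll.map (λ p → p zero) ps)) (det-closed n)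
                        (VecAll.map⁺ (VecAll.map (λ p → p ∘ suc) ps))

    -- This places norms in K: the matrices of multiplications have their entries there.
    ∣∣-closed : {A : Matrix n} → (∀ i j → P (A i j)) → P ∣ A ∣
    ∣∣-closed ps = det-closed _ (VecAll.tabulate⁺ ps)

prime>0 : ∀ {p} → Prime p → 0 ℕ.< p
prime>0 pr = ℕ.>-nonZero⁻¹ _ {{prime⇒nonZero pr}}

<prime⇒coprime : ∀ {p d} → Prime p → 0 ℕ.< d → d ℕ.< p → Coprime d p
<prime⇒coprime pr 0<d d<p = Coprime.sym (Coprime.prime⇒coprime pr {{ℕ.>-nonZero 0<d}} d<p)

module _ (em : ∀ {a} → ExcludedMiddle a) where

  by-contradiction : ∀ {a} {A : Set a} → ¬ ¬ A → A
  by-contradiction {A = A} ¬¬a with em {P = A}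
  ... | yes a  = a
  ... | no  ¬a = contradiction ¬a ¬¬a

  least : ∀ {a} (P : ℕ → Set a) {n} → P n → ∃[ d ] (d ℕ.≤ n × P d × (∀ {m} → m ℕ.< d → ¬ P m))
  least P {n} Pn = go n Pn (ℕ.<-wellFounded n)
    where
    go : ∀ n → P n → Acc ℕ._<_ n → ∃[ d ] (d ℕ.≤ n × P d × (∀ {m} → m ℕ.< d → ¬ P m))
    go n Pn (acc rec) with em {P = ∃[ m ] (m ℕ.< n × P m)}
    ... | no  ¬m            = n , ℕ.≤-refl , Pn , λ m<n Pm → ¬m (_ , m<n , Pm)
    ... | yes (m , m<n , Pm) with go m Pm (rec m<n)
    ...   | d , d≤m , Pd , min = d , ℕ.≤-trans d≤m (ℕ.<⇒≤ m<n) , Pd , min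

-- Fields, and linear algebra over subfields of L.

module Field (em : ∀ {a} → ExcludedMiddle a) {c ℓ} (L : CommutativeRing c ℓ) (L-field : IsField L) where
  open CommutativeRing L hiding (zero) public
  open import Algebra.Properties.Ring ring public
  open import Algebra.Properties.Semiring.Sum semiring public
  open import Algebra.Properties.CommutativeSemiring.Exp commutativeSemiring public
  open import Algebra.Properties.Semiring.Mult semiring public renaming (_×_ to _×ᴿ_)
  open import Relation.Binary.Reasoning.Setoid setoid public
  open IntegerSolver L public

  1≉0 : 1# ≉ 0#
  1≉0 = proj₁ L-field ∘ sym

  -- 0# ⁻¹ is 0#.
  infix 9 _⁻¹
  _⁻¹ : Carrier → Carrier
  x ⁻¹ with em {P = x ≈ 0#}
  ... | yes _   = 0#
  ... | no  x≉0 = proj₁ (proj₂ L-field x x≉0)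

  ⁻¹-inverseˡ : ∀ {x} → x ≉ 0# → x ⁻¹ * x ≈ 1#
  ⁻¹-inverseˡ {x} x≉0 with em {P = x ≈ 0#}
  ... | yes x≈0 = contradiction x≈0 x≉0
  ... | no  x≉0 = proj₁ (proj₂ (proj₂ L-field x x≉0))

  ⁻¹-inverseʳ : ∀ {x} → x ≉ 0# → x * x ⁻¹ ≈ 1#
  ⁻¹-inverseʳ x≉0 = trans (*-comm _ _) (⁻¹-inverseˡ x≉0)

  ⁻¹-zero : ∀ {x} → x ≈ 0# → x ⁻¹ ≈ 0#
  ⁻¹-zero {x} x≈0 with em {P = x ≈ 0#}
  ... | yes _   = refl
  ... | no  x≉0 = contradiction x≈0 x≉0

  *-cancelˡ : ∀ {x y z} → x ≉ 0# → x * y ≈ x * z → y ≈ z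
  *-cancelˡ {x} {y} {z} x≉0 xy≈xz = begin
    y  ≈⟨ *-identityˡ y ⟨
    1# * y  ≈⟨ *-congʳ (⁻¹-inverseˡ x≉0) ⟨
    x ⁻¹ * x * y  ≈⟨ *-assoc _ _ _ ⟩
    x ⁻¹ * (x * y)  ≈⟨ *-congˡ xy≈xz ⟩
    x ⁻¹ * (x * z)  ≈⟨ *-assoc _ _ _ ⟨
    x ⁻¹ * x * z  ≈⟨ *-congʳ (⁻¹-inverseˡ x≉0) ⟩
    1# * z  ≈⟨ *-identityˡ z ⟩
    z  ∎

  *≈0 : ∀ {x y} → x ≉ 0# → x * y ≈ 0# → y ≈ 0#
  *≈0 x≉0 eq = *-cancelˡ x≉0 (trans eq (sym (zeroʳ _)))

  *≉0 : ∀ {x y} → x ≉ 0# → y ≉ 0# → x * y ≉ 0#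
  *≉0 x≉0 y≉0 = y≉0 ∘ *≈0 x≉0

  *≉0⇒ˡ : ∀ {x y} → x * y ≉ 0# → x ≉ 0#
  *≉0⇒ˡ xy≉0 x≈0 = xy≉0 (trans (*-congʳ x≈0) (zeroˡ _))

  *≉0⇒ʳ : ∀ {x y} → x * y ≉ 0# → y ≉ 0#
  *≉0⇒ʳ xy≉0 y≈0 = xy≉0 (trans (*-congˡ y≈0) (zeroʳ _))

  ^≉0 : ∀ {x} n → x ≉ 0# → x ^ n ≉ 0#
  ^≉0 zero    x≉0 = 1≉0
  ^≉0 (suc n) x≉0 = *≉0 x≉0 (^≉0 n x≉0)

  ⁻¹-unique : ∀ {x y} → x * y ≈ 1# → y ≈ x ⁻¹
  ⁻¹-unique {x} xy≈1 = *-cancelˡ x≉0 (trans xy≈1 (sym (⁻¹-inverseʳ x≉0)))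
    where
    x≉0 : x ≉ 0#
    x≉0 = *≉0⇒ˡ (1≉0 ∘ trans (sym xy≈1))

  ⁻¹≉0 : ∀ {x} → x ≉ 0# → x ⁻¹ ≉ 0#
  ⁻¹≉0 x≉0 = *≉0⇒ˡ (1≉0 ∘ trans (sym (⁻¹-inverseˡ x≉0)))

  ⁻¹-cong : ∀ {x y} → x ≈ y → x ⁻¹ ≈ y ⁻¹
  ⁻¹-cong {x} {y} x≈y = case em {P = y ≈ 0#} of λ where
    (yes y≈0) → trans (⁻¹-zero (trans x≈y y≈0)) (sym (⁻¹-zero y≈0))
    (no  y≉0) → sym (⁻¹-unique (trans (*-congʳ x≈y) (⁻¹-inverseʳ y≉0)))

  1^ : ∀ n → 1# ^ n ≈ 1#
  1^ zero    = refl
  1^ (suc n) = trans (*-identityˡ _) (1^ n)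

  ^-suc : ∀ x n → x ^ suc n ≈ x ^ n * x
  ^-suc x n = *-comm _ _

  ^-comm : ∀ x m n → (x ^ m) ^ n ≈ (x ^ n) ^ m
  ^-comm x m n = trans (^-assocʳ x m n) (trans (^-congʳ x (ℕ.*-comm m n)) (sym (^-assocʳ x n m)))

  ⁻¹-^ : ∀ {x} n → x ≉ 0# → (x ⁻¹) ^ n * x ^ n ≈ 1#
  ⁻¹-^ {x} n x≉0 = trans (sym (^-distrib-* (x ⁻¹) x n)) (trans (^-congˡ n (⁻¹-inverseˡ x≉0)) (1^ n))

  x-y≈0⇒x≈y : ∀ {x y} → x - y ≈ 0# → x ≈ y
  x-y≈0⇒x≈y {x} {y} eq = trans (+-inverseˡ-unique x (- y) eq) (-‿involutive y)

  ≈0+≈0 : ∀ {x y} → x ≈ 0# → y ≈ 0# → x + y ≈ 0#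
  ≈0+≈0 p q = trans (+-cong p q) (+-identityˡ 0#)

  sum-cong : ∀ {n} {f g : Fin n → Carrier} → (∀ i → f i ≈ g i) → sum f ≈ sum g
  sum-cong = sum-cong-≋

  sum-zero : ∀ {n} {f : Fin n → Carrier} → (∀ i → f i ≈ 0#) → sum f ≈ 0#
  sum-zero {n} eq = trans (sum-cong eq) (sum-replicate-zero n)

  sum-neg : ∀ {n} (f : Fin n → Carrier) → sum (λ i → - f i) ≈ - sum f
  sum-neg f = begin
    sum (λ i → - f i)  ≈⟨ sum-cong (λ i → -1*x≈-x (f i)) ⟨
    sum (λ i → - 1# * f i)  ≈⟨ *-distribˡ-sum (- 1#) f ⟨
    - 1# * sum f  ≈⟨ -1*x≈-x _ ⟩
    - sum f  ∎

  sum-scale : ∀ {n} x (f g : Fin n → Carrier) → x * sum (λ i → f i * g i) ≈ sum (λ i → (x * f i) * g i)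
  sum-scale x f g = trans (*-distribˡ-sum x (λ i → f i * g i)) (sum-cong (λ i → sym (*-assoc x (f i) (g i))))

  sum-+* : ∀ {n} (f g h : Fin n → Carrier) →
           sum (λ i → (f i + g i) * h i) ≈ sum (λ i → f i * h i) + sum (λ i → g i * h i)
  sum-+* f g h = trans (sum-cong (λ i → distribʳ (h i) (f i) (g i))) (∑-distrib-+ (λ i → f i * h i) (λ i → g i * h i))

  sum-sum* : ∀ {m n} (a : Fin m → Carrier) (b : Fin m → Fin n → Carrier) (e : Fin n → Carrier) →
             sum (λ j → sum (λ i → a i * b i j) * e j) ≈ sum (λ i → a i * sum (λ j → b i j * e j))
  sum-sum* a b e = begin
    sum (λ j → sum (λ i → a i * b i j) * e j)
      ≈⟨ sum-cong (λ j → *-distribʳ-sum (e j) (λ i → a i * b i j)) ⟩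
    sum (λ j → sum (λ i → a i * b i j * e j))
      ≈⟨ ∑-comm (λ j i → a i * b i j * e j) ⟩
    sum (λ i → sum (λ j → a i * b i j * e j))
      ≈⟨ sum-cong (λ i → trans (sum-cong (λ j → *-assoc (a i) (b i j) (e j))) (sym (*-distribˡ-sum (a i) (λ j → b i j * e j)))) ⟩
    sum (λ i → a i * sum (λ j → b i j * e j)) ∎

  open Determinant L public using (Matrix; ∣_∣; _∙_; ∣∣-cong; ∣∣-homo; ∣∣-closed; δ; scalar; ∣scalar∣; shift; ∣shift∣)

  sum-δ : ∀ {n} i (e : Fin n → Carrier) → sum (λ j → δ i j * e j) ≈ e i
  sum-δ zero    e = trans (+-cong (*-identityˡ _) (sum-zero (λ j → zeroˡ (e (suc j))))) (+-identityʳ _)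
  sum-δ (suc i) e = trans (+-cong (zeroˡ _) (sum-δ i (e ∘ suc))) (+-identityˡ _)

  -- Subrings and subfields

  -- All fields of the proof are predicates on L, so that towers need no change of carrier. Their
  -- level ρ absorbs that of L, hence spans over a subring stay at level ρ and adjunction can be
  -- iterated.
  module Subobjects (r : Level) where
    ρ : Level
    ρ = c ⊔ ℓ ⊔ r

    record Subring : Set (lsuc ρ) where
      field
        Mem  : Carrier → Set ρ
        resp : ∀ {x y} → x ≈ y → Mem x → Mem y
        1∈   : Mem 1#
        +∈   : ∀ {x y} → Mem x → Mem y → Mem (x + y)
        *∈   : ∀ {x y} → Mem x → Mem y → Mem (x * y)
        -∈   : ∀ {x} → Mem x → Mem (- x)

      0∈ : Mem 0#
      0∈ = resp (-‿inverseʳ 1#) (+∈ 1∈ (-∈ 1∈))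

      ^∈ : ∀ {x} n → Mem x → Mem (x ^ n)
      ^∈ zero    _ = 1∈
      ^∈ (suc n) p = *∈ p (^∈ n p)

      sum∈ : ∀ {n} {f : Fin n → Carrier} → (∀ i → Mem (f i)) → Mem (sum f)
      sum∈ {zero}  p = 0∈
      sum∈ {suc n} p = +∈ (p zero) (sum∈ (p ∘ suc))

      ×1∈ : ∀ n → Mem (n ×ᴿ 1#)
      ×1∈ zero    = 0∈
      ×1∈ (suc n) = +∈ 1∈ (×1∈ n)

      δ∈ : ∀ {n} (i j : Fin n) → Mem (δ i j)
      δ∈ zero    zero    = 1∈
      δ∈ zero    (suc j) = 0∈
      δ∈ (suc i) zero    = 0∈
      δ∈ (suc i) (suc j) = δ∈ i j

      ∣∣∈ : ∀ {n} {A : Matrix n} → (∀ i j → Mem (A i j)) → Mem ∣ A ∣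
      ∣∣∈ = ∣∣-closed Mem resp *∈ (λ p q → +∈ p (-∈ q)) 1∈

    infix 4 _∋_
    _∋_ : Subring → Carrier → Set ρ
    P ∋ x = Subring.Mem P x

    record Subfield : Set (lsuc ρ) where
      field
        subring : Subring
      open Subring subring public
      field
        ⁻¹∈ : ∀ {x} → Mem x → Mem (x ⁻¹)

      cancel∈ : ∀ {x y} → x ≉ 0# → Mem x → Mem (x * y) → Mem y
      cancel∈ {x} {y} x≉0 p q = resp eq (*∈ (⁻¹∈ p) q)
        where
        eq : x ⁻¹ * (x * y) ≈ y
        eq = trans (sym (*-assoc _ _ _)) (trans (*-congʳ (⁻¹-inverseˡ x≉0)) (*-identityˡ y))

    record InSpan (P : Subring) {n} (e : Fin n → Carrier) (x : Carrier) : Set ρ where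
      constructor combination
      field
        coefficient  : Fin n → Carrier
        coefficient∈ : ∀ i → P ∋ coefficient i
        expansion    : x ≈ sum (λ i → coefficient i * e i)
    open InSpan public

    module _ {P : Subring} where
      open Subring P
      private
        variable
          m n : ℕ
          e e′ : Fin n → Carrier
          x y : Carrier

      span-resp : x ≈ y → InSpan P e x → InSpan P e y
      span-resp x≈y (combination a a∈ eq) = combination a a∈ (trans (sym x≈y) eq)

      span-+ : InSpan P e x → InSpan P e y → InSpan P e (x + y)
      span-+ (combination a a∈ eq) (combination b b∈ eq′) =
        combination (λ i → a i + b i) (λ i → +∈ (a∈ i) (b∈ i)) (trans (+-cong eq eq′) (sym (sum-+* a b _)))

      span-* : P ∋ y → InSpan P e x → InSpan P e (y * x)
      span-* {y} y∈ (combination a a∈ eq) =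
        combination (λ i → y * a i) (λ i → *∈ y∈ (a∈ i)) (trans (*-congˡ eq) (sum-scale y a _))

      span-neg : InSpan P e x → InSpan P e (- x)
      span-neg p = span-resp (-1*x≈-x _) (span-* (-∈ 1∈) p)

      span-0 : InSpan P e 0#
      span-0 {e = e} = combination (λ _ → 0#) (λ _ → 0∈) (sym (sum-zero (λ i → zeroˡ (e i))))

      span-gen : ∀ i → InSpan P e (e i)
      span-gen i = combination (δ i) (δ∈ i) (sym (sum-δ i _))

      span-sum : (f : Fin m → Carrier) → (∀ i → InSpan P e (f i)) → InSpan P e (sum f)
      span-sum {m = zero}  f p = span-0
      span-sum {m = suc m} f p = span-+ (p zero) (span-sum (f ∘ suc) (p ∘ suc))

      span-trans : (∀ i → InSpan P e′ (e i)) → InSpan P e x → InSpan P e′ x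
      span-trans p (combination a a∈ eq) = span-resp (sym eq) (span-sum (λ i → a i * _) (λ i → span-* (a∈ i) (p i)))

      span-*ʳ : ∀ z → (∀ i → InSpan P e′ (e i * z)) → InSpan P e x → InSpan P e′ (x * z)
      span-*ʳ {e = e} z p (combination a a∈ eq) = span-resp (sym (trans (*-congʳ eq) (trans (*-distribʳ-sum z (λ i → a i * e i)) (sum-cong (λ i → *-assoc (a i) (e i) z)))))
                        (span-sum (λ i → a i * (e i * z)) (λ i → span-* (a∈ i) (p i)))

    record Independent (P : Subring) {n} (e : Fin n → Carrier) : Set ρ where
      constructor independent
      field
        coefficient≈0 : ∀ (a : Fin n → Carrier) → (∀ i → P ∋ a i) → sum (λ i → a i * e i) ≈ 0# → ∀ i → a i ≈ 0#
    open Independent public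

    record Dependent (P : Subring) {n} (e : Fin n → Carrier) : Set ρ where
      constructor relation
      field
        scalars  : Fin n → Carrier
        scalars∈ : ∀ i → P ∋ scalars i
        vanishes     : sum (λ i → scalars i * e i) ≈ 0#
        index        : Fin n
        scalars≉0 : scalars index ≉ 0#

    ¬dependent⇒independent : ∀ {P n} {e : Fin n → Carrier} → ¬ Dependent P e → Independent P e
    ¬dependent⇒independent ¬dep = independent λ a a∈ eq i → by-contradiction em (λ ai≉0 → ¬dep (relation a a∈ eq i ai≉0))

    independent-unique : ∀ {P n} {e : Fin n → Carrier} → Independent P e →
      ∀ {a b} → (∀ i → P ∋ a i) → (∀ i → P ∋ b i) →
      sum (λ i → a i * e i) ≈ sum (λ i → b i * e i) → ∀ i → a i ≈ b i
    independent-unique {P} {e = e} ind {a} {b} a∈ b∈ eq i = x-y≈0⇒x≈y (coefficient≈0 ind (λ i → a i - b i) (λ i → +∈ (a∈ i) (-∈ (b∈ i))) diff i)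
      where
      open Subring P
      diff : sum (λ i → (a i - b i) * e i) ≈ 0#
      diff = begin
        sum (λ i → (a i - b i) * e i)  ≈⟨ sum-+* a (-_ ∘ b) e ⟩
        sum (λ i → a i * e i) + sum (λ i → - b i * e i)  ≈⟨ +-congˡ (trans (sum-cong (λ i → sym (-‿distribˡ-* (b i) (e i)))) (sum-neg (λ i → b i * e i))) ⟩
        sum (λ i → a i * e i) - sum (λ i → b i * e i)  ≈⟨ +-congʳ eq ⟩
        sum (λ i → b i * e i) - sum (λ i → b i * e i)  ≈⟨ -‿inverseʳ _ ⟩
        0#  ∎

    private
      -- Gaussian elimination with pivot `w k`: `v` lists the other vectors after removal of their
      -- `e zero` component, and `lift` turns a relation among them into one among all of `w`.
      module Eliminate (K : Subfield) {m n} (e : Fin (suc n) → Carrier) (w : Fin (suc m) → Carrier)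
                       (w∈ : ∀ i → InSpan (Subfield.subring K) e (w i))
                       (k : Fin (suc m)) (ak≉0 : coefficient (w∈ k) zero ≉ 0#) where
        open Subfield K
        q : Fin m → Carrier
        q i = coefficient (w∈ (punchIn k i)) zero * coefficient (w∈ k) zero ⁻¹
        v : Fin m → Carrier
        v i = w (punchIn k i) - q i * w k
        v∈ : ∀ i → InSpan subring (e ∘ suc) (v i)
        v∈ i = span-resp (sym rearranged) (span-+ (combination (a ∘ suc) (a∈ ∘ suc) refl) (span-neg (span-* (*∈ (a∈ zero) (⁻¹∈ (b∈ zero))) (combination (b ∘ suc) (b∈ ∘ suc) refl))))
          where
          open InSpan (w∈ (punchIn k i)) renaming (coefficient to a; coefficient∈ to a∈; expansion to eq)
          open InSpan (w∈ k) renaming (coefficient to b; coefficient∈ to b∈; expansion to eq′)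
          s = sum (λ j → a (suc j) * e (suc j))
          t = sum (λ j → b (suc j) * e (suc j))
          rearranged : w (punchIn k i) - a zero * b zero ⁻¹ * w k ≈ s - a zero * b zero ⁻¹ * t
          rearranged = begin
            w (punchIn k i) - a zero * b zero ⁻¹ * w k
              ≈⟨ +-cong eq (-‿cong (*-congˡ eq′)) ⟩
            (a zero * e zero + s) - a zero * b zero ⁻¹ * (b zero * e zero + t)
              ≈⟨ solve 6 (λ a b b⁻¹ e s t → (a :* e :+ s) :- a :* b⁻¹ :* (b :* e :+ t) := (s :- a :* b⁻¹ :* t) :+ a :* e :* (:1 :- b⁻¹ :* b)) refl (a zero) (b zero) (b zero ⁻¹) (e zero) s t ⟩
            (s - a zero * b zero ⁻¹ * t) + a zero * e zero * (1# - b zero ⁻¹ * b zero)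
              ≈⟨ +-congˡ (trans (*-congˡ (trans (+-congˡ (-‿cong (⁻¹-inverseˡ ak≉0))) (-‿inverseʳ 1#))) (zeroʳ _)) ⟩
            (s - a zero * b zero ⁻¹ * t) + 0#  ≈⟨ +-identityʳ _ ⟩
            s - a zero * b zero ⁻¹ * t ∎
        lift : Dependent subring v → Dependent subring w
        lift (relation d d∈ eq j dj≉0) = relation a a∈ total (punchIn k j) λ ≈0 → dj≉0 (trans (reflexive (≡.sym (insertAt-punchIn d k x j))) ≈0)
          where
          x = - sum (λ i → d i * q i)
          a : Fin (suc m) → Carrier
          a = insertAt d k x
          x∈ : subring ∋ x
          x∈ = -∈ (sum∈ (λ i → *∈ (d∈ i) (*∈ (coefficient∈ (w∈ (punchIn k i)) zero) (⁻¹∈ (coefficient∈ (w∈ k) zero)))))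
          a∈ : ∀ i → subring ∋ a i
          a∈ i with k Fin.≟ i
          ... | yes ≡.refl = ≡.subst (subring ∋_) (≡.sym (insertAt-lookup d k x)) x∈
          ... | no  k≢i    = ≡.subst (λ z → subring ∋ a z) (Fin.punchIn-punchOut k≢i)
                               (≡.subst (subring ∋_) (≡.sym (insertAt-punchIn d k x _)) (d∈ _))
          total : sum (λ i → a i * w i) ≈ 0#
          total = begin
            sum (λ i → a i * w i)
              ≈⟨ sum-remove {i = k} (λ i → a i * w i) ⟩
            a k * w k + sum (λ i → a (punchIn k i) * w (punchIn k i))
              ≈⟨ +-cong (*-congʳ (reflexive (insertAt-lookup d k x))) (sum-cong (λ i → *-congʳ (reflexive (insertAt-punchIn d k x i)))) ⟩
            x * w k + sum (λ i → d i * w (punchIn k i))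
              ≈⟨ +-comm _ _ ⟩
            sum (λ i → d i * w (punchIn k i)) + x * w k
              ≈⟨ +-congˡ (trans (sym (-‿distribˡ-* _ _)) (-‿cong (trans (*-distribʳ-sum (w k) (λ i → d i * q i)) (sum-cong (λ i → *-assoc (d i) (q i) (w k)))))) ⟩
            sum (λ i → d i * w (punchIn k i)) - sum (λ i → d i * (q i * w k))
              ≈⟨ +-congˡ (sum-neg (λ i → d i * (q i * w k))) ⟨
            sum (λ i → d i * w (punchIn k i)) + sum (λ i → - (d i * (q i * w k)))
              ≈⟨ ∑-distrib-+ (λ i → d i * w (punchIn k i)) (λ i → - (d i * (q i * w k))) ⟨
            sum (λ i → d i * w (punchIn k i) - d i * (q i * w k))
              ≈⟨ sum-cong (λ i → x[y-z]≈xy-xz (d i) _ _) ⟨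
            sum (λ i → d i * (w (punchIn k i) - q i * w k))
              ≈⟨ eq ⟩
            0# ∎

    -- One generator is eliminated at a time. Without generators every `w i` is zero, so any scalars
    -- give a relation; a generator that no `w k` involves is simply dropped.
    span-dependent : ∀ (K : Subfield) {m n} (e : Fin n → Carrier) (w : Fin m → Carrier) →
                     n ℕ.< m → (∀ i → InSpan (Subfield.subring K) e (w i)) → Dependent (Subfield.subring K) w
    span-dependent K {suc m} {zero} e w n<m w∈ =
      relation (λ _ → 1#) (λ _ → 1∈) (sum-zero (λ i → trans (*-identityˡ (w i)) (expansion (w∈ i)))) zero 1≉0
      where open Subfield K
    span-dependent K {suc m} {suc n} e w n<m w∈ = case em {P = ∃[ k ] (coefficient (w∈ k) zero ≉ 0#)} of λ where
      (no none)        → span-dependent K (e ∘ suc) w (ℕ.<-trans (ℕ.n<1+n n) n<m) λ i →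
                           combination (coefficient (w∈ i) ∘ suc) (coefficient∈ (w∈ i) ∘ suc)
                             (trans (expansion (w∈ i)) (trans (+-congʳ (trans (*-congʳ (by-contradiction em (λ ≉0 → none (i , ≉0)))) (zeroˡ _))) (+-identityˡ _)))
      (yes (k , ak≉0)) → Eliminate.lift K e w w∈ k ak≉0 (span-dependent K (e ∘ suc) _ (ℕ.≤-pred n<m) (Eliminate.v∈ K e w w∈ k ak≉0))

-- Simple extensions, degrees and norms.

module Simple (em : ∀ {a} → ExcludedMiddle a) {c ℓ} (L : CommutativeRing c ℓ) (L-field : IsField L) (r : Level) where
  open Field em L L-field
  open Subobjects r

  pow : Carrier → ∀ n → Fin n → Carrier
  pow u n i = u ^ toℕ i

  span∈ : ∀ {P Q : Subring} {n} {e : Fin n → Carrier} {x} → (∀ {y} → P ∋ y → Q ∋ y) → (∀ i → Q ∋ e i) → InSpan P e x → Q ∋ x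
  span∈ {Q = Q} P⊆Q e∈ (combination a a∈ eq) = resp (sym eq) (sum∈ (λ i → *∈ (P⊆Q (a∈ i)) (e∈ i)))
    where open Subring Q

  module _ (P : Subring) (u : Carrier) (n : ℕ) where
    open Subring P

    -- Expresses, without polynomials, that u is a root of a monic polynomial of degree n over P.
    Closes : Set ρ
    Closes = InSpan P (pow u n) (u ^ n)

    pow-gen : ∀ {k} → k ℕ.< n → InSpan P (pow u n) (u ^ k)
    pow-gen k<n = span-resp (^-congʳ u (Fin.toℕ-fromℕ< k<n)) (span-gen (fromℕ< k<n))

    module _ (0<n : 0 ℕ.< n) (closes : Closes) where

      span-shift : ∀ {x} → InSpan P (pow u n) x → InSpan P (pow u n) (x * u)
      span-shift = span-*ʳ u λ i → span-resp (^-suc u (toℕ i)) (next (Fin.toℕ<n i))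
        where
        next : ∀ {k} → k ℕ.< n → InSpan P (pow u n) (u ^ suc k)
        next k<n with ℕ.m≤n⇒m<n∨m≡n k<n
        ... | inj₁ 1+k<n    = pow-gen 1+k<n
        ... | inj₂ ≡.refl   = closes

      span-shifts : ∀ {x} k → InSpan P (pow u n) x → InSpan P (pow u n) (u ^ k * x)
      span-shifts zero    p = span-resp (sym (*-identityˡ _)) p
      span-shifts (suc k) p = span-resp (trans (*-comm _ _) (sym (*-assoc _ _ _))) (span-shift (span-shifts k p))

      base∈adjoin : ∀ {x} → P ∋ x → InSpan P (pow u n) x
      base∈adjoin p = span-resp (*-identityʳ _) (span-* p (pow-gen 0<n))

      adjoin : Subring
      adjoin = record
        { Mem  = InSpan P (pow u n)
        ; resp = span-resp
        ; 1∈   = pow-gen 0<n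
        ; +∈   = span-+
        ; *∈   = λ {x} {y} p q → span-*ʳ y (λ i → span-shifts (toℕ i) q) p
        ; -∈   = span-neg
        }

      gen∈adjoin : adjoin ∋ u
      gen∈adjoin = span-resp (trans (*-congʳ refl) (*-identityˡ u)) (span-shift (pow-gen 0<n))

  closes-mem : ∀ (P : Subring) {u n} → 0 ℕ.< n → P ∋ u ^ n → Closes P u n
  closes-mem P {u} {n} 0<n p = span-resp (*-identityʳ _) (span-* p (pow-gen P u n 0<n))

  sum-pow-suc : ∀ {n} (a : Fin (suc n) → Carrier) y →
                sum (λ i → a i * pow y (suc n) i) ≈ a zero + y * sum (λ i → a (suc i) * pow y n i)
  sum-pow-suc a y = +-cong (*-identityʳ _) (begin
    sum (λ i → a (suc i) * (y * y ^ toℕ i))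
      ≈⟨ sum-cong (λ i → solve 3 (λ a y z → a :* (y :* z) := y :* (a :* z)) refl (a (suc i)) y (y ^ toℕ i)) ⟩
    sum (λ i → y * (a (suc i) * y ^ toℕ i))
      ≈⟨ *-distribˡ-sum y (λ i → a (suc i) * y ^ toℕ i) ⟨
    y * sum (λ i → a (suc i) * y ^ toℕ i) ∎)

  sum-pow-last : ∀ {n} (a : Fin (suc n) → Carrier) y →
                 sum (λ i → a i * pow y (suc n) i) ≈ sum (λ i → a (inject₁ i) * pow y n i) + a (fromℕ n) * y ^ n
  sum-pow-last {n} a y = begin
    sum (λ i → a i * pow y (suc n) i)
      ≈⟨ sum-init-last (λ i → a i * pow y (suc n) i) ⟩
    sum (λ i → a (inject₁ i) * y ^ toℕ (inject₁ i)) + a (fromℕ n) * y ^ toℕ (fromℕ n)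
      ≈⟨ +-cong (sum-cong {f = λ i → a (inject₁ i) * y ^ toℕ (inject₁ i)} (λ i → *-congˡ {a (inject₁ i)} (^-congʳ y (Fin.toℕ-inject₁ i))))
                (*-congˡ {a (fromℕ n)} (^-congʳ y (Fin.toℕ-fromℕ n))) ⟩
    sum (λ i → a (inject₁ i) * pow y n i) + a (fromℕ n) * y ^ n ∎

  -- If the constant coefficient is nonzero, the relation reads y s = -a₀ and can be solved for the
  -- inverse inside S; otherwise y is divided out of the relation.
  algebraic-inverse : ∀ (K : Subfield) (S : Subring) → (∀ {x} → Subfield.Mem K x → S ∋ x) →
    ∀ {y} → S ∋ y → y ≉ 0# → ∀ {n} (a : Fin n → Carrier) → (∀ i → Subfield.Mem K (a i)) →
    sum (λ i → a i * pow y n i) ≈ 0# → ∀ i → a i ≉ 0# → ∃[ z ] (S ∋ z × y * z ≈ 1#)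
  algebraic-inverse K S K⊆S {y} y∈ y≉0 {suc n} a a∈ eq i ai≉0 = case em {P = a zero ≈ 0#} of λ where
      (no a0≉0) → - (a zero ⁻¹ * s) , S.-∈ (S.*∈ (K⊆S (K.⁻¹∈ (a∈ zero))) s∈) , (begin
        y * - (a zero ⁻¹ * s)
          ≈⟨ solve 4 (λ y a a⁻¹ s → y :* :- (a⁻¹ :* s) := a⁻¹ :* a :- a⁻¹ :* (a :+ y :* s)) refl y (a zero) (a zero ⁻¹) s ⟩
        a zero ⁻¹ * a zero - a zero ⁻¹ * (a zero + y * s)
          ≈⟨ +-cong (⁻¹-inverseˡ a0≉0) (-‿cong (trans (*-congˡ eq′) (zeroʳ _))) ⟩
        1# - 0#  ≈⟨ trans (+-congˡ -0#≈0#) (+-identityʳ 1#) ⟩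
        1# ∎)
      (yes a0≈0) → step a0≈0 i ai≉0
    where
    module K = Subfield K
    module S = Subring S
    s = sum (λ i → a (suc i) * pow y n i)
    s∈ : S ∋ s
    s∈ = S.sum∈ (λ i → S.*∈ (K⊆S (a∈ (suc i))) (S.^∈ (toℕ i) y∈))
    eq′ : a zero + y * s ≈ 0#
    eq′ = trans (sym (sum-pow-suc a y)) eq
    step : a zero ≈ 0# → ∀ i → a i ≉ 0# → ∃[ z ] (S ∋ z × y * z ≈ 1#)
    step a0≈0 zero    a0≉0 = contradiction a0≈0 a0≉0
    step a0≈0 (suc i) ai≉0 = algebraic-inverse K S K⊆S y∈ y≉0 (a ∘ suc) (a∈ ∘ suc)
      (*≈0 y≉0 (trans (sym (trans (+-congʳ a0≈0) (+-identityˡ _))) eq′)) i ai≉0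

  -- One power of x more than there are generators forces a relation over K, from which
  -- `algebraic-inverse` yields the inverse.
  finite-subfield : ∀ (K : Subfield) (S : Subring) → (∀ {x} → Subfield.Mem K x → S ∋ x) →
    ∀ {n} (e : Fin n → Carrier) → (∀ {x} → S ∋ x → InSpan (Subfield.subring K) e x) → Subfield
  finite-subfield K S K⊆S {n} e S⊆ = record { subring = S ; ⁻¹∈ = inv }
    where
    open Subring S
    inv : ∀ {x} → S ∋ x → S ∋ x ⁻¹
    inv {x} x∈ = case em {P = x ≈ 0#} of λ where
      (yes x≈0) → resp (sym (⁻¹-zero x≈0)) 0∈
      (no  x≉0) → let open Dependent (span-dependent K e (pow x (suc n)) (ℕ.n<1+n n) (λ i → S⊆ (^∈ (toℕ i) x∈)))
                      z , z∈ , xz≈1 = algebraic-inverse K S K⊆S x∈ x≉0 scalars scalars∈ vanishes index scalars≉0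
                  in resp (⁻¹-unique xz≈1) z∈

  adjoin-subfield : ∀ (K : Subfield) u n → 0 ℕ.< n → Closes (Subfield.subring K) u n → Subfield
  adjoin-subfield K u n 0<n cl = finite-subfield K (adjoin K.subring u n 0<n cl) (base∈adjoin K.subring u n 0<n cl) (pow u n) id
    where module K = Subfield K

  -- Degrees

  module _ (K : Subfield) where
    open Subfield K

    -- A nonzero top coefficient of a relation could be divided out, expressing a power of u by
    -- lower ones; so it vanishes and induction takes over.
    not-closes⇒independent : ∀ u n → (∀ {d} → d ℕ.< n → ¬ Closes subring u d) → Independent subring (pow u n)
    not-closes⇒independent u zero    _ = independent λ _ _ _ ()
    not-closes⇒independent u (suc n) none = independent λ a a∈ eq →
      let split : sum (λ i → a (inject₁ i) * pow u n i) + a (fromℕ n) * u ^ n ≈ 0#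
          split = trans (sym (sum-pow-last a u)) eq
          top : a (fromℕ n) ≈ 0#
          top = by-contradiction em λ t≉0 → none (ℕ.n<1+n n) (span-resp
            (begin
              - (a (fromℕ n) ⁻¹) * sum (λ i → a (inject₁ i) * pow u n i)
                ≈⟨ solve 4 (λ t t⁻¹ s v → :- t⁻¹ :* s := :- t⁻¹ :* (s :+ t :* v) :+ t⁻¹ :* t :* v) refl (a (fromℕ n)) (a (fromℕ n) ⁻¹) _ (u ^ n) ⟩
              - (a (fromℕ n) ⁻¹) * (sum (λ i → a (inject₁ i) * pow u n i) + a (fromℕ n) * u ^ n) + a (fromℕ n) ⁻¹ * a (fromℕ n) * u ^ n
                ≈⟨ +-cong (trans (*-congˡ split) (zeroʳ _)) (*-congʳ (⁻¹-inverseˡ t≉0)) ⟩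
              0# + 1# * u ^ n
                ≈⟨ trans (+-identityˡ _) (*-identityˡ _) ⟩
              u ^ n ∎)
            (span-* (-∈ (⁻¹∈ (a∈ (fromℕ n)))) (combination (a ∘ inject₁) (a∈ ∘ inject₁) refl)))
          rest : ∀ i → a (inject₁ i) ≈ 0#
          rest = coefficient≈0 (not-closes⇒independent u n (none ∘ ℕ.m<n⇒m<1+n)) (a ∘ inject₁) (a∈ ∘ inject₁)
                   (trans (sym (trans (+-congˡ (trans (*-congʳ top) (zeroˡ _))) (+-identityʳ _))) split)
      in λ i → cases a top rest i
      where
      cases : ∀ (a : Fin (suc n) → Carrier) → a (fromℕ n) ≈ 0# → (∀ i → a (inject₁ i) ≈ 0#) → ∀ i → a i ≈ 0#
      cases a top rest i with view i
      ... | ‵fromℕ     = top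
      ... | ‵inject₁ j = rest j

    record HasDegreeOver (u : Carrier) (d : ℕ) : Set ρ where
      field
        degree>0    : 0 ℕ.< d
        closes      : Closes subring u d
        pow-independent : Independent subring (pow u d)
        minimal     : ∀ {m} → m ℕ.< d → ¬ Closes subring u m

    degree : ∀ u {n} → Closes subring u n → ∃[ d ] (d ℕ.≤ n × HasDegreeOver u d)
    degree u cl with least em (Closes subring u) cl
    -- Degree 0 would write u⁰ = 1 as an empty sum.
    ... | zero  , d≤n , cl₀ , min = contradiction (expansion cl₀) 1≉0
    ... | suc d , d≤n , cl₁ , min = suc d , d≤n , record
      { degree>0 = s≤s z≤n ; closes = cl₁ ; pow-independent = not-closes⇒independent u (suc d) min ; minimal = min }

    dependent⇒closes : ∀ u n → Dependent subring (pow u n) → ∃[ d ] (d ℕ.< n × Closes subring u d)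
    dependent⇒closes u n (relation a a∈ eq i ai≉0) = by-contradiction em λ none →
      ai≉0 (coefficient≈0 (not-closes⇒independent u n (λ d<n cl → none (_ , d<n , cl))) a a∈ eq i)

  -- Matrices of multiplications

  record Represents (P : Subring) {n} (e : Fin n → Carrier) (z : Carrier) (A : Matrix n) : Set ρ where
    field
      entries∈ : ∀ i j → P ∋ A i j
      action   : ∀ i → z * e i ≈ sum (λ j → A i j * e j)
  open Represents public

  module _ {P : Subring} {n} {e : Fin n → Carrier} where
    open Subring P

    represent : ∀ {z} → (p : ∀ i → InSpan P e (z * e i)) → Represents P e z (λ i → coefficient (p i))
    represent p = record { entries∈ = λ i → coefficient∈ (p i) ; action = λ i → expansion (p i) }

    represents-scalar : ∀ {x} → P ∋ x → Represents P e x (scalar x)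
    represents-scalar {x} x∈ = record
      { entries∈ = λ i j → *∈ x∈ (δ∈ i j)
      ; action   = λ i → trans (*-congˡ (sym (sum-δ i e))) (sum-scale x (δ i) e)
      }

    represents-* : ∀ {z w A B} → Represents P e z A → Represents P e w B → Represents P e (z * w) (A ∙ B)
    represents-* {z} {w} {A} {B} R S = record
      { entries∈ = λ i j → sum∈ (λ k → *∈ (entries∈ R i k) (entries∈ S k j))
      ; action   = λ i → begin
          z * w * e i  ≈⟨ solve 3 (λ z w e → z :* w :* e := w :* (z :* e)) refl z w (e i) ⟩
          w * (z * e i)  ≈⟨ *-congˡ (action R i) ⟩
          w * sum (λ j → A i j * e j)  ≈⟨ *-distribˡ-sum w (λ j → A i j * e j) ⟩
          sum (λ j → w * (A i j * e j))  ≈⟨ sum-cong (λ j → trans (solve 3 (λ w a e → w :* (a :* e) := a :* (w :* e)) refl w (A i j) (e j)) (*-congˡ (action S j))) ⟩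
          sum (λ j → A i j * sum (λ k → B j k * e k))  ≈⟨ sum-sum* (A i) B e ⟨
          sum (λ k → (A ∙ B) i k * e k)  ∎
      }

    represents-^ : ∀ {z A} → Represents P e z A → ∀ q → ∃[ B ] (Represents P e (z ^ q) B × ∣ B ∣ ≈ ∣ A ∣ ^ q)
    represents-^ R zero    = scalar 1# , represents-scalar 1∈ , trans (∣scalar∣ n 1#) (1^ n)
    represents-^ {A = A} R (suc q) with represents-^ R q
    ... | B , S , eq = A ∙ B , represents-* R S , trans (∣∣-homo A B) (*-congˡ eq)

    represents-unique : Independent P e → ∀ {z w A B} → z ≈ w → Represents P e z A → Represents P e w B → ∣ A ∣ ≈ ∣ B ∣
    represents-unique ind z≈w R S = ∣∣-cong λ i → independent-unique ind (entries∈ R i) (entries∈ S i)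
      (trans (sym (action R i)) (trans (*-congʳ z≈w) (action S i)))

    -- The norm of z, the determinant of multiplication by z, is multiplicative, and the norm of the
    -- scalar x is xⁿ; so the norm is the required root.
    norm-^ : Independent P e → ∀ {z} → (∀ i → InSpan P e (z * e i)) →
             ∀ {x} q → P ∋ x → z ^ q ≈ x → ∃[ y ] (P ∋ y × y ^ q ≈ x ^ n)
    norm-^ ind z∈ {x} q x∈ eq with represents-^ (represent z∈) q
    ... | B , S , eq′ = ∣ A ∣ , ∣∣∈ (entries∈ (represent z∈)) ,
      trans (sym eq′) (trans (represents-unique ind eq S (represents-scalar x∈)) (∣scalar∣ n x))
      where
      A : Matrix n
      A i = coefficient (z∈ i)

  -- Roots

  div-^ : ∀ {x y z} q → y ≉ 0# → x ^ q ≈ z * y ^ q → (x * y ⁻¹) ^ q ≈ z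
  div-^ {x} {y} {z} q y≉0 eq = begin
    (x * y ⁻¹) ^ q  ≈⟨ ^-distrib-* x (y ⁻¹) q ⟩
    x ^ q * (y ⁻¹) ^ q  ≈⟨ *-congʳ eq ⟩
    z * y ^ q * (y ⁻¹) ^ q  ≈⟨ *-assoc _ _ _ ⟩
    z * (y ^ q * (y ⁻¹) ^ q)  ≈⟨ *-congˡ (trans (*-comm _ _) (⁻¹-^ q y≉0)) ⟩
    z * 1#  ≈⟨ *-identityʳ z ⟩
    z  ∎

  ^≉0⁻¹ : ∀ {x} n → 0 ℕ.< n → x ^ n ≉ 0# → x ≉ 0#
  ^≉0⁻¹ (suc n) _ = *≉0⇒ˡ

  Root : Subfield → ℕ → Carrier → Set ρ
  Root K q x = ∃[ y ] (Subfield.Mem K y × y ^ q ≈ x)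

  -- Bézout: if s m = 1 + t q, the q-th power of y^s is x · (x^t)^q, so y^s divided by x^t is a
  -- root; for the other sign the two powers exchange places.
  coprime-root : ∀ (K : Subfield) {m q x} → 0 ℕ.< q → Coprime m q → Subfield.Mem K x → x ≉ 0# → Root K q (x ^ m) → Root K q x
  coprime-root K {m} {q} {x} 0<q cop x∈ x≉0 (y , y∈ , eq) = case Coprime.coprime-Bézout cop of λ where
      (Bézout.+- s t e) → y ^ s * (x ^ t) ⁻¹ , *∈ (^∈ s y∈) (⁻¹∈ (^∈ t x∈)) , div-^ q (^≉0 t x≉0) (begin
        (y ^ s) ^ q  ≈⟨ ^-comm y s q ⟩
        (y ^ q) ^ s  ≈⟨ ^-congˡ s eq ⟩
        (x ^ m) ^ s  ≈⟨ ^-assocʳ x m s ⟩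
        x ^ (m ℕ.* s)  ≈⟨ ^-congʳ x (≡.trans (ℕ.*-comm m s) (≡.sym e)) ⟩
        x * x ^ (t ℕ.* q)  ≈⟨ *-congˡ (^-assocʳ x t q) ⟨
        x * (x ^ t) ^ q  ∎)
      (Bézout.-+ s t e) → x ^ t * (y ^ s) ⁻¹ , *∈ (^∈ t x∈) (⁻¹∈ (^∈ s y∈)) , div-^ q (^≉0 s y≉0) (begin
        (x ^ t) ^ q  ≈⟨ ^-assocʳ x t q ⟩
        x ^ (t ℕ.* q)  ≈⟨ ^-congʳ x (≡.sym e) ⟩
        x * x ^ (s ℕ.* m)  ≈⟨ *-congˡ (trans (^-congʳ x (ℕ.*-comm s m)) (sym (^-assocʳ x m s))) ⟩
        x * (x ^ m) ^ s  ≈⟨ *-congˡ (^-congˡ s eq) ⟨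
        x * (y ^ q) ^ s  ≈⟨ *-congˡ (^-comm y q s) ⟩
        x * (y ^ s) ^ q  ∎)
    where
    open Subfield K
    y≉0 : y ≉ 0#
    y≉0 = ^≉0⁻¹ q 0<q (λ y^q≈0 → ^≉0 m x≉0 (trans (sym eq) y^q≈0))

  module _ (K : Subfield) where
    open Subfield K

    degree-norm-^ : ∀ {u d z q x} → HasDegreeOver K u d → InSpan subring (pow u d) z → Mem x → z ^ q ≈ x → Root K q (x ^ d)
    degree-norm-^ {u} {d} {q = q} D z∈ x∈ eq = norm-^ (HasDegreeOver.pow-independent D) {_}
        (λ i → S.*∈ z∈ (pow-gen subring u d (Fin.toℕ<n i))) q x∈ eq
      where
      module S = Subring (adjoin subring u d (HasDegreeOver.degree>0 D) (HasDegreeOver.closes D))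

    -- If u had degree d < p, its norm would be a p-th root of x^d, and since d is prime to p, x
    -- itself would have one.
    not-root⇒degree : ∀ {u p x} → Prime p → Mem x → x ≉ 0# → u ^ p ≈ x → ¬ Root K p x → HasDegreeOver K u p
    not-root⇒degree {u} {p} {x} pr x∈ x≉0 eq ¬root = case degree K u (closes-mem subring (prime>0 pr) (resp (sym eq) x∈)) of λ where
      (d , d≤p , D) → case ℕ.m≤n⇒m<n∨m≡n d≤p of λ where
        (inj₁ d<p)    → contradiction (coprime-root K (prime>0 pr) (<prime⇒coprime pr (HasDegreeOver.degree>0 D) d<p) x∈ x≉0
                          (degree-norm-^ {q = p} D (gen∈adjoin subring u d (HasDegreeOver.degree>0 D) (HasDegreeOver.closes D)) x∈ eq)) ¬root
        (inj₂ ≡.refl) → D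

-- Parity and prime divisors.

even⊎odd : ∀ n → (∃[ m ] n ≡ m ℕ.+ m) ⊎ (∃[ m ] n ≡ suc (m ℕ.+ m))
even⊎odd zero = inj₁ (0 , ≡.refl)
even⊎odd (suc n) with even⊎odd n
... | inj₁ (m , eq) = inj₂ (m , ≡.cong suc eq)
... | inj₂ (m , eq) = inj₁ (suc m , ≡.trans (≡.cong suc eq) (≡.sym (≡.cong suc (ℕ.+-suc m m))))

prime-divisor : ∀ {n} → 1 ℕ.< n → ∃[ p ] (Prime p × p ∣ n)
prime-divisor {n} 1<n with factorise n {{ℕ.>-nonZero (ℕ.<-trans ℕ.z<s 1<n)}}
... | record { factors = [] ; isFactorisation = eq } = contradiction (≡.subst (1 ℕ.<_) eq 1<n) (ℕ.<-irrefl ≡.refl)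
... | record { factors = p ∷ ps ; isFactorisation = eq ; factorsPrime = pr ∷ _ } =
  p , pr , ≡.subst (p ∣_) (≡.sym eq) (ℕ.m∣m*n _)

prime⇒coprime⊎∣ : ∀ {p} → Prime p → ∀ n → Coprime n p ⊎ p ∣ n
prime⇒coprime⊎∣ {p} pr n with p ℕ.∣? n
... | yes p∣n = inj₂ p∣n
... | no  p∤n = inj₁ λ { (d∣n , d∣p) → [ id , (λ { ≡.refl → contradiction d∣n p∤n }) ]′ (prime⇒irreducible pr d∣p) }

distinct-primes-coprime : ∀ {p q} → Prime p → Prime q → p ≢ q → Coprime p q
distinct-primes-coprime {p} {q} pp pq p≢q with prime⇒coprime⊎∣ pq p
... | inj₁ c = c
... | inj₂ q∣p = [ (λ { ≡.refl → contradiction pq ℕ.¬prime[1] }) , (λ { ≡.refl → contradiction ≡.refl p≢q }) ]′ (prime⇒irreducible pp q∣p)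

2≢odd-prime : ∀ {n} → Prime (suc n) → suc n ≢ 2 → ∃[ m ] n ≡ m ℕ.+ m
2≢odd-prime {n} pr ≢2 with even⊎odd n
... | inj₁ e = e
... | inj₂ (m , ≡.refl) = contradiction
  ([ (λ ()) , ≡.sym ]′ (prime⇒irreducible pr {2} (divides (suc m) (≡.cong (λ k → suc (suc k)) (≡.trans (≡.cong (m ℕ.+_) (≡.sym (ℕ.+-identityʳ m))) (ℕ.*-comm 2 m))))))
  ≢2

-- Traces, and coefficients with respect to powers of a radical.

module Kummer (em : ∀ {a} → ExcludedMiddle a) {c ℓ} (L : CommutativeRing c ℓ) (L-field : IsField L) (r : Level) where
  open Field em L L-field
  open Subobjects r
  open Simple em L L-field r

  square-roots : ∀ {x y} → x * x ≈ y * y → x ≈ y ⊎ x ≈ - y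
  square-roots {x} {y} eq = case em {P = x - y ≈ 0#} of λ where
    (yes p) → inj₁ (x-y≈0⇒x≈y p)
    (no  p) → inj₂ (x-y≈0⇒x≈y (trans (+-congˡ (-‿involutive y)) (*≈0 p (begin
      (x - y) * (x + y)  ≈⟨ solve 2 (λ x y → (x :- y) :* (x :+ y) := x :* x :- y :* y) refl x y ⟩
      x * x - y * y  ≈⟨ +-congʳ eq ⟩
      y * y - y * y  ≈⟨ -‿inverseʳ _ ⟩
      0#  ∎))))

  geometric : ∀ x n → (x - 1#) * sum (pow x n) ≈ x ^ n - 1#
  geometric x zero    = trans (zeroʳ _) (sym (-‿inverseʳ 1#))
  geometric x (suc n) = begin
    (x - 1#) * (1# + sum (λ (i : Fin n) → x * x ^ toℕ i))
      ≈⟨ *-congˡ (+-congˡ (*-distribˡ-sum x (pow x n))) ⟨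
    (x - 1#) * (1# + x * sum (pow x n))
      ≈⟨ solve 2 (λ x s → (x :- :1) :* (:1 :+ x :* s) := x :- :1 :+ x :* ((x :- :1) :* s)) refl x _ ⟩
    x - 1# + x * ((x - 1#) * sum (pow x n))
      ≈⟨ +-congˡ (*-congˡ (geometric x n)) ⟩
    x - 1# + x * (x ^ n - 1#)
      ≈⟨ solve 2 (λ x y → x :- :1 :+ x :* (y :- :1) := x :* y :- :1) refl x (x ^ n) ⟩
    x ^ suc n - 1# ∎

  -1^even : ∀ m → (- 1#) ^ (m ℕ.+ m) ≈ 1#
  -1^even m = begin
    (- 1#) ^ (m ℕ.+ m)  ≈⟨ ^-homo-* (- 1#) m m ⟩
    (- 1#) ^ m * (- 1#) ^ m  ≈⟨ ^-distrib-* (- 1#) (- 1#) m ⟨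
    (- 1# * - 1#) ^ m  ≈⟨ ^-congˡ m (trans (-1*x≈-x _) (-‿involutive 1#)) ⟩
    1# ^ m  ≈⟨ 1^ m ⟩
    1#  ∎

  trace : ∀ {n} → Matrix n → Carrier
  trace A = sum (λ i → A i i)

  trace-comm : ∀ {n} (A B : Matrix n) → trace (A ∙ B) ≈ trace (B ∙ A)
  trace-comm A B = trans (∑-comm (λ i j → A i j * B j i)) (sum-cong (λ j → sum-cong (λ i → *-comm (A i j) (B j i))))

  -- The size is at least two here; in size one the diagonal entry would be x.
  trace-shift : ∀ {n} x → trace (shift {suc n} x) ≈ 0#
  trace-shift {n} x = ≈0+≈0 (zeroʳ x) (sum-zero (off-diagonal (suc n)))
    where
    off-diagonal : ∀ n (i : Fin n) → δ (inject₁ i) (suc i) ≈ 0#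
    off-diagonal (suc n) zero    = refl
    off-diagonal (suc n) (suc i) = off-diagonal n i

  -- Multiplication by `u ⁻¹` lowers exponents, so all rows but the first are unit vectors, and only
  -- the first wraps around with the factor u^-(n+1).
  represents-shift : ∀ (K : Subfield) {n u} → u ≉ 0# → Subfield.Mem K (u ^ suc n) →
                     Represents (Subfield.subring K) (pow u (suc n)) (u ⁻¹) (shift ((u ^ suc n) ⁻¹))
  represents-shift K {n} {u} u≉0 a∈ = record { entries∈ = entries ; action = act }
    where
    open Subfield K
    a = u ^ suc n
    entries : ∀ i j → Mem (shift (a ⁻¹) i j)
    entries zero    j = *∈ (⁻¹∈ a∈) (δ∈ (fromℕ n) j)
    entries (suc i) j = δ∈ (inject₁ i) j
    act : ∀ i → u ⁻¹ * pow u (suc n) i ≈ sum (λ j → shift (a ⁻¹) i j * pow u (suc n) j)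
    act zero = sym (begin
      sum (λ j → a ⁻¹ * δ (fromℕ n) j * pow u (suc n) j)  ≈⟨ sum-scale (a ⁻¹) (δ (fromℕ n)) (pow u (suc n)) ⟨
      a ⁻¹ * sum (λ j → δ (fromℕ n) j * pow u (suc n) j)  ≈⟨ *-congˡ (sum-δ (fromℕ n) (pow u (suc n))) ⟩
      a ⁻¹ * u ^ toℕ (fromℕ n)  ≈⟨ *-congˡ (^-congʳ u (Fin.toℕ-fromℕ n)) ⟩
      a ⁻¹ * u ^ n  ≈⟨ *-cancelˡ u≉0 (trans (solve 3 (λ u a v → u :* (a :* v) := a :* (u :* v)) refl u (a ⁻¹) (u ^ n))
                        (trans (⁻¹-inverseˡ (^≉0 (suc n) u≉0)) (sym (trans (sym (*-assoc _ _ _)) (trans (*-identityʳ _) (⁻¹-inverseʳ u≉0)))))) ⟩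
      u ⁻¹ * 1#  ∎)
    act (suc i) = begin
      u ⁻¹ * (u * u ^ toℕ i)  ≈⟨ trans (sym (*-assoc _ _ _)) (trans (*-congʳ (⁻¹-inverseˡ u≉0)) (*-identityˡ _)) ⟩
      u ^ toℕ i  ≈⟨ ^-congʳ u (≡.sym (Fin.toℕ-inject₁ i)) ⟩
      pow u (suc n) (inject₁ i)  ≈⟨ sum-δ (inject₁ i) (pow u (suc n)) ⟨
      sum (λ j → δ (inject₁ i) j * pow u (suc n) j) ∎

  -- x together with the n vectors `g` is dependent, being in the span of n vectors; the coefficient
  -- of x is nonzero because `g` is independent.
  independent-spans : ∀ (K : Subfield) {n} {e g : Fin n → Carrier} → Independent (Subfield.subring K) g →
    (∀ i → InSpan (Subfield.subring K) e (g i)) → ∀ {x} → InSpan (Subfield.subring K) e x → InSpan (Subfield.subring K) g x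
  independent-spans K {n} {e} {g} ind g∈ {x} x∈ = from (span-dependent K e x∷g (ℕ.n<1+n n) λ { zero → x∈ ; (suc i) → g∈ i })
    where
    open Subfield K
    x∷g : Fin (suc n) → Carrier
    x∷g zero    = x
    x∷g (suc i) = g i
    from : Dependent subring x∷g → InSpan subring g x
    from (relation a a∈ eq i ai≉0) = span-resp
        (begin
          - (a zero ⁻¹) * s  ≈⟨ solve 4 (λ t t⁻¹ s x → :- t⁻¹ :* s := :- t⁻¹ :* (t :* x :+ s) :+ t⁻¹ :* t :* x) refl (a zero) (a zero ⁻¹) s x ⟩
          - (a zero ⁻¹) * (a zero * x + s) + a zero ⁻¹ * a zero * x  ≈⟨ +-cong (trans (*-congˡ eq) (zeroʳ _)) (*-congʳ (⁻¹-inverseˡ a0≉0)) ⟩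
          0# + 1# * x  ≈⟨ trans (+-identityˡ _) (*-identityˡ x) ⟩
          x  ∎)
        (span-* (-∈ (⁻¹∈ (a∈ zero))) (combination (a ∘ suc) (a∈ ∘ suc) refl))
      where
      s = sum (λ j → a (suc j) * g j)
      a0≉0 : a zero ≉ 0#
      a0≉0 a0≈0 = ai≉0 (all i)
        where
        rest : ∀ j → a (suc j) ≈ 0#
        rest = coefficient≈0 ind (a ∘ suc) (a∈ ∘ suc) (trans (sym (trans (+-congʳ (trans (*-congʳ a0≈0) (zeroˡ x))) (+-identityˡ s))) eq)
        all : ∀ j → a j ≈ 0#
        all zero    = a0≈0
        all (suc j) = rest j

  -- With P the matrix of `g` in terms of `e`, and B that of y e in terms of `g`, one has A = B P
  -- and S = P B; thus no inverse matrix is needed.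
  trace-basis-change : ∀ (K : Subfield) {n} {e g : Fin n → Carrier} {y A S} →
    Independent (Subfield.subring K) e → Independent (Subfield.subring K) g → (∀ i → InSpan (Subfield.subring K) e (g i)) →
    Represents (Subfield.subring K) e y A → Represents (Subfield.subring K) g y S → trace A ≈ trace S
  trace-basis-change K {n} {e} {g} {y} {A} {S} ind-e ind-g g∈ R-A R-S = begin
    trace A  ≈⟨ sum-cong (λ i → A≈BP i i) ⟩
    trace (B ∙ P)  ≈⟨ trace-comm B P ⟩
    trace (P ∙ B)  ≈⟨ sum-cong (λ i → S≈PB i i) ⟨
    trace S  ∎
    where
    open Subfield K
    P B : Matrix n
    P i = coefficient (g∈ i)
    ye∈ : ∀ i → InSpan subring g (y * e i)
    ye∈ i = independent-spans K ind-g g∈ (combination (A i) (entries∈ R-A i) (action R-A i))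
    B i = coefficient (ye∈ i)
    A≈BP : ∀ i j → A i j ≈ (B ∙ P) i j
    A≈BP i = independent-unique ind-e (entries∈ R-A i) (λ j → sum∈ (λ k → *∈ (coefficient∈ (ye∈ i) k) (coefficient∈ (g∈ k) j))) (begin
      sum (λ j → A i j * e j)  ≈⟨ action R-A i ⟨
      y * e i  ≈⟨ expansion (ye∈ i) ⟩
      sum (λ k → B i k * g k)  ≈⟨ sum-cong (λ k → *-congˡ (expansion (g∈ k))) ⟩
      sum (λ k → B i k * sum (λ j → P k j * e j))  ≈⟨ sum-sum* (B i) P e ⟨
      sum (λ j → (B ∙ P) i j * e j)  ∎)
    S≈PB : ∀ i j → S i j ≈ (P ∙ B) i j
    S≈PB i = independent-unique ind-g (entries∈ R-S i) (λ j → sum∈ (λ k → *∈ (coefficient∈ (g∈ i) k) (coefficient∈ (ye∈ k) j))) (begin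
      sum (λ j → S i j * g j)  ≈⟨ action R-S i ⟨
      y * g i  ≈⟨ *-congˡ (expansion (g∈ i)) ⟩
      y * sum (λ k → P i k * e k)  ≈⟨ *-distribˡ-sum y (λ k → P i k * e k) ⟩
      sum (λ k → y * (P i k * e k))  ≈⟨ sum-cong (λ k → trans (solve 3 (λ y p e → y :* (p :* e) := p :* (y :* e)) refl y (P i k) (e k)) (*-congˡ (expansion (ye∈ k)))) ⟩
      sum (λ k → P i k * sum (λ j → B k j * g j))  ≈⟨ sum-sum* (P i) B g ⟨
      sum (λ j → (P ∙ B) i j * g j)  ∎)

  module Rotation (K : Subfield) (u : Carrier) (n : ℕ) (a∈ : Subfield.Mem K (u ^ suc n)) where
    open Subfield K
    private
      a = u ^ suc n

    -- From the coefficients of y to those of y u.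
    rotate : (Fin (suc n) → Carrier) → Fin (suc n) → Carrier
    rotate k zero    = a * k (fromℕ n)
    rotate k (suc i) = k (inject₁ i)

    rotations : ℕ → (Fin (suc n) → Carrier) → Fin (suc n) → Carrier
    rotations zero    k = k
    rotations (suc s) k = rotate (rotations s k)

    rotation-span : ∀ {x} (p : InSpan subring (pow u (suc n)) x) s →
      (∀ i → Mem (rotations s (coefficient p) i)) × x * u ^ s ≈ sum (λ i → rotations s (coefficient p) i * pow u (suc n) i)
    rotation-span {x} p zero    = coefficient∈ p , trans (*-identityʳ x) (expansion p)
    rotation-span {x} p (suc s) with rotation-span p s
    ... | k∈ , eq = k′∈ , (begin
      x * (u * u ^ s)  ≈⟨ solve 3 (λ x u v → x :* (u :* v) := u :* (x :* v)) refl x u (u ^ s) ⟩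
      u * (x * u ^ s)  ≈⟨ *-congˡ eq ⟩
      u * sum (λ i → k i * pow u (suc n) i)  ≈⟨ *-congˡ (sum-pow-last k u) ⟩
      u * (sum (λ i → k (inject₁ i) * pow u n i) + k (fromℕ n) * u ^ n)
        ≈⟨ solve 4 (λ u s k v → u :* (s :+ k :* v) := u :* v :* k :+ u :* s) refl u _ (k (fromℕ n)) (u ^ n) ⟩
      a * k (fromℕ n) + u * sum (λ i → k (inject₁ i) * pow u n i)
        ≈⟨ sum-pow-suc (rotate k) u ⟨
      sum (λ i → rotate k i * pow u (suc n) i) ∎)
      where
      k = rotations s (coefficient p)
      k′∈ : ∀ i → Mem (rotate k i)
      k′∈ zero    = *∈ a∈ (k∈ (fromℕ n))
      k′∈ (suc i) = k∈ (inject₁ i)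

    -- Row i of the matrix of y holds the coefficients of y uⁱ, so this computes its diagonal: the
    -- trace is the size times the constant coefficient.
    rotations-diagonal : ∀ k (i : Fin (suc n)) → rotations (toℕ i) k i ≈ k zero
    rotations-diagonal k i = go (toℕ i) i ≡.refl
      where
      go : ∀ s (i : Fin (suc n)) → toℕ i ≡ s → rotations s k i ≈ k zero
      go zero    zero    _  = refl
      go (suc s) (suc i) eq = go s (inject₁ i) (≡.trans (Fin.toℕ-inject₁ i) (ℕ.suc-injective eq))

    rotations-+ : ∀ k s i → rotations s (rotate k) i ≡ rotations (suc s) k i
    rotations-+ k zero    i       = ≡.refl
    rotations-+ k (suc s) zero    = ≡.cong (a *_) (rotations-+ k s (fromℕ n))
    rotations-+ k (suc s) (suc i) = rotations-+ k s (inject₁ i)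

    rotate-to-zero : u ≉ 0# → ∀ k i → k i ≉ 0# → ∃[ s ] rotations s k zero ≉ 0#
    rotate-to-zero u≉0 k i ki≉0 = go n k i (ℕ.m≤n+m n (toℕ i)) ki≉0
      where
      -- t bounds the number of rotations still needed to bring place i to the last place n; one
      -- more brings it to place 0.
      go : ∀ t k i → n ℕ.≤ toℕ i ℕ.+ t → k i ≉ 0# → ∃[ s ] rotations s k zero ≉ 0#
      go t k i le ki≉0 with view i
      go t       k _ le ki≉0 | ‵fromℕ     = 1 , *≉0 (^≉0 (suc n) u≉0) ki≉0
      go zero    k _ le ki≉0 | ‵inject₁ j = contradiction (≡.subst (n ℕ.≤_) (≡.trans (ℕ.+-identityʳ _) (Fin.toℕ-inject₁ j)) le) (ℕ.<⇒≱ (Fin.toℕ<n j))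
      go (suc t) k _ le ki≉0 | ‵inject₁ j with go t (rotate k) (suc j) (≡.subst (n ℕ.≤_) (≡.trans (ℕ.+-suc _ t) (≡.cong (λ z → suc (z ℕ.+ t)) (Fin.toℕ-inject₁ j))) le) ki≉0
      ... | s , ≉0 = suc s , λ ≈0 → ≉0 (trans (reflexive (rotations-+ k s zero)) ≈0)

-- The inductive step: adjoining an element of prime degree.

module Kneser (em : ∀ {a} → ExcludedMiddle a) {c ℓ} (L : CommutativeRing c ℓ) (L-field : IsField L) (r : Level) where
  open Field em L L-field
  open Subobjects r
  open Simple em L L-field r
  open Kummer em L L-field r

  record UnitGroup (K : Subfield) : Set (lsuc ρ) where
    field
      Mem   : Carrier → Set ρ
      resp  : ∀ {x y} → x ≈ y → Mem x → Mem y
      ≉0    : ∀ {x} → Mem x → x ≉ 0#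
      *∈    : ∀ {x y} → Mem x → Mem y → Mem (x * y)
      ⁻¹∈   : ∀ {x} → Mem x → Mem (x ⁻¹)
      base∈ : ∀ {x} → Subfield.Mem K x → x ≉ 0# → Mem x

    ^∈ : ∀ {x} n → Mem x → Mem (x ^ n)
    ^∈ zero    _ = base∈ (Subfield.1∈ K) 1≉0
    ^∈ (suc n) p = *∈ p (^∈ n p)

    cancel∈ : ∀ {x y} → Mem x → Mem (x * y) → Mem y
    cancel∈ p q = resp (trans (sym (*-assoc _ _ _)) (trans (*-congʳ (⁻¹-inverseˡ (≉0 p))) (*-identityˡ _))) (*∈ (⁻¹∈ p) q)

  record KneserConditions (K : Subfield) (U : UnitGroup K) : Set ρ where
    private
      module K = Subfield K
      module U = UnitGroup U
    field
      torsion     : ∀ {u} → U.Mem u → ∃[ n ] (n ×ᴿ 1# ≉ 0# × K.Mem (u ^ n))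
      prime-roots : ∀ {p ζ} → Prime p → U.Mem ζ → ζ ^ p ≈ 1# → K.Mem ζ
      fourth-root : ∀ {ζ} → U.Mem ζ → ζ * ζ ≈ - 1# → U.Mem (1# + ζ) → K.Mem ζ

  module Step (K : Subfield) (U : UnitGroup K) (conditions : KneserConditions K U)
              {u : Carrier} (u∈U : UnitGroup.Mem U u) (u∉K : ¬ Subfield.Mem K u)
              {n : ℕ} (p-prime : Prime (suc n)) (u^p∈K : Subfield.Mem K (u ^ suc n))
              (p≉0 : suc n ×ᴿ 1# ≉ 0#) where
    private
      module K = Subfield K
      module U = UnitGroup U
      open KneserConditions conditions
      p = suc n
      a = u ^ p

      u≉0 : u ≉ 0#
      u≉0 = U.≉0 u∈U

      u^≉0 : ∀ j → u ^ j ≉ 0#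
      u^≉0 j = ^≉0 j u≉0

      a≉0 : a ≉ 0#
      a≉0 = u^≉0 p

    -- w f⁻¹ is a q-th root of unity in U, hence in K.
    same-power∈K : ∀ {q w f} → Prime q → U.Mem w → K.Mem f → w ^ q ≈ f ^ q → K.Mem w
    same-power∈K {q} {w} {f} q-prime w∈ f∈ eq = K.resp
        (trans (*-assoc _ _ _) (trans (*-congˡ (⁻¹-inverseˡ f≉0)) (*-identityʳ w)))
        (K.*∈ (prime-roots q-prime (U.*∈ w∈ (U.⁻¹∈ (U.base∈ f∈ f≉0))) (div-^ q f≉0 (trans eq (sym (*-identityˡ _))))) f∈)
      where
      f≉0 : f ≉ 0#
      f≉0 = ^≉0⁻¹ q (prime>0 q-prime) (^≉0 q (U.≉0 w∈) ∘ trans eq)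

    a-not-power : ¬ Root K p a
    a-not-power (b , b∈ , eq) = u∉K (same-power∈K p-prime u∈U b∈ (sym eq))

    degree-u : HasDegreeOver K u p
    degree-u = not-root⇒degree K p-prime u^p∈K a≉0 refl a-not-power

    open HasDegreeOver degree-u public

    K[u] : Subfield
    K[u] = adjoin-subfield K u p degree>0 closes

    private
      module M = Subfield K[u]

    K⊆M : ∀ {x} → K.Mem x → M.Mem x
    K⊆M = base∈adjoin K.subring u p degree>0 closes

    u∈M : M.Mem u
    u∈M = gen∈adjoin K.subring u p degree>0 closes

    -- The coset of x modulo Kˣ lies in the subgroup generated by u.
    Coset : Carrier → Set ρ
    Coset x = ∃[ j ] K.Mem (x * u ^ j)

    coset⇒U : ∀ {x} → x ≉ 0# → Coset x → U.Mem x
    coset⇒U x≉0 (j , k∈) = U.cancel∈ (U.^∈ j u∈U) (U.resp (*-comm _ _) (U.base∈ k∈ (*≉0 x≉0 (u^≉0 j))))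

    u^∈K : ∀ {j} → p ∣ j → K.Mem (u ^ j)
    u^∈K (divides m ≡.refl) = K.resp (trans (^-assocʳ u p m) (^-congʳ u (ℕ.*-comm p m))) (K.^∈ m u^p∈K)

    -- The case K[ζ] ≠ K is excluded because [K[ζ] : K] < p, so that u still has degree p over K[ζ].
    root-of-unity∈K : ∀ {ζ} → M.Mem ζ → ζ ^ p ≈ 1# → K.Mem ζ
    root-of-unity∈K {ζ} ζ∈M ζ^p≈1 = by-contradiction em impossible
      where
      module _ (ζ∉K : ¬ K.Mem ζ) where
        sum≈0 : sum (pow ζ p) ≈ 0#
        sum≈0 = *≈0 (λ ≈0 → ζ∉K (K.resp (sym (x-y≈0⇒x≈y ≈0)) K.1∈))
                    (trans (geometric ζ p) (trans (+-congʳ ζ^p≈1) (-‿inverseʳ 1#)))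

        dependent : Dependent K.subring (pow ζ p)
        dependent = relation (λ _ → 1#) (λ _ → K.1∈) (trans (sum-cong {p} (λ i → *-identityˡ (pow ζ p i))) sum≈0) zero 1≉0

        impossible : ⊥
        impossible =
          let d₀ , d₀<p , cl₀ = dependent⇒closes K ζ p dependent
              d , d≤d₀ , D = degree K ζ cl₀
              open HasDegreeOver D renaming (degree>0 to d>0; closes to cl)
              K′ = adjoin-subfield K ζ d d>0 cl
              K⊆K′ = λ {x} → base∈adjoin K.subring ζ d d>0 cl {x}
              ¬root′ = λ { (b , b∈ , eq) → a-not-power (coprime-root K degree>0
                         (<prime⇒coprime p-prime d>0 (ℕ.≤-<-trans d≤d₀ d₀<p)) u^p∈K a≉0
                         (degree-norm-^ K {q = p} D b∈ u^p∈K eq)) }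
              D′ = not-root⇒degree K′ p-prime (K⊆K′ u^p∈K) a≉0 refl ¬root′
              -- Over `K′` the element ζ has two expansions in powers of u: one with coefficients in
              -- K, and the constant ζ. Comparing constant terms puts ζ in K.
              coefficients-agree = independent-unique (HasDegreeOver.pow-independent D′)
                {coefficient ζ∈M} {λ i → ζ * δ zero i}
                (λ i → K⊆K′ (coefficient∈ ζ∈M i))
                (λ i → Subfield.*∈ K′ (gen∈adjoin K.subring ζ d d>0 cl) (Subfield.δ∈ K′ zero i))
                (trans (sym (expansion ζ∈M)) (sym (trans (sym (sum-scale ζ (δ zero) (pow u p)))
                  (trans (*-congˡ (sum-δ zero (pow u p))) (*-identityʳ ζ)))))
          in ζ∉K (K.resp (trans (coefficients-agree zero) (*-identityʳ ζ)) (coefficient∈ ζ∈M zero))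

    private
      *-span : ∀ {z} → M.Mem z → ∀ i → InSpan K.subring (pow u p) (z * pow u p i)
      *-span z∈ i = M.*∈ z∈ (pow-gen K.subring u p (Fin.toℕ<n i))

      represents : ∀ {z} (z∈ : M.Mem z) → Represents K.subring (pow u p) z (λ i → coefficient (*-span z∈ i))
      represents z∈ = represent (*-span z∈)

    module _ (1<p : 1 ℕ.< p) where
      open Rotation K u n u^p∈K

      -- If y ∉ K, the trace of y is 0 in the basis of powers of y⁻¹, but p k₀ in the basis of powers of u.
      power∈K⇒constant : ∀ {y} (y∈ : M.Mem y) → K.Mem (y ^ p) → coefficient y∈ zero ≉ 0# → K.Mem y
      power∈K⇒constant {y} y∈ y^p∈K k₀≉0 = by-contradiction em impossible
        where
        k = coefficient y∈
        y≉0 : y ≉ 0#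
        y≉0 y≈0 = k₀≉0 (coefficient≈0 pow-independent k (coefficient∈ y∈) (trans (sym (expansion y∈)) y≈0) zero)
        A : Matrix p
        A i = rotations (toℕ i) k
        R-A : Represents K.subring (pow u p) y A
        R-A = record { entries∈ = λ i → proj₁ (rotation-span y∈ (toℕ i)) ; action = λ i → proj₂ (rotation-span y∈ (toℕ i)) }
        trace-A : trace A ≈ p ×ᴿ 1# * k zero
        trace-A = begin
          trace A  ≈⟨ sum-cong (rotations-diagonal k) ⟩
          sum {p} (λ _ → k zero)  ≈⟨ sum-replicate p ⟩
          p ×ᴿ k zero  ≈⟨ ×-congʳ p (*-identityˡ (k zero)) ⟨
          p ×ᴿ (1# * k zero)  ≈⟨ ×-assoc-* p 1# (k zero) ⟨
          p ×ᴿ 1# * k zero  ∎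
        ⁻¹⁻¹ : ∀ {x} → x ≉ 0# → (x ⁻¹) ⁻¹ ≈ x
        ⁻¹⁻¹ x≉0 = sym (⁻¹-unique (⁻¹-inverseˡ x≉0))
        -- `represents-shift` gives the matrix of the inverse of a generator; to obtain that of y,
        -- the powers of `y ⁻¹` are taken.
        z = y ⁻¹
        z≉0 : z ≉ 0#
        z≉0 = ⁻¹≉0 y≉0
        z^p∈K : K.Mem (z ^ p)
        z^p∈K = K.resp (sym (⁻¹-unique (trans (*-comm _ _) (⁻¹-^ p y≉0)))) (K.⁻¹∈ y^p∈K)
        trace-zero : ∀ m → 1 ℕ.< suc m → (x : Carrier) → trace (shift {m} x) ≈ 0#
        trace-zero (suc m) _ x = trace-shift {m} x
        trace-zero zero (s≤s ()) x
        impossible : ¬ ¬ K.Mem y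
        impossible y∉K = case em {P = Root K p (z ^ p)} of λ where
          -- z f⁻¹ is then a p-th root of unity in K(u), hence in K, which forces y into K.
          (yes (f , f∈ , eq)) →
            let f≉0 = ^≉0⁻¹ p degree>0 (^≉0 p z≉0 ∘ trans (sym eq))
                zf∈K = root-of-unity∈K (M.*∈ (M.⁻¹∈ y∈) (K⊆M (K.⁻¹∈ f∈))) (div-^ p f≉0 (trans (sym eq) (sym (*-identityˡ _))))
            in y∉K (K.resp (⁻¹⁻¹ y≉0) (K.⁻¹∈ (K.cancel∈ (⁻¹≉0 f≉0) (K.⁻¹∈ f∈) (K.resp (*-comm _ _) zf∈K))))
          (no ¬root) →
            let D = not-root⇒degree K p-prime z^p∈K (^≉0 p z≉0) refl ¬root
                tr = trace-basis-change K pow-independent (HasDegreeOver.pow-independent D)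
                       (λ i → M.^∈ (toℕ i) (M.⁻¹∈ y∈)) R-A
                       (record { entries∈ = entries∈ (represents-shift K z≉0 z^p∈K)
                               ; action = λ i → trans (*-congʳ (sym (⁻¹⁻¹ y≉0))) (action (represents-shift K z≉0 z^p∈K) i) })
            in *≉0 p≉0 k₀≉0 (trans (sym trace-A) (trans tr (trace-zero n 1<p _)))

      -- Multiplying z by a suitable power of u makes its constant coefficient nonzero, and then
      -- `power∈K⇒constant` applies.
      power∈K⇒coset : ∀ {z} → M.Mem z → z ≉ 0# → K.Mem (z ^ p) → Coset z
      power∈K⇒coset {z} z∈ z≉0 z^p∈K = case em {P = ∃[ i ] coefficient z∈ i ≉ 0#} of λ where
        (no none)        → contradiction (trans (expansion z∈) (sum-zero (λ i → trans (*-congʳ (by-contradiction em (λ ≉0 → none (i , ≉0)))) (zeroˡ (pow u p i))))) z≉0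
        (yes (i , ki≉0)) →
          let s , ≉0 = rotate-to-zero u≉0 (coefficient z∈) i ki≉0
              k∈ , eq = rotation-span z∈ s
          in s , power∈K⇒constant (combination (rotations s (coefficient z∈)) k∈ eq)
                   (K.resp (sym (trans (^-distrib-* z (u ^ s) p) (*-congˡ (^-comm u s p)))) (K.*∈ z^p∈K (K.^∈ s u^p∈K))) ≉0

    p>1 : 1 ℕ.< p
    p>1 = ℕ.nonTrivial⇒n>1 p {{ℕ.prime⇒nonTrivial p-prime}}

    -- Compare norms; the norm of u is a because p is odd.
    odd⇒divides : p ≢ 2 → ∀ {z j} → M.Mem z → z ≉ 0# → K.Mem (z ^ p * u ^ j) → p ∣ j
    odd⇒divides p≢2 {z} {j} z∈ z≉0 k∈ = case prime⇒coprime⊎∣ p-prime j of λ where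
        (inj₂ p∣j) → p∣j
        (inj₁ cop) → contradiction (coprime-root K degree>0 cop u^p∈K a≉0 root) a-not-power
      where
      k = z ^ p * u ^ j
      Z : Matrix p
      Z i = coefficient (*-span z∈ i)
      root : Root K p (a ^ j)
      root =
        let B , R-B , ∣B∣ = represents-^ (represents z∈) p
            C , R-C , ∣C∣ = represents-^ (represents-shift K u≉0 u^p∈K) j
            z^p≈ : z ^ p ≈ k * (u ⁻¹) ^ j
            z^p≈ = trans (sym (trans (*-congˡ (trans (*-comm _ _) (⁻¹-^ j u≉0))) (*-identityʳ _))) (sym (*-assoc _ _ _))
            m , n≡m+m = 2≢odd-prime p-prime p≢2
            ∣shift∣≈ : ∣ shift {n} (a ⁻¹) ∣ ≈ a ⁻¹
            ∣shift∣≈ = trans (∣shift∣ n (a ⁻¹)) (trans (*-congʳ (trans (^-congʳ (- 1#) n≡m+m) (-1^even m))) (*-identityˡ _))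
            -- Norms of zᵖ = k u⁻ʲ. Solved for aʲ, this exhibits k divided by the norm of z as a
            -- p-th root of aʲ.
            norm : ∣ Z ∣ ^ p ≈ k ^ p * (a ⁻¹) ^ j
            norm = begin
              ∣ Z ∣ ^ p  ≈⟨ ∣B∣ ⟨
              ∣ B ∣  ≈⟨ represents-unique pow-independent z^p≈ R-B (represents-* (represents-scalar k∈) R-C) ⟩
              ∣ scalar k ∙ C ∣  ≈⟨ ∣∣-homo (scalar k) C ⟩
              ∣ scalar {p} k ∣ * ∣ C ∣  ≈⟨ *-cong (∣scalar∣ p k) (trans ∣C∣ (^-congˡ j ∣shift∣≈)) ⟩
              k ^ p * (a ⁻¹) ^ j  ∎
            Z≉0 = ^≉0⁻¹ p degree>0 (λ ≈0 → *≉0 (^≉0 p (*≉0 (^≉0 p z≉0) (u^≉0 j))) (^≉0 j (⁻¹≉0 a≉0)) (trans (sym norm) ≈0))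
        in k * ∣ Z ∣ ⁻¹ , K.*∈ k∈ (K.⁻¹∈ (K.∣∣∈ (entries∈ (represents z∈)))) , div-^ p Z≉0 (begin
          k ^ p  ≈⟨ trans (*-congˡ (⁻¹-^ j a≉0)) (*-identityʳ _) ⟨
          k ^ p * ((a ⁻¹) ^ j * a ^ j)  ≈⟨ solve 3 (λ k b a → k :* (b :* a) := a :* (k :* b)) refl (k ^ p) ((a ⁻¹) ^ j) (a ^ j) ⟩
          a ^ j * (k ^ p * (a ⁻¹) ^ j)  ≈⟨ *-congˡ norm ⟨
          a ^ j * ∣ Z ∣ ^ p  ∎)

    -- Exponents of u matter only modulo p, where q is invertible; so j may be replaced by a
    -- multiple of q.
    adjust-exponent : ∀ {q} → Coprime q p → ∀ j → ∃[ s ] (∀ {w} → K.Mem (w * u ^ j) → K.Mem (w * u ^ (q ℕ.* s)))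
    adjust-exponent {q} cop j = case Coprime.coprime-Bézout cop of λ where
      (Bézout.+- x y e) → x ℕ.* j , λ {w} k∈ → K.resp
        (begin
          w * u ^ j * u ^ (y ℕ.* p ℕ.* j)  ≈⟨ *-assoc _ _ _ ⟩
          w * (u ^ j * u ^ (y ℕ.* p ℕ.* j))  ≈⟨ *-congˡ (^-homo-* u j _) ⟨
          w * u ^ (j ℕ.+ y ℕ.* p ℕ.* j)  ≈⟨ *-congˡ (^-congʳ u (≡.trans (≡.cong (ℕ._* j) e) (≡.trans (≡.cong (ℕ._* j) (ℕ.*-comm x q)) (ℕ.*-assoc q x j)))) ⟩
          w * u ^ (q ℕ.* (x ℕ.* j))  ∎)
        (K.*∈ k∈ (u^∈K (ℕ.∣m⇒∣m*n j (ℕ.n∣m*n y))))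
      -- Here q x ≡ -1 modulo p; the factor n = p - 1 ≡ -1 repairs the sign.
      (Bézout.-+ x y e) → x ℕ.* (n ℕ.* j) , λ {w} k∈ →
        let t = q ℕ.* (x ℕ.* (n ℕ.* j))
            e′ : j ℕ.+ (n ℕ.* j ℕ.+ t) ≡ j ℕ.+ y ℕ.* p ℕ.* (n ℕ.* j)
            e′ = ≡.cong (j ℕ.+_) (≡.trans (≡.cong (n ℕ.* j ℕ.+_) (≡.trans (≡.sym (ℕ.*-assoc q x (n ℕ.* j))) (≡.cong (ℕ._* (n ℕ.* j)) (ℕ.*-comm q x))))
                   (≡.cong (ℕ._* (n ℕ.* j)) e))
        in K.cancel∈ (u^≉0 (p ℕ.* j)) (u^∈K (ℕ.m∣m*n j)) (K.resp
          (begin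
            w * u ^ j * u ^ (y ℕ.* p ℕ.* (n ℕ.* j))  ≈⟨ *-assoc _ _ _ ⟩
            w * (u ^ j * u ^ (y ℕ.* p ℕ.* (n ℕ.* j)))  ≈⟨ *-congˡ (^-homo-* u j _) ⟨
            w * u ^ (j ℕ.+ y ℕ.* p ℕ.* (n ℕ.* j))  ≈⟨ *-congˡ (^-congʳ u (≡.sym e′)) ⟩
            w * u ^ (j ℕ.+ (n ℕ.* j ℕ.+ t))  ≈⟨ *-congˡ (^-congʳ u (≡.sym (ℕ.+-assoc j (n ℕ.* j) t))) ⟩
            w * u ^ (p ℕ.* j ℕ.+ t)  ≈⟨ *-congˡ (^-homo-* u (p ℕ.* j) t) ⟩
            w * (u ^ (p ℕ.* j) * u ^ t)  ≈⟨ solve 3 (λ w x y → w :* (x :* y) := x :* (w :* y)) refl w _ _ ⟩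
            u ^ (p ℕ.* j) * (w * u ^ t)  ∎)
          (K.*∈ k∈ (u^∈K (ℕ.∣m⇒∣m*n (n ℕ.* j) (ℕ.n∣m*n y)))))

    power-u : ∀ {q w} s → w ^ q * u ^ (q ℕ.* s) ≈ (w * u ^ s) ^ q
    power-u {q} {w} s = sym (trans (^-distrib-* w (u ^ s) q) (*-congˡ (trans (^-assocʳ u s q) (^-congʳ u (ℕ.*-comm s q)))))

    -- For a prime q ≠ p, the norm shows that an element of K with a q-th root in K[u] has one in K.
    other-prime-root : ∀ {q} → Prime q → q ≢ p → ∀ {z j} → M.Mem z → z ≉ 0# → K.Mem (z ^ q * u ^ j) →
                       ∃[ s ] ((∀ {w} → K.Mem (w * u ^ j) → K.Mem (w * u ^ (q ℕ.* s))) × Root K q (z ^ q * u ^ (q ℕ.* s)))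
    other-prime-root {q} q-prime q≢p {z} {j} z∈ z≉0 k∈ =
      let s , adj = adjust-exponent (distinct-primes-coprime q-prime p-prime q≢p) j
          k′∈ = adj k∈
      in s , (λ {w} → adj {w}) , coprime-root K (prime>0 q-prime) (distinct-primes-coprime p-prime q-prime (q≢p ∘ ≡.sym)) k′∈ (*≉0 (^≉0 q z≉0) (u^≉0 (q ℕ.* s)))
           (degree-norm-^ K {q = q} degree-u (M.*∈ z∈ (M.^∈ s u∈M)) k′∈ (sym (power-u {q} s)))

    private
      remove-square : p ≡ 2 → ∀ {x j} → K.Mem (x * u ^ j) → K.Mem x ⊎ K.Mem (x * u)
      remove-square p≡2 {x} {j} k∈ = case even⊎odd j of λ where
          (inj₁ (m , ≡.refl)) → inj₁ (drop m k∈)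
          (inj₂ (m , ≡.refl)) → inj₂ (drop m (K.resp (sym (*-assoc _ _ _)) k∈))
        where
        drop : ∀ {x} m → K.Mem (x * u ^ (m ℕ.+ m)) → K.Mem x
        drop m k∈ = K.cancel∈ (u^≉0 (m ℕ.+ m)) (u^∈K (≡.subst (_∣ m ℕ.+ m) (≡.sym p≡2) (divides m (≡.trans (≡.cong (m ℕ.+_) (≡.sym (ℕ.+-identityʳ m))) (ℕ.*-comm 2 m))))) (K.resp (*-comm _ _) k∈)

    -- Write z = x + y u; then z² u ∈ K forces x² = - y² a.
    quadratic : p ≡ 2 → ∀ {z} → M.Mem z → z ≉ 0# → K.Mem (z * z * u) →
                ∃[ ζ ] (U.Mem ζ × M.Mem ζ × ¬ K.Mem ζ × ζ * ζ ≈ - 1# × ∃[ x ] (K.Mem x × x ≉ 0# × z ≈ x * (1# + ζ)))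
    quadratic ≡.refl {z} z∈ z≉0 k∈ = ζ , U.*∈ u∈U (U.⁻¹∈ (U.base∈ f∈ f≉0)) , M.*∈ u∈M (K⊆M (K.⁻¹∈ f∈)) , ζ∉K , ζ² , x , x∈ , x≉0 , z≈
      where
      x = coefficient z∈ zero
      y = coefficient z∈ (suc zero)
      x∈ = coefficient∈ z∈ zero
      y∈ = coefficient∈ z∈ (suc zero)
      z≈x+yu : z ≈ x + y * u
      z≈x+yu = trans (expansion z∈) (+-cong (*-identityʳ x) (trans (+-identityʳ _) (*-congˡ (*-identityʳ u))))
      pair : Carrier → Carrier → Fin 2 → Carrier
      pair s t zero       = s
      pair s t (suc zero) = t
      pair-sum : ∀ s t → sum (λ i → pair s t i * pow u 2 i) ≈ s + t * u
      pair-sum s t = +-cong (*-identityʳ s) (trans (+-identityʳ _) (*-congˡ (*-identityʳ u)))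
      pair∈ : ∀ {s t} → K.Mem s → K.Mem t → ∀ i → K.Mem (pair s t i)
      pair∈ s∈ t∈ zero       = s∈
      pair∈ s∈ t∈ (suc zero) = t∈
      -- This is the coefficient of u in z² u, which is zero because z² u ∈ K.
      norm≈0 : x * x + y * y * a ≈ 0#
      norm≈0 = independent-unique pow-independent
        (pair∈ (K.+∈ (K.*∈ y∈ (K.*∈ x∈ u^p∈K)) (K.*∈ y∈ (K.*∈ x∈ u^p∈K))) (K.+∈ (K.*∈ x∈ x∈) (K.*∈ (K.*∈ y∈ y∈) u^p∈K)))
        (pair∈ k∈ K.0∈)
        (begin
          sum (λ i → pair (y * (x * a) + y * (x * a)) (x * x + y * y * a) i * pow u 2 i)
            ≈⟨ pair-sum (y * (x * a) + y * (x * a)) (x * x + y * y * a) ⟩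
          (y * (x * a) + y * (x * a)) + (x * x + y * y * a) * u
            ≈⟨ solve 3 (λ x y u → (y :* (x :* (u :* (u :* :1))) :+ y :* (x :* (u :* (u :* :1)))) :+ (x :* x :+ y :* y :* (u :* (u :* :1))) :* u
                 := (x :+ y :* u) :* (x :+ y :* u) :* u :+ :0 :* u) refl x y u ⟩
          (x + y * u) * (x + y * u) * u + 0# * u
            ≈⟨ +-congʳ (*-congʳ (*-cong z≈x+yu z≈x+yu)) ⟨
          z * z * u + 0# * u
            ≈⟨ pair-sum (z * z * u) 0# ⟨
          sum (λ i → pair (z * z * u) 0# i * pow u 2 i) ∎) (suc zero)
      y≉0 : y ≉ 0#
      y≉0 y≈0 = z≉0 (trans z≈x+yu (≈0+≈0 x≈0 (trans (*-congʳ y≈0) (zeroˡ u))))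
        where
        x≈0 : x ≈ 0#
        x≈0 = by-contradiction em λ x≉0 → *≉0 x≉0 x≉0 (trans (sym (trans (+-congˡ (trans (*-congʳ (trans (*-congʳ y≈0) (zeroˡ y))) (zeroˡ a))) (+-identityʳ _))) norm≈0)
      x≉0 : x ≉ 0#
      x≉0 x≈0 = *≉0 (*≉0 y≉0 y≉0) a≉0 (trans (sym (trans (+-congʳ (trans (*-congʳ x≈0) (zeroˡ x))) (+-identityˡ _))) norm≈0)
      -- From x² = -y² u² it follows that ζ = u y x⁻¹ squares to -1 and that z = x (1 + ζ); ζ is
      -- written as u f⁻¹ to show that it lies in U.
      f = x * y ⁻¹
      f∈ = K.*∈ x∈ (K.⁻¹∈ y∈)
      f≉0 : f ≉ 0#
      f≉0 = *≉0 x≉0 (⁻¹≉0 y≉0)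
      ζ = u * f ⁻¹
      ζf≈u : ζ * f ≈ u
      ζf≈u = trans (*-assoc _ _ _) (trans (*-congˡ (⁻¹-inverseˡ f≉0)) (*-identityʳ u))
      ζ∉K : ¬ K.Mem ζ
      ζ∉K ζ∈ = u∉K (K.resp ζf≈u (K.*∈ ζ∈ f∈))
      fy≈x : f * y ≈ x
      fy≈x = trans (*-assoc _ _ _) (trans (*-congˡ (⁻¹-inverseˡ y≉0)) (*-identityʳ x))
      ζx≈yu : ζ * x ≈ y * u
      ζx≈yu = begin
        ζ * x  ≈⟨ *-congˡ fy≈x ⟨
        ζ * (f * y)  ≈⟨ *-assoc _ _ _ ⟨
        ζ * f * y  ≈⟨ *-congʳ ζf≈u ⟩
        u * y  ≈⟨ *-comm u y ⟩
        y * u  ∎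
      ζ² : ζ * ζ ≈ - 1#
      ζ² = *-cancelˡ (*≉0 x≉0 x≉0) (begin
        x * x * (ζ * ζ)  ≈⟨ solve 2 (λ x z → x :* x :* (z :* z) := (z :* x) :* (z :* x)) refl x ζ ⟩
        (ζ * x) * (ζ * x)  ≈⟨ *-cong ζx≈yu ζx≈yu ⟩
        (y * u) * (y * u)  ≈⟨ solve 3 (λ x y u → (y :* u) :* (y :* u) := (x :* x :+ y :* y :* (u :* (u :* :1))) :- x :* x) refl x y u ⟩
        (x * x + y * y * a) - x * x ≈⟨ trans (+-congʳ norm≈0) (+-identityˡ _) ⟩
        - (x * x)  ≈⟨ solve 1 (λ x → :- (x :* x) := x :* x :* :- :1) refl x ⟩
        x * x * - 1#  ∎)
      z≈ : z ≈ x * (1# + ζ)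
      z≈ = trans z≈x+yu (trans (+-congˡ (sym ζx≈yu)) (solve 2 (λ x z → x :+ z :* x := x :* (:1 :+ z)) refl x ζ))

    -- For odd p the exponent of u is divisible by p, so zᵖ itself lies in K. For p = 2 an odd
    -- exponent may survive, which is the exceptional case.
    p-power-coset : ∀ {z j} → M.Mem z → z ≉ 0# → K.Mem (z ^ p * u ^ j) → Coset z ⊎ (p ≡ 2 × K.Mem (z * z * u))
    p-power-coset {z} {j} z∈ z≉0 k∈ = case p ℕ.≟ 2 of λ where
        (no  p≢2) → inj₁ (power∈K⇒coset p>1 z∈ z≉0 (K.cancel∈ (u^≉0 j) (u^∈K (odd⇒divides p≢2 {j = j} z∈ z≉0 k∈)) (K.resp (*-comm _ _) k∈)))
        (yes p≡2) → case remove-square p≡2 {j = j} k∈ of λ where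
          (inj₁ z^p∈K)   → inj₁ (power∈K⇒coset p>1 z∈ z≉0 z^p∈K)
          (inj₂ z^p*u∈K) → inj₂ (p≡2 , K.resp (*-congʳ (trans (^-congʳ z p≡2) (*-congˡ (*-identityʳ z)))) z^p*u∈K)

    -- The exceptional elements are multiples by Kˣ of 1 + ζ with ζ² = -1, so one in U would put 1 +
    -- ζ in U, against `fourth-root`.
    U-not-quadratic : ∀ {w} → U.Mem w → M.Mem w → p ≡ 2 → ¬ K.Mem (w * w * u)
    U-not-quadratic w∈U w∈M p≡2 k∈ with quadratic p≡2 w∈M (U.≉0 w∈U) k∈
    ... | ζ , ζ∈U , _ , ζ∉K , ζ² , x , x∈ , x≉0 , w≈ =
      ζ∉K (fourth-root ζ∈U ζ² (U.cancel∈ (U.base∈ x∈ x≉0) (U.resp w≈ w∈U)))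

    -- For q ≠ p, some w uˢ ∈ U has the same q-th power as an element of K, so they differ by a root
    -- of unity in K.
    U-power-coset : ∀ {q w j} → Prime q → U.Mem w → M.Mem w → K.Mem (w ^ q * u ^ j) → Coset w
    U-power-coset {q} {w} {j} q-prime w∈U w∈M k∈ = case q ℕ.≟ p of λ where
      (no q≢p) →
        let s , _ , f , f∈ , eq = other-prime-root q-prime q≢p {j = j} w∈M (U.≉0 w∈U) k∈
        in s , same-power∈K q-prime (U.*∈ w∈U (U.^∈ s u∈U)) f∈ (trans (sym (power-u {q} s)) (sym eq))
      (yes q≡p) → case p-power-coset {j = j} w∈M (U.≉0 w∈U) (K.resp (*-congʳ (^-congʳ w q≡p)) k∈) of λ where
        (inj₁ coset)      → coset
        (inj₂ (p≡2 , k∈)) → contradiction k∈ (U-not-quadratic w∈U w∈M p≡2)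

    -- Induction on an exponent m with wᵐ ∈ K: for a prime q dividing m the claim holds for w^q, and
    -- `U-power-coset` passes from w^q to w.
    U∩M⊆coset : ∀ {w} → U.Mem w → M.Mem w → Coset w
    U∩M⊆coset w∈U w∈M with torsion w∈U
    ... | zero  , ≉0 , _     = contradiction refl ≉0
    ... | suc m , _  , w^∈K = go (suc m) (ℕ.<-wellFounded (suc m)) (s≤s z≤n) w∈U w∈M w^∈K
      where
      go : ∀ m → Acc ℕ._<_ m → 0 ℕ.< m → ∀ {w} → U.Mem w → M.Mem w → K.Mem (w ^ m) → Coset w
      go m (acc rec) 0<m {w} w∈U w∈M k∈ = case ℕ.m≤n⇒m<n∨m≡n 0<m of λ where
        (inj₂ ≡.refl) → 0 , k∈
        (inj₁ 1<m)    → case prime-divisor 1<m of λ where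
          (q , q-prime , divides m′ ≡.refl) →
            let 1<q = ℕ.nonTrivial⇒n>1 q {{ℕ.prime⇒nonTrivial q-prime}}
                0<m′ = ℕ.n≢0⇒n>0 (λ { ≡.refl → contradiction 0<m (ℕ.<-irrefl ≡.refl) })
                j , k′∈ = go m′ (rec (ℕ.m<m*n m′ q {{ℕ.>-nonZero 0<m′}} 1<q)) 0<m′ (U.^∈ q w∈U) (M.^∈ q w∈M)
                            (K.resp (sym (trans (^-assocʳ w q m′) (^-congʳ w (ℕ.*-comm q m′)))) k∈)
            in U-power-coset {j = j} q-prime w∈U w∈M k′∈

    private
      ⁻¹-* : ∀ {x y} → x ≉ 0# → y ≉ 0# → x ⁻¹ * y ⁻¹ ≈ (x * y) ⁻¹
      ⁻¹-* {x} {y} x≉0 y≉0 = ⁻¹-unique (begin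
        x * y * (x ⁻¹ * y ⁻¹)  ≈⟨ solve 4 (λ x y x⁻¹ y⁻¹ → x :* y :* (x⁻¹ :* y⁻¹) := (x :* x⁻¹) :* (y :* y⁻¹)) refl x y (x ⁻¹) (y ⁻¹) ⟩
        (x * x ⁻¹) * (y * y ⁻¹)  ≈⟨ *-cong (⁻¹-inverseʳ x≉0) (⁻¹-inverseʳ y≉0) ⟩
        1# * 1#  ≈⟨ *-identityˡ 1# ⟩
        1#  ∎)

      -- k plays the part of m⁻¹ in x = w m.
      record Quotient (x : Carrier) : Set ρ where
        constructor quotient
        field
          {w k} : Carrier
          w∈    : U.Mem w
          k∈    : M.Mem k
          k≉0   : k ≉ 0#
          w≈xk  : w ≈ x * k

    UM : UnitGroup K[u]
    UM = record
      { Mem   = Quotient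
      ; resp  = λ { x≈y (quotient w∈ k∈ k≉0 eq) → quotient w∈ k∈ k≉0 (trans eq (*-congʳ x≈y)) }
      ; ≉0    = λ { (quotient w∈ k∈ k≉0 eq) x≈0 → U.≉0 w∈ (trans eq (trans (*-congʳ x≈0) (zeroˡ _))) }
      ; *∈    = λ { {x} {y} (quotient {w} {k} w∈ k∈ k≉0 eq) (quotient {w′} {k′} w′∈ k′∈ k′≉0 eq′) →
                  quotient (U.*∈ w∈ w′∈) (M.*∈ k∈ k′∈) (*≉0 k≉0 k′≉0)
                    (trans (*-cong eq eq′) (solve 4 (λ x k y k′ → (x :* k) :* (y :* k′) := x :* y :* (k :* k′)) refl x k y k′)) }
      ; ⁻¹∈   = λ { {x} (quotient {w} {k} w∈ k∈ k≉0 eq) →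
                  quotient (U.⁻¹∈ w∈) (M.⁻¹∈ k∈) (⁻¹≉0 k≉0)
                    (trans (⁻¹-cong eq) (sym (⁻¹-* (*≉0⇒ˡ (U.≉0 w∈ ∘ trans eq)) k≉0))) }
      ; base∈ = λ m∈ m≉0 → quotient (U.base∈ K.1∈ 1≉0) (M.⁻¹∈ m∈) (⁻¹≉0 m≉0) (sym (⁻¹-inverseʳ m≉0))
      }

    U⊆UM : ∀ {x} → U.Mem x → UnitGroup.Mem UM x
    U⊆UM x∈ = quotient x∈ M.1∈ 1≉0 (sym (*-identityʳ _))

    private
      M-divide : ∀ {x k} → k ≉ 0# → M.Mem k → M.Mem (x * k) → M.Mem x
      M-divide k≉0 k∈ p = M.cancel∈ k≉0 k∈ (M.resp (*-comm _ _) p)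

      U-divide : ∀ {x k} → U.Mem k → U.Mem (x * k) → U.Mem x
      U-divide k∈ p = U.cancel∈ k∈ (U.resp (*-comm _ _) p)

      -- w = ζ k and k have the same q-th power, which therefore lies in U ∩ M; this moves the
      -- question from ζ to k ∈ M. In the exceptional case q = p = 2 one has ζ = ±1 anyway.
      prime-roots′ : ∀ {q ζ} → Prime q → UnitGroup.Mem UM ζ → ζ ^ q ≈ 1# → M.Mem ζ
      prime-roots′ {q} {ζ} q-prime (quotient {w} {k} w∈ k∈ k≉0 w≈ζk) ζ^q≈1 = case q ℕ.≟ p of λ where
          (no q≢p) →
            let s , adj , f , f∈ , eq = other-prime-root q-prime q≢p {j = j} k∈ k≉0 k^q∈
                wu^s∈K = same-power∈K q-prime (U.*∈ w∈ (U.^∈ s u∈U)) f∈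
                           (trans (sym (power-u {q} s)) (trans (*-congʳ w^q≈k^q) (sym eq)))
                w∈M = M-divide (u^≉0 s) (M.^∈ s u∈M) (K⊆M wu^s∈K)
            in M-divide k≉0 k∈ (M.resp w≈ζk w∈M)
          (yes q≡p) → case p-power-coset {j = j} k∈ k≉0 (K.resp (*-congʳ (^-congʳ k q≡p)) k^q∈) of λ where
            (inj₁ coset)   → K⊆M (prime-roots q-prime (U-divide (coset⇒U k≉0 coset) (U.resp w≈ζk w∈)) ζ^q≈1)
            (inj₂ (p≡2 , _)) →
              [ (λ ζ≈1 → M.resp (sym ζ≈1) M.1∈) , (λ ζ≈-1 → M.resp (sym ζ≈-1) (M.-∈ M.1∈)) ]′
              (square-roots {ζ} {1#} (trans (sym (trans (^-congʳ ζ (≡.trans q≡p p≡2)) (*-congˡ (*-identityʳ ζ)))) (trans ζ^q≈1 (sym (*-identityˡ 1#)))))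
        where
        w^q≈k^q : w ^ q ≈ k ^ q
        w^q≈k^q = trans (^-congˡ q w≈ζk) (trans (^-distrib-* ζ k q) (trans (*-congʳ ζ^q≈1) (*-identityˡ _)))
        coset-w^q : Coset (w ^ q)
        coset-w^q = U∩M⊆coset (U.^∈ q w∈) (M.resp (sym w^q≈k^q) (M.^∈ q k∈))
        j = proj₁ coset-w^q
        k^q∈ : K.Mem (k ^ q * u ^ j)
        k^q∈ = K.resp (*-congʳ w^q≈k^q) (proj₂ coset-w^q)

      -- The second alternative comes from `quadratic`. It is harmless for `fourth-root′`, since all
      -- square roots of -1 then lie in M.
      square-coset : ∀ {k} → M.Mem k → k ≉ 0# → Coset (k * k) → U.Mem k ⊎ ∃[ ζ ] (M.Mem ζ × ζ * ζ ≈ - 1#)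
      square-coset {k} k∈ k≉0 (j , kk∈) = case 2 ℕ.≟ p of λ where
          (no 2≢p) →
            let s , _ , f , f∈ , eq = other-prime-root ℕ.prime[2] 2≢p {j = j} k∈ k≉0 k²∈
                ku^s∈K = [ (λ e → K.resp (sym e) f∈) , (λ e → K.resp (sym e) (K.-∈ f∈)) ]′
                  (square-roots {k * u ^ s} {f} (trans (sym (*-congˡ (*-identityʳ _))) (trans (sym (power-u {2} {k} s)) (trans (sym eq) (*-congˡ (*-identityʳ f))))))
            in inj₁ (coset⇒U k≉0 (s , ku^s∈K))
          (yes 2≡p) → case p-power-coset {j = j} k∈ k≉0 (K.resp (*-congʳ (^-congʳ k 2≡p)) k²∈) of λ where
            (inj₁ coset)         → inj₁ (coset⇒U k≉0 coset)
            (inj₂ (p≡2 , k∈′)) → let ζ , _ , ζ∈M , _ , ζ² , _ = quadratic p≡2 k∈ k≉0 k∈′ in inj₂ (ζ , ζ∈M , ζ²)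
        where
        k²∈ : K.Mem (k ^ 2 * u ^ j)
        k²∈ = K.resp (*-congʳ (sym (*-congˡ (*-identityʳ k)))) kk∈

      -- Here w² = -k², and (1 + x)² = 2 x gives w′² x⁻¹ = 2 k′². So k² and k′² are in cosets of
      -- powers of u, the latter once x ∈ U is known. Unless M contains a square root of -1, this
      -- puts k, x, k′ and 1 + x in U one after the other, and the condition for K applies.
      fourth-root′ : ∀ {x} → UnitGroup.Mem UM x → x * x ≈ - 1# → UnitGroup.Mem UM (1# + x) → M.Mem x
      fourth-root′ {x} (quotient {w} {k} w∈ k∈ k≉0 w≈xk) x² (quotient {w′} {k′} w′∈ k′∈ k′≉0 w′≈) =
        case em {P = 1# + 1# ≈ 0#} of λ where
          -- In characteristic 2, x² = -1 = 1, so x = ±1.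
          (yes 2≈0) → [ (λ x≈1 → M.resp (sym x≈1) M.1∈) , (λ x≈-1 → M.resp (sym x≈-1) (M.-∈ M.1∈)) ]′
                        (square-roots {x} {1#} (trans x² (trans (sym (+-inverseˡ-unique 1# 1# 2≈0)) (sym (*-identityˡ 1#)))))
          (no  2≉0) → case square-coset k∈ k≉0 k²-coset of λ where
            (inj₂ root) → from-root root
            (inj₁ k∈U)  → let x∈U = U-divide k∈U (U.resp w≈xk w∈) in
              case square-coset k′∈ k′≉0 (k′²-coset 2≉0 x∈U) of λ where
                (inj₂ root)  → from-root root
                (inj₁ k′∈U)  → K⊆M (fourth-root x∈U x² (U-divide k′∈U (U.resp w′≈ w′∈)))
        where
        from-root : ∃[ ζ ] (M.Mem ζ × ζ * ζ ≈ - 1#) → M.Mem x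
        from-root (ζ , ζ∈ , ζ²) = [ (λ e → M.resp (sym e) ζ∈) , (λ e → M.resp (sym e) (M.-∈ ζ∈)) ]′
          (square-roots (trans x² (sym ζ²)))
        x≉0 : x ≉ 0#
        x≉0 = *≉0⇒ˡ (U.≉0 w∈ ∘ trans w≈xk)
        ww≈ : w * w ≈ - (k * k)
        ww≈ = trans (*-cong w≈xk w≈xk) (trans (solve 2 (λ x k → (x :* k) :* (x :* k) := (x :* x) :* (k :* k)) refl x k) (trans (*-congʳ x²) (-1*x≈-x _)))
        k²-coset : Coset (k * k)
        k²-coset = let j , k∈′ = U∩M⊆coset (U.*∈ w∈ w∈) (M.resp (sym ww≈) (M.-∈ (M.*∈ k∈ k∈)))
                   in j , K.resp (trans (-‿distribˡ-* _ _) (*-congʳ (trans (-‿cong ww≈) (-‿involutive _)))) (K.-∈ k∈′)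
        w′w′≈ : w′ * w′ * x ⁻¹ ≈ (1# + 1#) * (k′ * k′)
        w′w′≈ = begin
          w′ * w′ * x ⁻¹  ≈⟨ *-congʳ (*-cong w′≈ w′≈) ⟩
          ((1# + x) * k′) * ((1# + x) * k′) * x ⁻¹  ≈⟨ solve 3 (λ x k′ x⁻¹ → ((:1 :+ x) :* k′) :* ((:1 :+ x) :* k′) :* x⁻¹
                        := k′ :* k′ :* x⁻¹ :* (:1 :+ x :* x) :+ (:1 :+ :1) :* (k′ :* k′) :* (x :* x⁻¹)) refl x k′ (x ⁻¹) ⟩
          k′ * k′ * x ⁻¹ * (1# + x * x) + (1# + 1#) * (k′ * k′) * (x * x ⁻¹)
                        ≈⟨ +-cong (trans (*-congˡ (trans (+-congˡ x²) (-‿inverseʳ 1#))) (zeroʳ _)) (trans (*-congˡ (⁻¹-inverseʳ x≉0)) (*-identityʳ _)) ⟩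
          0# + (1# + 1#) * (k′ * k′)  ≈⟨ +-identityˡ _ ⟩
          (1# + 1#) * (k′ * k′)  ∎
        k′²-coset : 1# + 1# ≉ 0# → U.Mem x → Coset (k′ * k′)
        k′²-coset 2≉0 x∈U =
          let j , k∈′ = U∩M⊆coset (U.*∈ (U.*∈ w′∈ w′∈) (U.⁻¹∈ x∈U)) (M.resp (sym w′w′≈) (M.*∈ (M.+∈ M.1∈ M.1∈) (M.*∈ k′∈ k′∈)))
          in j , K.cancel∈ 2≉0 (K.+∈ K.1∈ K.1∈) (K.resp (trans (*-congʳ w′w′≈) (*-assoc _ _ _)) k∈′)

    UM-conditions : KneserConditions K[u] UM
    UM-conditions = record
      { torsion     = λ { {x} (quotient w∈ k∈ k≉0 eq) →
          let m , m≉0 , w^m∈ = torsion w∈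
          in m , m≉0 , M-divide (^≉0 m k≉0) (M.^∈ m k∈) (K⊆M (K.resp (trans (^-congˡ m eq) (^-distrib-* x _ m)) w^m∈)) }
      ; prime-roots = prime-roots′
      ; fourth-root = fourth-root′
      }

-- Descent on relations 1 = ∑ uⱼ.

module Independence (em : ∀ {a} → ExcludedMiddle a) {c ℓ} (L : CommutativeRing c ℓ) (L-field : IsField L) (r : Level) where
  open Field em L L-field
  open Subobjects r
  open Simple em L L-field r
  open Kneser em L L-field r

  total : List Carrier → Carrier
  total = List.foldr _+_ 0#

  total-++ : ∀ xs ys → total (xs List.++ ys) ≈ total xs + total ys
  total-++ []       ys = sym (+-identityˡ _)
  total-++ (x ∷ xs) ys = trans (+-congˡ (total-++ xs ys)) (sym (+-assoc _ _ _))

  total-*ʳ : ∀ xs y → total xs * y ≈ total (List.map (_* y) xs)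
  total-*ʳ []       y = zeroˡ y
  total-*ʳ (x ∷ xs) y = trans (distribʳ y x _) (+-congˡ (total-*ʳ xs y))

  module _ (K : Subfield) (U : UnitGroup K) (conditions : KneserConditions K U)
           {u : Carrier} (u∈U : UnitGroup.Mem U u) (u∉K : ¬ Subfield.Mem K u)
           {n : ℕ} (p-prime : Prime (suc n)) (u^p∈K : Subfield.Mem K (u ^ suc n))
           (p≉0 : suc n ×ᴿ 1# ≉ 0#) where
    private
      module K = Subfield K
      module U = UnitGroup U
      p = suc n
      a = u ^ p
    open Step K U conditions u∈U u∉K p-prime u^p∈K p≉0 using (Coset; pow-independent; K[u]; U∩M⊆coset)

    HasZeroConstant : Carrier → Set ρ
    HasZeroConstant x = Σ[ x∈ ∈ InSpan K.subring (pow u p) x ] coefficient x∈ zero ≈ 0#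

    -- x is κ uˢ with κ ∈ K and 0 ≤ s < p, and s = 0 is excluded by x ∉ K.
    coset-zero-constant : ∀ {x} → ¬ K.Mem x → Coset x → HasZeroConstant x
    coset-zero-constant {x} x∉K (j , k∈) = go (t ℕ.% p) (ℕ.m%n<n t p) x≈
      where
      u≉0 = UnitGroup.≉0 U u∈U
      a≉0 = ^≉0 p u≉0
      -- x ∈ K u⁻ʲ, and -j ≡ n j modulo p = n + 1; the exponent t is then reduced modulo p.
      t = n ℕ.* j
      κ = (a ^ j) ⁻¹ * (x * u ^ j) * a ^ (t ℕ./ p)
      κ∈ : K.Mem κ
      κ∈ = K.*∈ (K.*∈ (K.⁻¹∈ (K.^∈ j u^p∈K)) k∈) (K.^∈ (t ℕ./ p) u^p∈K)
      x≈ : x ≈ κ * u ^ (t ℕ.% p)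
      x≈ = sym (begin
        (a ^ j) ⁻¹ * (x * u ^ j) * a ^ (t ℕ./ p) * u ^ (t ℕ.% p)
          ≈⟨ *-congʳ (*-congˡ (trans (^-assocʳ u p (t ℕ./ p)) (^-congʳ u (ℕ.*-comm p (t ℕ./ p))))) ⟩
        (a ^ j) ⁻¹ * (x * u ^ j) * u ^ (t ℕ./ p ℕ.* p) * u ^ (t ℕ.% p)
          ≈⟨ solve 5 (λ b x y z w → b :* (x :* y) :* z :* w := b :* (y :* (w :* z)) :* x) refl ((a ^ j) ⁻¹) x (u ^ j) _ _ ⟩
        (a ^ j) ⁻¹ * (u ^ j * (u ^ (t ℕ.% p) * u ^ (t ℕ./ p ℕ.* p))) * x
          ≈⟨ *-congʳ (*-congˡ (*-congˡ (trans (sym (^-homo-* u (t ℕ.% p) _)) (^-congʳ u (≡.sym (ℕ.m≡m%n+[m/n]*n t p)))))) ⟩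
        (a ^ j) ⁻¹ * (u ^ j * u ^ t) * x
          ≈⟨ *-congʳ (*-congˡ (trans (sym (^-homo-* u j t)) (sym (^-assocʳ u p j)))) ⟩
        (a ^ j) ⁻¹ * a ^ j * x
          ≈⟨ trans (*-congʳ (⁻¹-inverseˡ (^≉0 j a≉0))) (*-identityˡ x) ⟩
        x ∎)
      go : ∀ s → s ℕ.< p → x ≈ κ * u ^ s → HasZeroConstant x
      go zero    _         eq = contradiction (K.resp (sym (trans eq (*-identityʳ κ))) κ∈) x∉K
      go (suc s) (s≤s s<n) eq = combination (λ i → κ * δ (suc (fromℕ< s<n)) i) (λ i → K.*∈ κ∈ (K.δ∈ (suc (fromℕ< s<n)) i))
        (begin
          x  ≈⟨ eq ⟩
          κ * u ^ suc s  ≈⟨ *-congˡ (^-congʳ u (≡.cong suc (≡.sym (Fin.toℕ-fromℕ< s<n)))) ⟩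
          κ * pow u p (suc (fromℕ< s<n))  ≈⟨ *-congˡ (sum-δ (suc (fromℕ< s<n)) (pow u p)) ⟨
          κ * sum (λ i → δ (suc (fromℕ< s<n)) i * pow u p i)  ≈⟨ sum-scale κ (δ (suc (fromℕ< s<n))) (pow u p) ⟩
          sum (λ i → κ * δ (suc (fromℕ< s<n)) i * pow u p i)  ∎) , zeroʳ κ

    total-zero-constant : ∀ {xs} → All HasZeroConstant xs → HasZeroConstant (total xs)
    total-zero-constant []                  = span-0 , refl
    total-zero-constant ((p , p≈0) ∷ ps) with total-zero-constant ps
    ... | q , q≈0 = span-+ p q , ≈0+≈0 p≈0 q≈0

    -- All summands have constant coefficient 0 in the basis of powers of u, while 1 has constant
    -- coefficient 1.
    total≉1 : ∀ {xs} → All (λ x → U.Mem x × Subfield.Mem K[u] x × ¬ K.Mem x) xs → total xs ≉ 1#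
    total≉1 ps total≈1 with total-zero-constant (All.map (λ { (x∈U , x∈M , x∉K) → coset-zero-constant x∉K (U∩M⊆coset x∈U x∈M) }) ps)
    ... | q , q≈0 = 1≉0 (trans (sym (independent-unique pow-independent (coefficient∈ q) (K.δ∈ zero)
            (trans (sym (expansion q)) (trans total≈1 (sym (sum-δ zero (pow u p))))) zero)) q≈0)

  -- The exponent need not be the order of the value modulo the base: any exponent bringing the
  -- value into the base will do, as long as it is nonzero in L.
  record Entry (K : Subfield) (U : UnitGroup K) : Set (lsuc ρ) where
    field
      value     : Carrier
      value∈    : UnitGroup.Mem U value
      exponent  : ℕ
      exponent≉0 : exponent ×ᴿ 1# ≉ 0#
      power∈    : Subfield.Mem K (value ^ exponent)
  open Entry

  module _ {K : Subfield} {U : UnitGroup K} where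
    values : List (Entry K U) → List Carrier
    values = List.map value

    weight : List (Entry K U) → ℕ
    weight = List.foldr (λ e w → exponent e ℕ.+ w) 0

    exponent>0 : (e : Entry K U) → 0 ℕ.< exponent e
    exponent>0 e with exponent e | exponent≉0 e
    ... | zero  | ≉0 = contradiction refl ≉0
    ... | suc m | _  = s≤s z≤n

  -- Sorts the terms of a relation over K when passing to M: those in M become bare elements, the
  -- others entries over M.
  record Split (K M : Subfield) (U : UnitGroup K) (UM : UnitGroup M) (es : List (Entry K U)) : Set (lsuc ρ) where
    field
      inside   : List Carrier
      outside  : List (Entry M UM)
      inside∈  : All (λ x → UnitGroup.Mem U x × Subfield.Mem M x × ¬ Subfield.Mem K x) inside
      outside∉ : All (λ e → ¬ Subfield.Mem M (value e)) outside
      weight≤  : weight outside ℕ.≤ weight es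
      total≈   : total (values es) ≈ total inside + total (values outside)
  open Split

  module _ {K M : Subfield} {U : UnitGroup K} {UM : UnitGroup M} (K⊆M : ∀ {x} → Subfield.Mem K x → Subfield.Mem M x)
           (U⊆UM : ∀ {x} → UnitGroup.Mem U x → UnitGroup.Mem UM x) where

    module _ {es : List (Entry K U)} (s : Split K M U UM es) (e : Entry K U) where
      add-inside : Subfield.Mem M (value e) → ¬ Subfield.Mem K (value e) → Split K M U UM (e ∷ es)
      add-inside e∈M e∉K = record
        { inside   = value e ∷ inside s
        ; outside  = outside s
        ; inside∈  = (value∈ e , e∈M , e∉K) ∷ inside∈ s
        ; outside∉ = outside∉ s
        ; weight≤  = ℕ.≤-trans (weight≤ s) (ℕ.m≤n+m _ _)
        ; total≈   = trans (+-congˡ (total≈ s)) (sym (+-assoc _ _ _))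
        }

      -- The exponent over M may be a smaller m; this is how the entry whose power has been adjoined
      -- loses weight.
      add-outside : ∀ m → m ℕ.≤ exponent e → m ×ᴿ 1# ≉ 0# → Subfield.Mem M (value e ^ m) → ¬ Subfield.Mem M (value e) → Split K M U UM (e ∷ es)
      add-outside m m≤ m≉0 m∈ e∉M = record
        { inside   = inside s
        ; outside  = record { value = value e ; value∈ = U⊆UM (value∈ e) ; exponent = m ; exponent≉0 = m≉0 ; power∈ = m∈ } ∷ outside s
        ; inside∈  = inside∈ s
        ; outside∉ = e∉M ∷ outside∉ s
        ; weight≤  = ℕ.+-mono-≤ m≤ (weight≤ s)
        ; total≈   = trans (+-congˡ (total≈ s)) (solve 3 (λ x y z → x :+ (y :+ z) := y :+ (x :+ z)) refl _ _ _)
        }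

    split : (es : List (Entry K U)) → All (λ e → ¬ Subfield.Mem K (value e)) es → Split K M U UM es
    split []       []           = record
      { inside = [] ; outside = [] ; inside∈ = [] ; outside∉ = [] ; weight≤ = z≤n ; total≈ = sym (+-identityˡ 0#) }
    split (e ∷ es) (e∉K ∷ ∉K) = case em {P = Subfield.Mem M (value e)} of λ where
      (yes e∈M) → add-inside (split es ∉K) e e∈M e∉K
      (no  e∉M) → add-outside (split es ∉K) e (exponent e) ℕ.≤-refl (exponent≉0 e) (K⊆M (power∈ e)) e∉M

  scale : ∀ {K U} {d} → UnitGroup.Mem U d → Subfield.Mem K d → Entry K U → Entry K U
  scale {K} {U} {d} d∈U d∈K e = record
    { value      = value e * d
    ; value∈     = UnitGroup.*∈ U (value∈ e) d∈U
    ; exponent   = exponent e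
    ; exponent≉0 = exponent≉0 e
    ; power∈     = Subfield.resp K (sym (^-distrib-* _ _ (exponent e))) (Subfield.*∈ K (power∈ e) (Subfield.^∈ K (exponent e) d∈K))
    }

  weight-scale : ∀ {K U} {d} (d∈U : UnitGroup.Mem U d) (d∈K : Subfield.Mem K d) es → weight (List.map (scale {K} {U} d∈U d∈K) es) ≡ weight es
  weight-scale d∈U d∈K []       = ≡.refl
  weight-scale {K} {U} d∈U d∈K (e ∷ es) = ≡.cong (exponent e ℕ.+_) (weight-scale {K} {U} d∈U d∈K es)

  total-scale : ∀ {K U} {d} (d∈U : UnitGroup.Mem U d) (d∈K : Subfield.Mem K d) es → total (values (List.map (scale {K} {U} d∈U d∈K) es)) ≈ total (values es) * d
  total-scale {d = d} d∈U d∈K []       = sym (zeroˡ d)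
  total-scale {K} {U} d∈U d∈K (e ∷ es) = trans (+-congˡ (total-scale {K} {U} d∈U d∈K es)) (sym (distribʳ _ _ _))

  -- A counterexample of weight below w. The field and the group belong to it because the descent
  -- enlarges both.
  record UnitTotal (w : ℕ) : Set (lsuc ρ) where
    field
      {K}        : Subfield
      {U}        : UnitGroup K
      conditions : KneserConditions K U
      entries    : List (Entry K U)
      weight<    : weight entries ℕ.< w
      ∉base      : All (λ e → ¬ Subfield.Mem K (value e)) entries
      total≈1    : total (values entries) ≈ 1#

  module Descend {K : Subfield} {U : UnitGroup K} (conditions : KneserConditions K U)
                 (e : Entry K U) (es : List (Entry K U)) (e∉K : ¬ Subfield.Mem K (value e))
                 (∉K : All (λ e → ¬ Subfield.Mem K (value e)) es) (total≈1 : total (values (e ∷ es)) ≈ 1#)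
                 {q : ℕ} (q-prime : Prime (suc q)) (m : ℕ) (eq : exponent e ≡ m ℕ.* suc q) where
    private
      module K = Subfield K
      module U = UnitGroup U

    product≈ : exponent e ×ᴿ 1# ≈ (m ×ᴿ 1#) * (suc q ×ᴿ 1#)
    product≈ = trans (×-congˡ eq) (×1-homo-* m (suc q))

    m≉0 : m ×ᴿ 1# ≉ 0#
    m≉0 = *≉0⇒ˡ (exponent≉0 e ∘ trans product≈)

    q≉0 : suc q ×ᴿ 1# ≉ 0#
    q≉0 = *≉0⇒ʳ {m ×ᴿ 1#} (exponent≉0 e ∘ trans product≈)

    m>0 : 0 ℕ.< m
    m>0 = ℕ.n≢0⇒n>0 (λ { ≡.refl → m≉0 refl })

    m<exponent : m ℕ.< exponent e
    m<exponent = ≡.subst (m ℕ.<_) (≡.sym eq) (ℕ.m<m*n m (suc q) {{ℕ.>-nonZero m>0}} (ℕ.nonTrivial⇒n>1 (suc q) {{ℕ.prime⇒nonTrivial q-prime}}))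

    lowered : K.Mem (value e ^ m) → UnitTotal (weight (e ∷ es))
    lowered m∈ = record
      { conditions = conditions
      ; entries    = record { value = value e ; value∈ = value∈ e ; exponent = m ; exponent≉0 = m≉0 ; power∈ = m∈ } ∷ es
      ; weight<    = ℕ.+-monoˡ-< (weight es) m<exponent
      ; ∉base      = e∉K ∷ ∉K
      ; total≈1    = total≈1
      }

    module _ (m∉ : ¬ K.Mem (value e ^ m)) where
      u^q∈ : K.Mem ((value e ^ m) ^ suc q)
      u^q∈ = K.resp (trans (^-congʳ (value e) eq) (sym (^-assocʳ (value e) m (suc q)))) (power∈ e)

      open Step K U conditions (U.^∈ m (value∈ e)) m∉ q-prime u^q∈ q≉0
        using (K[u]; UM; UM-conditions; K⊆M; U⊆UM; u∈M)

      private
        module M = Subfield K[u]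

      remaining : Split K K[u] U UM es
      remaining = split K⊆M U⊆UM es ∉K

      -- If `value e` lies in M, its term leaves the relation; if not, its exponent drops from m (q
      -- + 1) to m, as its m-th power has been adjoined.
      lighter-split : Dec (M.Mem (value e)) → Σ (Split K K[u] U UM (e ∷ es)) λ s → weight (outside s) ℕ.< weight (e ∷ es)
      lighter-split (yes e∈M) = add-inside {K} {K[u]} {U} {UM} K⊆M U⊆UM remaining e e∈M e∉K ,
        ℕ.≤-<-trans (weight≤ remaining) (ℕ.m<n+m (weight es) (exponent>0 e))
      lighter-split (no  e∉M) = add-outside {K} {K[u]} {U} {UM} K⊆M U⊆UM remaining e m (ℕ.<⇒≤ m<exponent) m≉0 u∈M e∉M ,
        ℕ.+-mono-<-≤ m<exponent (weight≤ remaining)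

      module _ (s : Split K K[u] U UM (e ∷ es)) (s< : weight (outside s) ℕ.< weight (e ∷ es)) where
        t : Carrier
        t = total (inside s)

        total∈M : ∀ {xs} → All (λ x → U.Mem x × M.Mem x × ¬ K.Mem x) xs → M.Mem (total xs)
        total∈M []                  = M.0∈
        total∈M ((_ , x∈ , _) ∷ xs) = M.+∈ x∈ (total∈M xs)

        d∈ : M.Mem (1# - t)
        d∈ = M.+∈ M.1∈ (M.-∈ (total∈M (inside∈ s)))

        outside≈ : total (values (outside s)) ≈ 1# - t
        outside≈ = trans (solve 2 (λ x y → y := (x :+ y) :- x) refl t (total (values (outside s)))) (+-congʳ (trans (sym (total≈ s)) total≈1))

        d≉0 : 1# - t ≉ 0#
        d≉0 d≈0 = total≉1 K U conditions (U.^∈ m (value∈ e)) m∉ q-prime u^q∈ q≉0 (inside∈ s) (sym (x-y≈0⇒x≈y d≈0))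

        d⁻¹∈M : M.Mem ((1# - t) ⁻¹)
        d⁻¹∈M = M.⁻¹∈ d∈

        d⁻¹∈U : UnitGroup.Mem UM ((1# - t) ⁻¹)
        d⁻¹∈U = UnitGroup.base∈ UM d⁻¹∈M (⁻¹≉0 d≉0)

        scaled : List (Entry K[u] UM)
        scaled = List.map (scale {K[u]} {UM} d⁻¹∈U d⁻¹∈M) (outside s)

        -- The terms outside M add up to 1 - t ∈ M, nonzero by `total≉1`; dividing by it makes the
        -- sum 1 again and keeps exponents and non-membership in M.
        rescaled : UnitTotal (weight (e ∷ es))
        rescaled = record
          { conditions = UM-conditions
          ; entries    = scaled
          ; weight<    = ≡.subst (ℕ._< weight (e ∷ es)) (≡.sym (weight-scale {K[u]} {UM} d⁻¹∈U d⁻¹∈M (outside s))) s<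
          ; ∉base      = All.map⁺ (All.map (λ e∉ p → e∉ (M.cancel∈ (⁻¹≉0 d≉0) d⁻¹∈M (M.resp (*-comm _ _) p))) (outside∉ s))
          ; total≈1    = trans (total-scale {K[u]} {UM} d⁻¹∈U d⁻¹∈M (outside s)) (trans (*-congʳ outside≈) (⁻¹-inverseʳ d≉0))
          }

    smaller : UnitTotal (weight (e ∷ es))
    smaller = case em {P = K.Mem (value e ^ m)} of λ where
      (yes m∈) → lowered m∈
      (no  m∉) → rescaled m∉ (proj₁ (lighter-split m∉ em)) (proj₂ (lighter-split m∉ em))

  -- Either an exponent can be lowered over K, or K is enlarged by an element of prime degree, over which
  -- an exponent can be lowered.
  no-unit-total : ∀ N → ¬ UnitTotal N
  no-unit-total (suc N) record { entries = [] ; total≈1 = total≈1 } = 1≉0 (sym total≈1)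
  no-unit-total (suc N) record { K = K ; conditions = conditions ; entries = e ∷ es ; weight< = w< ; ∉base = e∉K ∷ ∉K ; total≈1 = total≈1 } =
      case prime-divisor 1<exponent of λ where
        (zero  , q-prime , _)            → contradiction q-prime ℕ.¬prime[0]
        (suc q , q-prime , divides m eq) → no-unit-total N (weaken (Descend.smaller conditions e es e∉K ∉K total≈1 q-prime m eq))
    where
    1<exponent : 1 ℕ.< exponent e
    1<exponent = case ℕ.m≤n⇒m<n∨m≡n (exponent>0 e) of λ where
      (inj₁ 1<) → 1<
      (inj₂ 1≡) → contradiction (Subfield.resp K (trans (^-congʳ (value e) (≡.sym 1≡)) (*-identityʳ _)) (power∈ e)) e∉K
    weaken : UnitTotal (weight (e ∷ es)) → UnitTotal N
    weaken t = record { conditions = UnitTotal.conditions t ; entries = UnitTotal.entries t ; ∉base = UnitTotal.∉base t ; total≈1 = UnitTotal.total≈1 t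
                      ; weight< = ℕ.<-≤-trans (UnitTotal.weight< t) (ℕ.≤-pred w<) }

  -- Independence over K of distinct cosets of Kˣ in U, the coefficients being absorbed into the elements of U.
  UnitTotals : (K : Subfield) → UnitGroup K → Set ρ
  UnitTotals K U = ∀ us → All (UnitGroup.Mem U) us → total us ≈ 1# → Any (Subfield.Mem K) us

  kneser : ∀ {K U} → KneserConditions K U → UnitTotals K U
  kneser {K} {U} conditions us us∈ total≈1 = by-contradiction em λ ¬any →
      no-unit-total (suc (weight (entries us∈))) record
        { conditions = conditions
        ; entries    = entries us∈
        ; weight<    = ℕ.≤-refl
        ; ∉base      = entries∉ us∈ (All.¬Any⇒All¬ us ¬any)
        ; total≈1    = trans (reflexive (≡.cong total (entries-values us∈))) total≈1
        }
    where
    open KneserConditions conditions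
    entries : ∀ {us} → All (UnitGroup.Mem U) us → List (Entry K U)
    entries []                = []
    entries (_∷_ {u} u∈ us∈) = record { value = u ; value∈ = u∈ ; exponent = proj₁ (torsion u∈) ; exponent≉0 = proj₁ (proj₂ (torsion u∈)) ; power∈ = proj₂ (proj₂ (torsion u∈)) } ∷ entries us∈
    entries-values : ∀ {us} (us∈ : All (UnitGroup.Mem U) us) → values (entries us∈) ≡ us
    entries-values []         = ≡.refl
    entries-values (u∈ ∷ us∈) = ≡.cong (_ ∷_) (entries-values us∈)
    entries∉ : ∀ {us} (us∈ : All (UnitGroup.Mem U) us) → All (λ u → ¬ Subfield.Mem K u) us → All (λ e → ¬ Subfield.Mem K (value e)) (entries us∈)
    entries∉ []         []         = []
    entries∉ (u∈ ∷ us∈) (u∉ ∷ us∉) = u∉ ∷ entries∉ us∈ us∉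

-- Binomial coefficients modulo a prime, and towers of radical extensions.

prime∤! : ∀ {p} → Prime p → ∀ n → n ℕ.< p → ¬ p ∣ n !
prime∤! pr zero    _   p∣1 = contradiction (≡.subst Prime (ℕ.∣1⇒≡1 p∣1) pr) ℕ.¬prime[1]
prime∤! pr (suc n) n<p p∣ with ℕ.euclidsLemma (suc n) (n !) pr p∣
... | inj₁ p∣1+n = ℕ.<⇒≱ n<p (ℕ.∣⇒≤ p∣1+n)
... | inj₂ p∣n!  = prime∤! pr n (ℕ.<-trans (ℕ.n<1+n n) n<p) p∣n!

-- p divides p! = C · k! · (p - k)! but neither of the two smaller factorials.
prime∣C : ∀ {p k} → Prime p → 0 ℕ.< k → k ℕ.< p → p ∣ p C k
prime∣C {suc p} {k} pr 0<k k<p with ℕ.euclidsLemma (suc p C k) (k ! ℕ.* (suc p ℕ.∸ k) !) pr (≡.subst (suc p ∣_) (≡.sym product) (ℕ.m∣m*n (p !)))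
  where
  instance
    _ = k ℕ.!* (suc p ℕ.∸ k) !≢0
  product : (suc p C k) ℕ.* (k ! ℕ.* (suc p ℕ.∸ k) !) ≡ suc p !
  product = ≡.trans (≡.cong (ℕ._* (k ! ℕ.* (suc p ℕ.∸ k) !)) (ℕ.nCk≡n!/k![n-k]! (ℕ.<⇒≤ k<p)))
                    (ℕ.m/n*n≡m (ℕ.k![n∸k]!∣n! (ℕ.<⇒≤ k<p)))
... | inj₁ p∣C = p∣C
... | inj₂ p∣k!m! with ℕ.euclidsLemma (k !) ((suc p ℕ.∸ k) !) pr p∣k!m!
...   | inj₁ p∣k! = contradiction p∣k! (prime∤! pr k k<p)
...   | inj₂ p∣m! = contradiction p∣m! (prime∤! pr (suc p ℕ.∸ k) (ℕ.∸-monoʳ-< 0<k (ℕ.<⇒≤ k<p)))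

module Chains (em : ∀ {a} → ExcludedMiddle a) {c ℓ} (L : CommutativeRing c ℓ) (L-field : IsField L) (r : Level) where
  open Field em L L-field
  open Subobjects r
  open Simple em L L-field r

  record Generator (F : Subfield) : Set ρ where
    field
      u          : Carrier
      u≉0        : u ≉ 0#
      exponent   : ℕ
      exponent≉0 : exponent ×ᴿ 1# ≉ 0#
      power∈     : Subfield.Mem F (u ^ exponent)

    exponent>0 : 0 ℕ.< exponent
    exponent>0 = ℕ.n≢0⇒n>0 λ n≡0 → exponent≉0 (×-congˡ n≡0)

    closes : Closes (Subfield.subring F) u exponent
    closes = closes-mem (Subfield.subring F) exponent>0 power∈

    F[u] : Subfield
    F[u] = adjoin-subfield F u exponent exponent>0 closes

    F⊆F[u] : ∀ {x} → Subfield.Mem F x → Subfield.Mem F[u] x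
    F⊆F[u] = base∈adjoin (Subfield.subring F) u exponent exponent>0 closes

    u∈F[u] : Subfield.Mem F[u] u
    u∈F[u] = gen∈adjoin (Subfield.subring F) u exponent exponent>0 closes
  open Generator

  lift : ∀ {F M : Subfield} → (∀ {x} → Subfield.Mem F x → Subfield.Mem M x) → Generator F → Generator M
  lift F⊆M g = record { u = u g ; u≉0 = u≉0 g ; exponent = exponent g ; exponent≉0 = exponent≉0 g ; power∈ = F⊆M (power∈ g) }

  lift* : ∀ {k F} (g : Generator F) → Vec (Generator F) k → Vec (Generator (F[u] g)) k
  lift* {F = F} g = Vec.map (lift {F} {F[u] g} (F⊆F[u] g))

  -- All generators have a power in the bottom field, so those left after one adjunction are still
  -- generators over the larger field.
  chain : ∀ {k} (F : Subfield) → Vec (Generator F) k → Subfield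
  chain F Vec.[]       = F
  chain F (g Vec.∷ gs) = chain (F[u] g) (lift* g gs)

  base⊆chain : ∀ {k} (F : Subfield) (gs : Vec (Generator F) k) {x} → Subfield.Mem F x → Subfield.Mem (chain F gs) x
  base⊆chain F Vec.[]       x∈ = x∈
  base⊆chain F (g Vec.∷ gs) x∈ = base⊆chain (F[u] g) (lift* g gs) (F⊆F[u] g x∈)

  generators∈chain : ∀ {k} (F : Subfield) (gs : Vec (Generator F) k) → VecAll.All (λ g → Subfield.Mem (chain F gs) (u g)) gs
  generators∈chain F Vec.[]       = VecAll.[]
  generators∈chain F (g Vec.∷ gs) = base⊆chain (F[u] g) (lift* g gs) (u∈F[u] g) VecAll.∷ VecAll.map⁻ (generators∈chain (F[u] g) (lift* g gs))

  -- Q need only be a ring, because each adjunction is a span of powers. Hence inverses taken in the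
  -- chain are polynomials in the generators.
  chain⊆ : ∀ {k} (F : Subfield) (gs : Vec (Generator F) k) (Q : Subring) → (∀ {x} → Subfield.Mem F x → Q ∋ x) →
           VecAll.All (λ g → Q ∋ u g) gs → ∀ {x} → Subfield.Mem (chain F gs) x → Q ∋ x
  chain⊆ F Vec.[]       Q F⊆Q _                   = F⊆Q
  chain⊆ F (g Vec.∷ gs) Q F⊆Q (u∈ VecAll.∷ us∈) =
    chain⊆ (F[u] g) (lift* g gs) Q (span∈ {Subfield.subring F} {Q} F⊆Q (λ i → Subring.^∈ Q (toℕ i) u∈)) (VecAll.map⁺ us∈)

  span-tower : ∀ {P Q : Subring} {m n} {e : Fin m → Carrier} {f : Fin n → Carrier} →
    (∀ {x} → Q ∋ x → InSpan P e x) → ∀ {x} → InSpan Q f x → InSpan P (λ k → uncurry (λ i j → e i * f j) (remQuot {m} n k)) x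
  span-tower {P} {Q} {m} {n} {e} {f} Q⊆ (combination a a∈ eq) = span-resp (sym eq) (span-sum (λ j → a j * f j)
      λ j → span-*ʳ (f j) (λ i → span-resp (reflexive (≡.cong (uncurry (λ i j → e i * f j)) (Fin.remQuot-combine i j))) (span-gen (combine i j))) (Q⊆ (a∈ j)))

  chain-finite : ∀ {k} (F : Subfield) (gs : Vec (Generator F) k) →
    ∃[ n ] Σ[ e ∈ (Fin n → Carrier) ] (∀ {x} → Subfield.Mem (chain F gs) x → InSpan (Subfield.subring F) e x)
  chain-finite F Vec.[]       = 1 , (λ _ → 1#) , λ x∈ → span-resp (*-identityʳ _) (span-* x∈ (span-gen zero))
  chain-finite F (g Vec.∷ gs) =
    let n , e , ⊆ = chain-finite (F[u] g) (lift* g gs)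
    in exponent g ℕ.* n , (λ k → uncurry (λ i j → pow (u g) (exponent g) i * e j) (remQuot {exponent g} n k)) ,
       λ x∈ → span-tower {Subfield.subring F} {Subfield.subring (F[u] g)} {exponent g} {n} {pow (u g) (exponent g)} {e} id (⊆ x∈)

  chain-closes : ∀ {k} (F : Subfield) (gs : Vec (Generator F) k) {x} → Subfield.Mem (chain F gs) x →
                 ∃[ n ] Closes (Subfield.subring F) x n
  chain-closes F gs {x} x∈ =
    let n , e , ⊆ = chain-finite F gs
        d , _ , cl = dependent⇒closes F x (suc n) (span-dependent F e (pow x (suc n)) (ℕ.n<1+n n) (λ i → ⊆ (Subfield.^∈ (chain F gs) (toℕ i) x∈)))
    in d , cl

  -- Characteristic q

  module Characteristic {q : ℕ} (q-prime : Prime q) (q≈0 : q ×ᴿ 1# ≈ 0#) where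
    private
      multiple≈0 : ∀ {m} → q ∣ m → ∀ x → m ×ᴿ x ≈ 0#
      multiple≈0 {m} (divides t ≡.refl) x = begin
        (t ℕ.* q) ×ᴿ x  ≈⟨ ×-congʳ (t ℕ.* q) (*-identityˡ x) ⟨
        (t ℕ.* q) ×ᴿ (1# * x)  ≈⟨ ×-assoc-* (t ℕ.* q) 1# x ⟨
        (t ℕ.* q) ×ᴿ 1# * x  ≈⟨ *-congʳ (×1-homo-* t q) ⟩
        (t ×ᴿ 1#) * (q ×ᴿ 1#) * x  ≈⟨ *-congʳ (trans (*-congˡ q≈0) (zeroʳ _)) ⟩
        0# * x  ≈⟨ zeroˡ x ⟩
        0#  ∎

    ∣⇒≈0 : ∀ {m} → q ∣ m → m ×ᴿ 1# ≈ 0#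
    ∣⇒≈0 q∣m = multiple≈0 q∣m 1#

    frobenius-+ : ∀ x y → (x + y) ^ q ≈ x ^ q + y ^ q
    frobenius-+ x y = go q q-prime (λ {m} → multiple≈0 {m})
      where
      module B = Binomial commutativeSemiring
      go : ∀ p → Prime p → (∀ {m} → p ∣ m → ∀ x → m ×ᴿ x ≈ 0#) → (x + y) ^ p ≈ x ^ p + y ^ p
      go zero    pr _ = contradiction pr ℕ.¬prime[0]
      go (suc p) pr multiple≈0 = begin
        (x + y) ^ suc p  ≈⟨ B.theorem (suc p) x y ⟩
        t zero + sum (λ (i : Fin (suc p)) → t (suc i))
          ≈⟨ +-cong first (sum-init-last (λ i → t (suc i))) ⟩
        y ^ suc p + (sum (λ (i : Fin p) → t (suc (inject₁ i))) + t (fromℕ (suc p)))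
          ≈⟨ +-congˡ (+-cong (sum-zero inner) final) ⟩
        y ^ suc p + (0# + x ^ suc p)  ≈⟨ trans (+-congˡ (+-identityˡ _)) (+-comm _ _) ⟩
        x ^ suc p + y ^ suc p  ∎
        where
        t : Fin (suc (suc p)) → Carrier
        t = B.binomialTerm x y (suc p)
        first : t zero ≈ y ^ suc p
        first = trans (+-identityʳ _) (*-identityˡ _)
        final : t (fromℕ (suc p)) ≈ x ^ suc p
        final = begin
          (suc p C suc (toℕ (fromℕ p))) ×ᴿ (x ^ suc (toℕ (fromℕ p)) * y ^ (p ℕ.∸ toℕ (fromℕ p)))
            ≡⟨ ≡.cong (λ k → (suc p C suc k) ×ᴿ (x ^ suc k * y ^ (p ℕ.∸ k))) (Fin.toℕ-fromℕ p) ⟩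
          (suc p C suc p) ×ᴿ (x ^ suc p * y ^ (p ℕ.∸ p))
            ≡⟨ ≡.cong₂ (λ k m → k ×ᴿ (x ^ suc p * y ^ m)) (ℕ.nCn≡1 (suc p)) (ℕ.n∸n≡0 p) ⟩
          1 ×ᴿ (x ^ suc p * 1#)
            ≈⟨ trans (+-identityʳ _) (*-identityʳ _) ⟩
          x ^ suc p ∎
        inner : ∀ i → t (suc (inject₁ i)) ≈ 0#
        inner i = multiple≈0 (prime∣C pr (s≤s z≤n) (s≤s (≡.subst (ℕ._< p) (≡.sym (Fin.toℕ-inject₁ i)) (Fin.toℕ<n i)))) _

    frobenius-sum : ∀ {n} (f : Fin n → Carrier) → sum f ^ q ≈ sum (λ i → f i ^ q)
    frobenius-sum {zero}  f = go q (prime>0 q-prime)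
      where
      go : ∀ p → 0 ℕ.< p → 0# ^ p ≈ 0#
      go (suc p) _ = zeroˡ _
    frobenius-sum {suc n} f = trans (frobenius-+ (f zero) (sum (f ∘ suc))) (+-congˡ (frobenius-sum (f ∘ suc)))

    module _ (F : Subfield) (g : Generator F) where
      private
        module F = Subfield F
        v = u g ^ q

      power-coprime : Coprime q (exponent g)
      power-coprime = [ Coprime.sym , (λ q∣n → contradiction (∣⇒≈0 q∣n) (exponent≉0 g)) ]′ (prime⇒coprime⊎∣ q-prime (exponent g))

      -- q is prime to the exponent, so by Bézout u is a quotient of powers of u^q and of the known
      -- power of u in F; thus F(u) = F(u^q).
      generator∈ : ∀ (Q : Subfield) → (∀ {x} → F.Mem x → Subfield.Mem Q x) → Subfield.Mem Q v → Subfield.Mem Q (u g)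
      generator∈ Q F⊆Q v∈ = case Coprime.coprime-Bézout power-coprime of λ where
          (Bézout.+- x y e) → divide (exponent g) y (F⊆Q (power∈ g)) q x v∈ e
          (Bézout.-+ x y e) → divide q x v∈ (exponent g) y (F⊆Q (power∈ g)) e
        where
        module Q = Subfield Q
        divide : ∀ m y → Q.Mem (u g ^ m) → ∀ n x → Q.Mem (u g ^ n) → 1 ℕ.+ y ℕ.* m ≡ x ℕ.* n → Q.Mem (u g)
        divide m y u^m∈ n x u^n∈ e = Q.cancel∈ (^≉0 y (^≉0 m (u≉0 g))) (Q.^∈ y u^m∈) (Q.resp (begin
          (u g ^ n) ^ x  ≈⟨ trans (^-assocʳ (u g) n x) (^-congʳ (u g) (≡.trans (ℕ.*-comm n x) (≡.sym e))) ⟩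
          u g * u g ^ (y ℕ.* m)  ≈⟨ *-comm _ _ ⟩
          u g ^ (y ℕ.* m) * u g  ≈⟨ *-congʳ (trans (^-assocʳ (u g) m y) (^-congʳ (u g) (ℕ.*-comm m y))) ⟨
          (u g ^ m) ^ y * u g  ∎) (Q.^∈ x u^n∈))

      -- A relation would give u^q a degree d″ < d. But u ∈ F(u^q), so the d independent powers of u
      -- would lie in the span of d″ elements.
      powers-independent : ∀ {d} → HasDegreeOver F (u g) d → Independent F.subring (pow v d)
      powers-independent {d} D = ¬dependent⇒independent λ dep →
        let d′ , d′<d , cl = dependent⇒closes F v d dep
            d″ , d″≤d′ , D″ = degree F v cl
            module D″ = HasDegreeOver D″
            Q = adjoin-subfield F v d″ D″.degree>0 D″.closes
            u∈Q = generator∈ Q (base∈adjoin F.subring v d″ D″.degree>0 D″.closes) (gen∈adjoin F.subring v d″ D″.degree>0 D″.closes)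
            open Dependent (span-dependent F (pow v d″) (pow (u g) d) (ℕ.≤-<-trans d″≤d′ d′<d) (λ i → Subfield.^∈ Q (toℕ i) u∈Q))
        in scalars≉0 (coefficient≈0 (HasDegreeOver.pow-independent D) scalars scalars∈ vanishes index)

      -- With x = ∑ cᵢ uⁱ, the powers u^(i q) are independent over F because F[u] = F[u^q], so x^q ∈ F forces cᵢ^q = 0 for i > 0.
      purely-inseparable-step : ∀ {x} → Subfield.Mem (F[u] g) x → F.Mem (x ^ q) → F.Mem x
      purely-inseparable-step {x} x∈ x^q∈ = go (degree F (u g) (closes g))
        where
        go : ∃[ d ] (d ℕ.≤ exponent g × HasDegreeOver F (u g) d) → F.Mem x
        go (zero  , _ , D) = contradiction (HasDegreeOver.degree>0 D) (ℕ.<-irrefl ≡.refl)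
        go (suc d , _ , D) = F.resp (sym x≈) (coefficient∈ x∈′ zero)
          where
          module D = HasDegreeOver D
          x∈′ : InSpan F.subring (pow (u g) (suc d)) x
          x∈′ = span∈ {F.subring} {adjoin F.subring (u g) (suc d) D.degree>0 D.closes} (base∈adjoin F.subring (u g) (suc d) D.degree>0 D.closes)
                  (λ i → Subring.^∈ (adjoin F.subring (u g) (suc d) D.degree>0 D.closes) (toℕ i) (gen∈adjoin F.subring (u g) (suc d) D.degree>0 D.closes)) x∈
          a : Fin (suc d) → Carrier
          a = coefficient x∈′
          x^q≈ : sum (λ i → a i ^ q * pow v (suc d) i) ≈ sum (λ i → x ^ q * δ zero i * pow v (suc d) i)
          x^q≈ = begin
            sum (λ i → a i ^ q * pow v (suc d) i)
              ≈⟨ sum-cong (λ i → trans (^-distrib-* (a i) (u g ^ toℕ i) q) (*-congˡ (^-comm (u g) (toℕ i) q))) ⟨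
            sum (λ i → (a i * pow (u g) (suc d) i) ^ q)
              ≈⟨ frobenius-sum (λ i → a i * pow (u g) (suc d) i) ⟨
            sum (λ i → a i * pow (u g) (suc d) i) ^ q
              ≈⟨ ^-congˡ q (expansion x∈′) ⟨
            x ^ q
              ≈⟨ trans (*-congˡ (sum-δ zero (pow v (suc d)))) (*-identityʳ _) ⟨
            x ^ q * sum (λ i → δ zero i * pow v (suc d) i)
              ≈⟨ sum-scale (x ^ q) (δ zero) (pow v (suc d)) ⟩
            sum (λ i → x ^ q * δ zero i * pow v (suc d) i) ∎
          a-suc≈0 : ∀ i → a (suc i) ≈ 0#
          a-suc≈0 i = by-contradiction em λ ≉0 → ^≉0 q ≉0 (trans
            (independent-unique (powers-independent D) (λ i → F.^∈ q (coefficient∈ x∈′ i)) (λ i → F.*∈ x^q∈ (F.δ∈ zero i)) x^q≈ (suc i))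
            (zeroʳ _))
          x≈ : x ≈ a zero
          x≈ = trans (expansion x∈′) (trans (+-cong (*-identityʳ _) (sum-zero (λ i → trans (*-congʳ (a-suc≈0 i)) (zeroˡ (pow (u g) (suc d) (suc i)))))) (+-identityʳ _))

    purely-inseparable : ∀ {k} (F : Subfield) (gs : Vec (Generator F) k) {x} → Subfield.Mem (chain F gs) x → Subfield.Mem F (x ^ q) → Subfield.Mem F x
    purely-inseparable F Vec.[]       x∈ _    = x∈
    purely-inseparable F (g Vec.∷ gs) x∈ x^q∈ =
      purely-inseparable-step F g (purely-inseparable (F[u] g) (lift* g gs) x∈ (F⊆F[u] g x^q∈)) x^q∈

    -- Over F = K(x^q) the same generators span a chain that contains x, and x^q ∈ F; so x ∈ F by
    -- `purely-inseparable`.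
    in-span-of-q-th-powers : ∀ {k} (K : Subfield) (gs : Vec (Generator K) k) {x} → Subfield.Mem (chain K gs) x →
                             ∃[ n ] InSpan (Subfield.subring K) (pow (x ^ q) n) x
    in-span-of-q-th-powers K gs {x} x∈ =
      let n , cl = chain-closes K gs (Subfield.^∈ (chain K gs) q x∈)
          d , _ , D = degree K (x ^ q) cl
          module D = HasDegreeOver D
          F = adjoin-subfield K (x ^ q) d D.degree>0 D.closes
          K⊆F = λ {y} → base∈adjoin K.subring (x ^ q) d D.degree>0 D.closes {y}
          gs′ = Vec.map (lift {K} {F} K⊆F) gs
          x∈′ = chain⊆ K gs (Subfield.subring (chain F gs′)) (λ y∈ → base⊆chain F gs′ (K⊆F y∈)) (VecAll.map⁻ (generators∈chain F gs′)) x∈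
      in d , purely-inseparable F gs′ x∈′ (gen∈adjoin K.subring (x ^ q) d D.degree>0 D.closes)
      where module K = Subfield K

-- Polynomials: division, evaluation and derivatives.

module Coefficients {k kℓ} (K : CommutativeRing k kℓ) where
  open CommutativeRing K hiding (zero)
  open import Algebra.Properties.Ring ring
  open import Algebra.Properties.Semiring.Mult semiring renaming (_×_ to _×ᴷ_)
  open import Relation.Binary.Reasoning.Setoid setoid
  open IntegerSolver K using (solve; _:=_; _:+_; _:*_; _:-_)
  open Polynomial K public

  coeff-+ : ∀ f g n → coeff (f +ₚ g) n ≈ coeff f n + coeff g n
  coeff-+ []      g       n       = sym (+-identityˡ _)
  coeff-+ (c ∷ f) []      n       = sym (+-identityʳ _)
  coeff-+ (c ∷ f) (d ∷ g) zero    = refl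
  coeff-+ (c ∷ f) (d ∷ g) (suc n) = coeff-+ f g n

  coeff-* : ∀ c f n → coeff (List.map (c *_) f) n ≈ c * coeff f n
  coeff-* c []      n       = sym (zeroʳ c)
  coeff-* c (d ∷ f) zero    = refl
  coeff-* c (d ∷ f) (suc n) = coeff-* c f n

  coeff-derivative : ∀ f n → coeff (derivative f) n ≈ suc n ×ᴷ coeff f (suc n)
  coeff-derivative []      n       = sym (×-zeroʳ n)
    where
    ×-zeroʳ : ∀ n → suc n ×ᴷ 0# ≈ 0#
    ×-zeroʳ zero    = +-identityˡ 0#
    ×-zeroʳ (suc n) = trans (+-identityˡ _) (×-zeroʳ n)
  coeff-derivative (c ∷ f) zero    = coeff-+ f (0# ∷ derivative f) zero
  coeff-derivative (c ∷ f) (suc n) = trans (coeff-+ f (0# ∷ derivative f) (suc n)) (+-congˡ (coeff-derivative f n))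

  derivative-cong : ∀ {f g} → f ≈ₚ g → derivative f ≈ₚ derivative g
  derivative-cong {f} {g} eq n = trans (coeff-derivative f n) (trans (×-congʳ (suc n) (eq (suc n))) (sym (coeff-derivative g n)))

  private
    coeff-snoc : ∀ {n} (a v : Vec Carrier n) t m →
      t * coeff (monic v) m + coeff (Vec.toList (Vec.zipWith (λ x y → x - t * y) a v)) m ≈ coeff (Vec.toList (a Vec.∷ʳ t)) m
    coeff-snoc Vec.[]       Vec.[]       t zero    = trans (+-identityʳ _) (*-identityʳ t)
    coeff-snoc Vec.[]       Vec.[]       t (suc m) = trans (+-identityʳ _) (zeroʳ t)
    coeff-snoc (x Vec.∷ a) (y Vec.∷ v) t zero    = solve 3 (λ x y t → t :* y :+ (x :- t :* y) := x) refl x y t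
    coeff-snoc (x Vec.∷ a) (y Vec.∷ v) t (suc m) = coeff-snoc a v t m

    coeff-zeros : ∀ n m → coeff (Vec.toList (Vec.replicate n 0#)) m ≈ 0#
    coeff-zeros zero    m       = refl
    coeff-zeros (suc n) zero    = refl
    coeff-zeros (suc n) (suc m) = coeff-zeros n m

  -- Induction on the dividend: if g leaves remainder r, then c + X g leaves c + X r minus t times
  -- the divisor, where t is the top coefficient of r.
  division : ∀ {n} (v : Vec Carrier (suc n)) g →
             ∃[ q ] Σ[ r ∈ Vec Carrier (suc n) ] g ≈ₚ q *ₚ monic v +ₚ Vec.toList r
  division {n} v []      = [] , Vec.replicate (suc n) 0# , λ m → sym (coeff-zeros (suc n) m)
  division {n} v (c ∷ g) = divide (division v g)
    where
    divide : ∃[ q ] Σ[ r ∈ Vec Carrier (suc n) ] g ≈ₚ q *ₚ monic v +ₚ Vec.toList r →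
             ∃[ q ] Σ[ r ∈ Vec Carrier (suc n) ] c ∷ g ≈ₚ q *ₚ monic v +ₚ Vec.toList r
    divide (q , r , eq) with Vec.initLast r
    ... | r₀ , t , ≡.refl = t ∷ q , r′ , λ m → sym (begin
      coeff ((t ∷ q) *ₚ monic v +ₚ Vec.toList r′) m
        ≈⟨ coeff-+ ((t ∷ q) *ₚ monic v) (Vec.toList r′) m ⟩
      coeff (List.map (t *_) (monic v) +ₚ (0# ∷ q *ₚ monic v)) m + coeff (Vec.toList r′) m
        ≈⟨ +-congʳ (trans (coeff-+ (List.map (t *_) (monic v)) (0# ∷ q *ₚ monic v) m) (+-congʳ (coeff-* t (monic v) m))) ⟩
      t * coeff (monic v) m + coeff (0# ∷ q *ₚ monic v) m + coeff (Vec.toList r′) m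
        ≈⟨ solve 3 (λ x y z → x :+ y :+ z := y :+ (x :+ z)) refl _ _ _ ⟩
      coeff (0# ∷ q *ₚ monic v) m + (t * coeff (monic v) m + coeff (Vec.toList r′) m)
        ≈⟨ +-congˡ (coeff-snoc (c Vec.∷ r₀) v t m) ⟩
      coeff (0# ∷ q *ₚ monic v) m + coeff (c ∷ Vec.toList (r₀ Vec.∷ʳ t)) m
        ≈⟨ shifted m ⟩
      coeff (c ∷ g) m ∎)
      where
      r′ = Vec.zipWith (λ x y → x - t * y) (c Vec.∷ r₀) v
      shifted : ∀ m → coeff (0# ∷ q *ₚ monic v) m + coeff (c ∷ Vec.toList (r₀ Vec.∷ʳ t)) m ≈ coeff (c ∷ g) m
      shifted zero    = +-identityˡ c
      shifted (suc m) = sym (trans (eq m) (coeff-+ (q *ₚ monic v) (Vec.toList (r₀ Vec.∷ʳ t)) m))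

module Evaluation {k kℓ a aℓ} {K : CommutativeRing k kℓ} (A : CommutativeAlgebra K a aℓ) (α : CommutativeAlgebra.Carrier A) where
  private
    module K = CommutativeRing K
  open CommutativeAlgebra A hiding (zero)
  open RingHomomorphism homomorphism
  open import Algebra.Properties.Ring ring
  open import Algebra.Properties.Semiring.Mult semiring renaming (_×_ to _×ᴬ_)
  open import Algebra.Properties.CommutativeSemiring.Exp commutativeSemiring
  open import Relation.Binary.Reasoning.Setoid setoid
  open IntegerSolver commutativeRing using (solve; _:=_; _:+_; _:*_; _:-_)
  open Coefficients K

  infix 10 _⟨α⟩ _′⟨α⟩
  _⟨α⟩ : Poly → Carrier
  f ⟨α⟩ = eval A f α

  _′⟨α⟩ : Poly → Carrier
  f ′⟨α⟩ = eval A (derivative f) α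

  eval-+ : ∀ f g → (f +ₚ g) ⟨α⟩ ≈ f ⟨α⟩ + g ⟨α⟩
  eval-+ []      g       = sym (+-identityˡ _)
  eval-+ (c ∷ f) []      = sym (+-identityʳ _)
  eval-+ (c ∷ f) (d ∷ g) = begin
    ⟦ c K.+ d ⟧ + α * (f +ₚ g) ⟨α⟩  ≈⟨ +-cong (+-homo c d) (*-congˡ (eval-+ f g)) ⟩
    ⟦ c ⟧ + ⟦ d ⟧ + α * (f ⟨α⟩ + g ⟨α⟩)  ≈⟨ solve 5 (λ c d α f g → c :+ d :+ α :* (f :+ g) := (c :+ α :* f) :+ (d :+ α :* g)) refl ⟦ c ⟧ ⟦ d ⟧ α (f ⟨α⟩) (g ⟨α⟩) ⟩
    (⟦ c ⟧ + α * f ⟨α⟩) + (⟦ d ⟧ + α * g ⟨α⟩) ∎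

  eval-scale : ∀ c f → List.map (c K.*_) f ⟨α⟩ ≈ ⟦ c ⟧ * f ⟨α⟩
  eval-scale c []      = sym (zeroʳ _)
  eval-scale c (d ∷ f) = trans (+-cong (*-homo c d) (*-congˡ (eval-scale c f)))
    (solve 4 (λ c d α f → c :* d :+ α :* (c :* f) := c :* (d :+ α :* f)) refl ⟦ c ⟧ ⟦ d ⟧ α (f ⟨α⟩))

  eval-shift : ∀ f → (K.0# ∷ f) ⟨α⟩ ≈ α * f ⟨α⟩
  eval-shift f = trans (+-congʳ 0#-homo) (+-identityˡ _)

  eval-* : ∀ f g → (f *ₚ g) ⟨α⟩ ≈ f ⟨α⟩ * g ⟨α⟩
  eval-* []      g = sym (zeroˡ _)
  eval-* (c ∷ f) g = begin
    (List.map (c K.*_) g +ₚ (K.0# ∷ f *ₚ g)) ⟨α⟩  ≈⟨ eval-+ (List.map (c K.*_) g) (K.0# ∷ f *ₚ g) ⟩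
    List.map (c K.*_) g ⟨α⟩ + (K.0# ∷ f *ₚ g) ⟨α⟩  ≈⟨ +-cong (eval-scale c g) (trans (eval-shift (f *ₚ g)) (*-congˡ (eval-* f g))) ⟩
    ⟦ c ⟧ * g ⟨α⟩ + α * (f ⟨α⟩ * g ⟨α⟩)  ≈⟨ solve 4 (λ c α f g → c :* g :+ α :* (f :* g) := (c :+ α :* f) :* g) refl ⟦ c ⟧ α (f ⟨α⟩) (g ⟨α⟩) ⟩
    (⟦ c ⟧ + α * f ⟨α⟩) * g ⟨α⟩  ∎

  eval-zero : ∀ f → f ≈ₚ [] → f ⟨α⟩ ≈ 0#
  eval-zero []      _  = refl
  eval-zero (c ∷ f) eq = trans (+-cong (trans (⟦⟧-cong (eq 0)) 0#-homo) (trans (*-congˡ (eval-zero f (eq ∘ suc))) (zeroʳ α))) (+-identityˡ 0#)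

  eval-cong : ∀ f g → f ≈ₚ g → f ⟨α⟩ ≈ g ⟨α⟩
  eval-cong []      g       eq = sym (eval-zero g (K.sym ∘ eq))
  eval-cong (c ∷ f) []      eq = eval-zero (c ∷ f) eq
  eval-cong (c ∷ f) (d ∷ g) eq = +-cong (⟦⟧-cong (eq 0)) (*-congˡ (eval-cong f g (eq ∘ suc)))

  derivative-∷ : ∀ c f → (c ∷ f) ′⟨α⟩ ≈ f ⟨α⟩ + α * f ′⟨α⟩
  derivative-∷ c f = trans (eval-+ f (K.0# ∷ derivative f)) (+-congˡ (eval-shift (derivative f)))

  derivative-+ : ∀ f g → (f +ₚ g) ′⟨α⟩ ≈ f ′⟨α⟩ + g ′⟨α⟩
  derivative-+ []      g       = sym (+-identityˡ _)
  derivative-+ (c ∷ f) []      = sym (+-identityʳ _)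
  derivative-+ (c ∷ f) (d ∷ g) = begin
    (c K.+ d ∷ f +ₚ g) ′⟨α⟩  ≈⟨ derivative-∷ (c K.+ d) (f +ₚ g) ⟩
    (f +ₚ g) ⟨α⟩ + α * (f +ₚ g) ′⟨α⟩  ≈⟨ +-cong (eval-+ f g) (*-congˡ (derivative-+ f g)) ⟩
    f ⟨α⟩ + g ⟨α⟩ + α * (f ′⟨α⟩ + g ′⟨α⟩)  ≈⟨ solve 5 (λ f g α f′ g′ → f :+ g :+ α :* (f′ :+ g′) := (f :+ α :* f′) :+ (g :+ α :* g′)) refl (f ⟨α⟩) (g ⟨α⟩) α (f ′⟨α⟩) (g ′⟨α⟩) ⟩
    (f ⟨α⟩ + α * f ′⟨α⟩) + (g ⟨α⟩ + α * g ′⟨α⟩)  ≈⟨ +-cong (derivative-∷ c f) (derivative-∷ d g) ⟨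
    (c ∷ f) ′⟨α⟩ + (d ∷ g) ′⟨α⟩  ∎

  derivative-scale : ∀ c f → List.map (c K.*_) f ′⟨α⟩ ≈ ⟦ c ⟧ * f ′⟨α⟩
  derivative-scale c []      = sym (zeroʳ _)
  derivative-scale c (d ∷ f) = begin
    (c K.* d ∷ List.map (c K.*_) f) ′⟨α⟩  ≈⟨ derivative-∷ (c K.* d) (List.map (c K.*_) f) ⟩
    List.map (c K.*_) f ⟨α⟩ + α * List.map (c K.*_) f ′⟨α⟩  ≈⟨ +-cong (eval-scale c f) (*-congˡ (derivative-scale c f)) ⟩
    ⟦ c ⟧ * f ⟨α⟩ + α * (⟦ c ⟧ * f ′⟨α⟩)  ≈⟨ solve 4 (λ c α f f′ → c :* f :+ α :* (c :* f′) := c :* (f :+ α :* f′)) refl ⟦ c ⟧ α (f ⟨α⟩) (f ′⟨α⟩) ⟩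
    ⟦ c ⟧ * (f ⟨α⟩ + α * f ′⟨α⟩)  ≈⟨ *-congˡ (derivative-∷ d f) ⟨
    ⟦ c ⟧ * (d ∷ f) ′⟨α⟩  ∎

  -- The product rule is wanted only at α, where it becomes an identity between elements of the
  -- algebra.
  derivative-* : ∀ f g → (f *ₚ g) ′⟨α⟩ ≈ f ′⟨α⟩ * g ⟨α⟩ + f ⟨α⟩ * g ′⟨α⟩
  derivative-* []      g = sym (trans (+-cong (zeroˡ _) (zeroˡ _)) (+-identityˡ 0#))
  derivative-* (c ∷ f) g = begin
    (List.map (c K.*_) g +ₚ (K.0# ∷ f *ₚ g)) ′⟨α⟩
      ≈⟨ derivative-+ (List.map (c K.*_) g) (K.0# ∷ f *ₚ g) ⟩
    List.map (c K.*_) g ′⟨α⟩ + (K.0# ∷ f *ₚ g) ′⟨α⟩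
      ≈⟨ +-cong (derivative-scale c g) (trans (derivative-∷ K.0# (f *ₚ g)) (+-cong (eval-* f g) (*-congˡ (derivative-* f g)))) ⟩
    ⟦ c ⟧ * g ′⟨α⟩ + (f ⟨α⟩ * g ⟨α⟩ + α * (f ′⟨α⟩ * g ⟨α⟩ + f ⟨α⟩ * g ′⟨α⟩))
      ≈⟨ solve 6 (λ c α f g f′ g′ → c :* g′ :+ (f :* g :+ α :* (f′ :* g :+ f :* g′)) := (f :+ α :* f′) :* g :+ (c :+ α :* f) :* g′) refl ⟦ c ⟧ α (f ⟨α⟩) (g ⟨α⟩) (f ′⟨α⟩) (g ′⟨α⟩) ⟩
    (f ⟨α⟩ + α * f ′⟨α⟩) * g ⟨α⟩ + (⟦ c ⟧ + α * f ⟨α⟩) * g ′⟨α⟩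
      ≈⟨ +-congʳ (*-congʳ (derivative-∷ c f)) ⟨
    (c ∷ f) ′⟨α⟩ * g ⟨α⟩ + (c ∷ f) ⟨α⟩ * g ′⟨α⟩ ∎

  derivative-eval-cong : ∀ f g → f ≈ₚ g → f ′⟨α⟩ ≈ g ′⟨α⟩
  derivative-eval-cong f g eq = eval-cong (derivative f) (derivative g) (derivative-cong {f} {g} eq)

  X^_·_ : ℕ → Poly → Poly
  X^ m · f = List.replicate m K.0# List.++ f

  eval-X^ : ∀ m f → (X^ m · f) ⟨α⟩ ≈ α ^ m * f ⟨α⟩
  eval-X^ zero    f = sym (*-identityˡ _)
  eval-X^ (suc m) f = trans (eval-shift (X^ m · f)) (trans (*-congˡ (eval-X^ m f)) (sym (*-assoc _ _ _)))

  derivative-X^ : ∀ m f → (X^ suc m · f) ′⟨α⟩ ≈ suc m ×ᴬ (α ^ m * f ⟨α⟩) + α ^ suc m * f ′⟨α⟩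
  derivative-X^ zero    f = trans (derivative-∷ K.0# f)
    (+-cong (sym (trans (+-identityʳ _) (*-identityˡ _))) (*-congʳ (sym (*-identityʳ α))))
  derivative-X^ (suc m) f = begin
    (K.0# ∷ (X^ suc m · f)) ′⟨α⟩
      ≈⟨ trans (derivative-∷ K.0# (X^ suc m · f)) (+-cong (eval-X^ (suc m) f) (*-congˡ (derivative-X^ m f))) ⟩
    y + α * (suc m ×ᴬ (α ^ m * f ⟨α⟩) + α ^ suc m * f ′⟨α⟩)
      ≈⟨ +-congˡ (trans (distribˡ α _ _) (+-cong (trans (×-comm-* (suc m) α _) (×-congʳ (suc m) (sym (*-assoc _ _ _)))) (sym (*-assoc _ _ _)))) ⟩
    y + (suc m ×ᴬ y + α ^ suc (suc m) * f ′⟨α⟩)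
      ≈⟨ +-assoc _ _ _ ⟨
    suc (suc m) ×ᴬ y + α ^ suc (suc m) * f ′⟨α⟩ ∎
    where
    y = α ^ suc m * f ⟨α⟩

-- Minimal polynomials and separability.

module Extension (em : ∀ {a} → ExcludedMiddle a) {k kℓ l lℓ} (K : CommutativeRing k kℓ) (K-field : IsField K)
                 (L : CommutativeAlgebra K l lℓ) (L-field : IsField (CommutativeAlgebra.commutativeRing L)) (r : Level) where
  private
    module K = CommutativeRing K
    module Kᶠ = Field em K K-field
    module L = CommutativeAlgebra L
  open RingHomomorphism L.homomorphism public
    using (⟦_⟧; ⟦⟧-cong; +-homo; *-homo; -‿homo; 0#-homo; 1#-homo)
  open Field em L.commutativeRing L-field
  open Subobjects (k ⊔ kℓ ⊔ r)
  open Simple em L.commutativeRing L-field (k ⊔ kℓ ⊔ r)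
  open Coefficients K

  ⟦⟧-inverse : ∀ {c} → ¬ (c K.≈ K.0#) → ⟦ c ⟧ * ⟦ c Kᶠ.⁻¹ ⟧ ≈ 1#
  ⟦⟧-inverse c≉0 = trans (sym (*-homo _ _)) (trans (⟦⟧-cong (Kᶠ.⁻¹-inverseʳ c≉0)) 1#-homo)

  ⟦⟧≉0 : ∀ {c} → ¬ (c K.≈ K.0#) → ⟦ c ⟧ ≉ 0#
  ⟦⟧≉0 c≉0 = *≉0⇒ˡ (1≉0 ∘ trans (sym (⟦⟧-inverse c≉0)))

  ⟦⟧≈0 : ∀ {c} → ⟦ c ⟧ ≈ 0# → c K.≈ K.0#
  ⟦⟧≈0 eq = by-contradiction em λ c≉0 → ⟦⟧≉0 c≉0 eq

  ⟦×1⟧ : ∀ n → ⟦ n Kᶠ.×ᴿ K.1# ⟧ ≈ n ×ᴿ 1#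
  ⟦×1⟧ zero    = 0#-homo
  ⟦×1⟧ (suc n) = trans (+-homo _ _) (+-cong 1#-homo (⟦×1⟧ n))

  -- The level is padded by r so that K becomes a subfield at the level at which U is available as
  -- well.
  record Image (x : Carrier) : Set (l ⊔ lℓ ⊔ k ⊔ kℓ ⊔ r) where
    constructor image
    field
      preimage : K.Carrier
      image≈   : ⟦ preimage ⟧ ≈ x
  open Image public

  base : Subfield
  base = record
    { subring = record
      { Mem  = Image
      ; resp = λ { x≈y (image c eq) → image c (trans eq x≈y) }
      ; 1∈   = image K.1# 1#-homo
      ; +∈   = λ { (image c eq) (image d eq′) → image (c K.+ d) (trans (+-homo c d) (+-cong eq eq′)) }
      ; *∈   = λ { (image c eq) (image d eq′) → image (c K.* d) (trans (*-homo c d) (*-cong eq eq′)) }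
      ; -∈   = λ { (image c eq) → image (K.- c) (trans (-‿homo c) (-‿cong eq)) }
      }
    ; ⁻¹∈ = λ { {x} (image c eq) → case em {P = c K.≈ K.0#} of λ where
        (yes c≈0) → image K.0# (trans 0#-homo (sym (⁻¹-zero (trans (sym eq) (trans (⟦⟧-cong c≈0) 0#-homo)))))
        (no  c≉0) → image (c Kᶠ.⁻¹) (⁻¹-unique (trans (*-congʳ (sym eq)) (⟦⟧-inverse c≉0))) }
    }

  private
    module base = Subfield base
    P = base.subring

  module _ {α : Carrier} where
    open Evaluation L α

    eval-vec : ∀ {n} (v : Vec K.Carrier n) → Vec.toList v ⟨α⟩ ≈ sum (λ i → ⟦ Vec.lookup v i ⟧ * pow α n i)
    eval-vec Vec.[]      = refl
    eval-vec (c Vec.∷ v) = trans (+-congˡ (*-congˡ (eval-vec v))) (sym (sum-pow-suc (λ i → ⟦ Vec.lookup (c Vec.∷ v) i ⟧) α))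

    eval-snoc : ∀ {n} (v : Vec K.Carrier n) c → Vec.toList (v Vec.∷ʳ c) ⟨α⟩ ≈ Vec.toList v ⟨α⟩ + ⟦ c ⟧ * α ^ n
    eval-snoc         Vec.[]      c = trans (+-congˡ (zeroʳ α)) (trans (+-comm _ _) (+-congˡ (sym (*-identityʳ _))))
    eval-snoc {suc n} (d Vec.∷ v) c = trans (+-congˡ (*-congˡ (eval-snoc v c)))
      (solve 5 (λ d α v c β → d :+ α :* (v :+ c :* β) := (d :+ α :* v) :+ c :* (α :* β)) refl ⟦ d ⟧ α (Vec.toList v ⟨α⟩) ⟦ c ⟧ (α ^ n))

    eval-span : ∀ {n} (v : Vec K.Carrier n) → InSpan P (pow α n) (Vec.toList v ⟨α⟩)
    eval-span v = combination (λ i → ⟦ Vec.lookup v i ⟧) (λ i → image (Vec.lookup v i) refl) (eval-vec v)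

    span-eval : ∀ {n x} → InSpan P (pow α n) x → ∃[ v ] x ≈ Vec.toList {n = n} v ⟨α⟩
    span-eval (combination a a∈ eq) = Vec.tabulate (preimage ∘ a∈) , trans eq (sym (trans (eval-vec (Vec.tabulate (preimage ∘ a∈)))
      (sum-cong (λ i → *-congʳ (trans (reflexive (≡.cong ⟦_⟧ (Vec.lookup∘tabulate (preimage ∘ a∈) i))) (image≈ (a∈ i)))))))

    1-monic : ∀ {n} (v : Vec K.Carrier n) → monic v ⟨α⟩ ≈ Vec.toList v ⟨α⟩ + α ^ n
    1-monic {n} v = trans (eval-snoc v K.1#) (+-congˡ (trans (*-congʳ 1#-homo) (*-identityˡ _)))

    root⇒closes : ∀ {n} (v : Vec K.Carrier n) → monic v ⟨α⟩ ≈ 0# → Closes P α n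
    root⇒closes {n} v eq = span-resp (sym (+-inverseʳ-unique _ (α ^ n) (trans (sym (1-monic v)) eq))) (span-neg (eval-span v))

    closes⇒root : ∀ {n} → Closes P α n → ∃[ v ] monic {n} v ⟨α⟩ ≈ 0#
    closes⇒root {n} cl =
      let v , eq = span-eval (span-neg cl)
      in v , trans (1-monic v) (trans (+-congʳ (sym eq)) (-‿inverseˡ _))

    -- Isolates the leading term n c α^(n-1) of the derivative at α; a vanishing derivative can then
    -- be solved for α^(n-1).
    derivative-snoc : ∀ {n} (v : Vec K.Carrier n) c →
      ∃[ y ] (InSpan P (pow α (ℕ.pred n)) y × Vec.toList (v Vec.∷ʳ c) ′⟨α⟩ ≈ y + n ×ᴿ ⟦ c ⟧ * α ^ ℕ.pred n)
    derivative-snoc         Vec.[]                c = 0# , span-0 , trans (trans (+-cong 0#-homo (zeroʳ α)) (+-identityˡ 0#)) (sym (trans (+-identityˡ _) (zeroˡ _)))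
    derivative-snoc {suc zero} (d Vec.∷ Vec.[]) c = 0# , span-0 , trans (derivative-∷ d (c ∷ []))
      (trans (+-cong (+-congˡ (zeroʳ α)) (*-congˡ (trans (+-cong 0#-homo (zeroʳ α)) (+-identityˡ 0#))))
      (solve 2 (λ c α → c :+ :0 :+ α :* :0 := :0 :+ (c :+ :0) :* :1) refl ⟦ c ⟧ α))
    derivative-snoc {suc (suc n)} (d Vec.∷ v) c =
      let y , y∈ , eq = derivative-snoc v c
          w = Vec.toList v ⟨α⟩
      in w + y * α ,
         span-+ (eval-span v) (span-*ʳ α (λ i → span-resp (trans (^-suc α (toℕ i)) refl) (pow-gen P α (suc n) (s≤s (Fin.toℕ<n i)))) y∈) ,
         trans (derivative-∷ d (Vec.toList (v Vec.∷ʳ c))) (trans (+-cong (eval-snoc v c) (*-congˡ eq))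
           (solve 6 (λ w c α β y nc → (w :+ c :* (α :* β)) :+ α :* (y :+ nc :* β) := (w :+ y :* α) :+ (c :+ nc) :* (α :* β)) refl w ⟦ c ⟧ α (α ^ n) y (suc n ×ᴿ ⟦ c ⟧)))

    module _ {d : ℕ} (D : HasDegreeOver base α (suc d)) where
      open HasDegreeOver D

      minimal-polynomial : ∃[ v ] IsMinimalPolynomial L α {suc d} v
      minimal-polynomial =
        let v , root = closes⇒root closes
        in v , root , λ w m<d root′ → minimal m<d (root⇒closes w root′)

      -- The remainder of g modulo the minimal polynomial vanishes at α and has too small a degree,
      -- so its coefficients are zero by independence of the powers of α.
      root⇒multiple : ∀ (v : Vec K.Carrier (suc d)) → monic v ⟨α⟩ ≈ 0# → ∀ g → g ⟨α⟩ ≈ 0# → ∃[ q ] g ≈ₚ q *ₚ monic v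
      root⇒multiple v root g g≈0 =
        let q , s , eq = division v g
            s≈0 : Vec.toList s ⟨α⟩ ≈ 0#
            s≈0 = trans (sym (trans (+-congʳ (trans (eval-* q (monic v)) (trans (*-congˡ root) (zeroʳ _)))) (+-identityˡ _)))
                    (trans (sym (trans (eval-cong g (q *ₚ monic v +ₚ Vec.toList s) eq) (eval-+ (q *ₚ monic v) (Vec.toList s)))) g≈0)
            s-zero : ∀ i → Vec.lookup s i K.≈ K.0#
            s-zero i = ⟦⟧≈0 (coefficient≈0 pow-independent (λ i → ⟦ Vec.lookup s i ⟧) (λ i → image (Vec.lookup s i) refl) (trans (sym (eval-vec s)) s≈0) i)
        in q , λ m → K.trans (eq m) (K.trans (coeff-+ (q *ₚ monic v) (Vec.toList s) m) (K.trans (K.+-congˡ (coeff-zero s s-zero m)) (K.+-identityʳ _)))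
        where
        coeff-zero : ∀ {n} (s : Vec K.Carrier n) → (∀ i → Vec.lookup s i K.≈ K.0#) → ∀ m → coeff (Vec.toList s) m K.≈ K.0#
        coeff-zero Vec.[]      _  m       = K.refl
        coeff-zero (c Vec.∷ s) eq zero    = eq zero
        coeff-zero (c Vec.∷ s) eq (suc m) = coeff-zero s (eq ∘ suc) m

      -- f′(α) is invertible in K(α), say with inverse v(α); then f divides 1 − v f′.
      separable : ∀ (v : Vec K.Carrier (suc d)) → monic v ⟨α⟩ ≈ 0# → monic v ′⟨α⟩ ≉ 0# → IsSeparablePoly (monic v)
      separable v root f′≉0 =
        let module M = Subfield (adjoin-subfield base α (suc d) degree>0 closes)
            α∈ = gen∈adjoin P α (suc d) degree>0 closes
            f′ = derivative (monic v)
            w , w≈ = span-eval (M.⁻¹∈ (eval∈ M.subring (λ c → base∈adjoin P α (suc d) degree>0 closes (image c refl)) α∈ f′))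
            wf′ = Vec.toList w *ₚ f′
            g = (K.1# ∷ []) +ₚ List.map ((K.- K.1#) K.*_) wf′
            g≈0 : g ⟨α⟩ ≈ 0#
            g≈0 = begin
              g ⟨α⟩  ≈⟨ eval-+ (K.1# ∷ []) (List.map ((K.- K.1#) K.*_) wf′) ⟩
              (⟦ K.1# ⟧ + α * 0#) + List.map ((K.- K.1#) K.*_) wf′ ⟨α⟩  ≈⟨ +-cong (trans (+-cong 1#-homo (zeroʳ α)) (+-identityʳ 1#)) (eval-scale (K.- K.1#) wf′) ⟩
              1# + ⟦ K.- K.1# ⟧ * wf′ ⟨α⟩  ≈⟨ +-congˡ (*-cong (trans (-‿homo K.1#) (-‿cong 1#-homo)) (trans (eval-* (Vec.toList w) f′) (trans (*-congʳ (sym w≈)) (⁻¹-inverseˡ f′≉0)))) ⟩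
              1# + - 1# * 1#  ≈⟨ trans (+-congˡ (*-identityʳ _)) (-‿inverseʳ 1#) ⟩
              0#  ∎
            q , g≈ = root⇒multiple v root g g≈0
        in q , Vec.toList w , λ m → K.trans (coeff-+ (q *ₚ monic v) wf′ m) (K.trans (K.+-congʳ (K.sym (g≈ m)))
             (K.trans (K.+-congʳ (K.trans (coeff-+ (K.1# ∷ []) (List.map ((K.- K.1#) K.*_) wf′) m) (K.+-congˡ (coeff-* (K.- K.1#) wf′ m))))
               (cancel (coeff (K.1# ∷ []) m) (coeff wf′ m))))
        where
        eval∈ : ∀ (Q : Subring) → (∀ c → Q ∋ ⟦ c ⟧) → Q ∋ α → ∀ f → Q ∋ f ⟨α⟩
        eval∈ Q K⊆Q α∈ []      = Subring.0∈ Q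
        eval∈ Q K⊆Q α∈ (c ∷ f) = Subring.+∈ Q (K⊆Q c) (Subring.*∈ Q α∈ (eval∈ Q K⊆Q α∈ f))
        cancel : ∀ x y → x K.+ (K.- K.1#) K.* y K.+ y K.≈ x
        cancel = Kᶠ.solve 2 (λ x y → x Kᶠ.:+ (Kᶠ.:- Kᶠ.:1) Kᶠ.:* y Kᶠ.:+ y Kᶠ.:= x) K.refl

      -- If the derivative vanished at α, its leading term (d + 1) α^d could be solved for, and α
      -- would satisfy a monic relation of degree d.
      derivative≉0-char0 : suc d ×ᴿ 1# ≉ 0# → ∀ (v : Vec K.Carrier (suc d)) → monic v ′⟨α⟩ ≉ 0#
      derivative≉0-char0 d≉0 v f′≈0 =
        let y , y∈ , eq = derivative-snoc v K.1#
            n = suc d ×ᴿ ⟦ K.1# ⟧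
            n≈ : n ≈ suc d ×ᴿ 1#
            n≈ = ×-congʳ (suc d) 1#-homo
            n≉0 : n ≉ 0#
            n≉0 = d≉0 ∘ trans (sym n≈)
            nα^d≈ : n * α ^ d ≈ - y
            nα^d≈ = +-inverseʳ-unique y _ (trans (sym eq) f′≈0)
        in minimal (ℕ.n<1+n d) (span-resp
             (trans (sym (*-congˡ nα^d≈)) (trans (sym (*-assoc _ _ _)) (trans (*-congʳ (⁻¹-inverseˡ n≉0)) (*-identityˡ _))))
             (span-* (base.⁻¹∈ (base.resp (sym n≈) (base.×1∈ (suc d)))) (span-neg y∈)))

      -- α = ∑ bⱼ α^(j q) makes α a root of G = X − ∑ bⱼ X^(j q), which has G′ = 1.
      derivative≉0-charp : ∀ q → suc q ×ᴿ 1# ≈ 0# → ∀ {n} → InSpan P (pow (α ^ suc q) n) α →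
                           ∀ (v : Vec K.Carrier (suc d)) → monic v ⟨α⟩ ≈ 0# → monic v ′⟨α⟩ ≉ 0#
      derivative≉0-charp q q≈0 {n} α∈ v root f′≈0 =
        let h , G≈ = root⇒multiple v root G G-root
        in 1≉0 (begin
          1#  ≈⟨ G′≈1 ⟨
          G ′⟨α⟩  ≈⟨ derivative-eval-cong G (h *ₚ monic v) G≈ ⟩
          (h *ₚ monic v) ′⟨α⟩  ≈⟨ derivative-* h (monic v) ⟩
          h ′⟨α⟩ * monic v ⟨α⟩ + h ⟨α⟩ * monic v ′⟨α⟩  ≈⟨ +-cong (trans (*-congˡ root) (zeroʳ _)) (trans (*-congˡ f′≈0) (zeroʳ _)) ⟩
          0# + 0#  ≈⟨ +-identityˡ 0# ⟩
          0#  ∎)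
        where
        -- Replaces X by its power with exponent q + 1, which is the characteristic.
        inflate : ∀ {n} → Vec K.Carrier n → Poly
        inflate Vec.[]      = []
        inflate (c Vec.∷ v) = (c ∷ []) +ₚ (X^ suc q · inflate v)
        constant : ∀ c → (c ∷ []) ⟨α⟩ ≈ ⟦ c ⟧
        constant c = trans (+-congˡ (zeroʳ α)) (+-identityʳ _)
        constant′ : ∀ c → (c ∷ []) ′⟨α⟩ ≈ 0#
        constant′ c = trans (derivative-∷ c []) (trans (+-identityˡ _) (zeroʳ α))
        eval-inflate : ∀ {n} (v : Vec K.Carrier n) → inflate v ⟨α⟩ ≈ sum (λ i → ⟦ Vec.lookup v i ⟧ * pow (α ^ suc q) n i)
        eval-inflate Vec.[]      = refl
        eval-inflate (c Vec.∷ v) = trans (eval-+ (c ∷ []) (X^ suc q · inflate v))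
          (trans (+-cong (constant c) (trans (eval-X^ (suc q) (inflate v)) (*-congˡ (eval-inflate v))))
                 (sym (sum-pow-suc (λ i → ⟦ Vec.lookup (c Vec.∷ v) i ⟧) (α ^ suc q))))
        inflate′ : ∀ {n} (v : Vec K.Carrier n) → inflate v ′⟨α⟩ ≈ 0#
        inflate′ Vec.[]      = refl
        inflate′ (c Vec.∷ v) = trans (derivative-+ (c ∷ []) (X^ suc q · inflate v))
          (trans (+-cong (constant′ c) (trans (derivative-X^ q (inflate v)) (+-cong q×≈0 (trans (*-congˡ (inflate′ v)) (zeroʳ _))))) (trans (+-identityˡ _) (+-identityˡ 0#)))
          where
          q×≈0 : suc q ×ᴿ (α ^ q * inflate v ⟨α⟩) ≈ 0#
          q×≈0 = trans (×-congʳ (suc q) (sym (*-identityˡ _))) (trans (sym (×-assoc-* (suc q) 1# _)) (trans (*-congʳ q≈0) (zeroˡ _)))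
        -α∈ : InSpan P (pow (α ^ suc q) n) (- α)
        -α∈ = span-neg α∈
        b : Vec K.Carrier n
        b = Vec.tabulate (preimage ∘ coefficient∈ -α∈)
        G : Poly
        G = (K.0# ∷ K.1# ∷ []) +ₚ inflate b
        G-root : G ⟨α⟩ ≈ 0#
        G-root = begin
          G ⟨α⟩  ≈⟨ eval-+ (K.0# ∷ K.1# ∷ []) (inflate b) ⟩
          (⟦ K.0# ⟧ + α * (K.1# ∷ []) ⟨α⟩) + inflate b ⟨α⟩  ≈⟨ +-cong (trans (+-cong 0#-homo (*-congˡ (trans (constant K.1#) 1#-homo))) (trans (+-identityˡ _) (*-identityʳ α))) (eval-inflate b) ⟩
          α + sum (λ i → ⟦ Vec.lookup b i ⟧ * pow (α ^ suc q) n i)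
            ≈⟨ +-congˡ (trans (sum-cong (λ i → *-congʳ (trans (reflexive (≡.cong ⟦_⟧ (Vec.lookup∘tabulate (preimage ∘ coefficient∈ -α∈) i))) (image≈ (coefficient∈ -α∈ i))))) (sym (expansion -α∈))) ⟩
          α - α  ≈⟨ -‿inverseʳ α ⟩
          0#  ∎
        G′≈1 : G ′⟨α⟩ ≈ 1#
        G′≈1 = begin
          G ′⟨α⟩  ≈⟨ derivative-+ (K.0# ∷ K.1# ∷ []) (inflate b) ⟩
          (K.0# ∷ K.1# ∷ []) ′⟨α⟩ + inflate b ′⟨α⟩  ≈⟨ +-cong (derivative-∷ K.0# (K.1# ∷ [])) (inflate′ b) ⟩
          ((K.1# ∷ []) ⟨α⟩ + α * (K.1# ∷ []) ′⟨α⟩) + 0#  ≈⟨ +-identityʳ _ ⟩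
          (K.1# ∷ []) ⟨α⟩ + α * (K.1# ∷ []) ′⟨α⟩  ≈⟨ +-cong (trans (constant K.1#) 1#-homo) (trans (*-congˡ (constant′ K.1#)) (zeroʳ α)) ⟩
          1# + 0#  ≈⟨ +-identityʳ 1# ⟩
          1#  ∎

  open Chains em L.commutativeRing L-field (k ⊔ kℓ ⊔ r)

  -- Let q be the least positive multiple of 1 that vanishes, and p a prime factor of it. The
  -- cofactor is smaller than q, so it does not vanish, and p must.
  first-zero : (∃[ n ] (0 ℕ.< n × n ×ᴿ 1# ≈ 0#)) → ∃[ q ] (Prime q × q ×ᴿ 1# ≈ 0#)
  first-zero (n , 0<n , n≈0) =
      let q , _ , (0<q , q≈0) , min = least em (λ n → 0 ℕ.< n × n ×ᴿ 1# ≈ 0#) {n} (0<n , n≈0)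
          1<q : 1 ℕ.< q
          1<q = case ℕ.m≤n⇒m<n∨m≡n 0<q of λ where
            (inj₁ 1<q)  → 1<q
            (inj₂ 1≡q) → contradiction (trans (sym (+-identityʳ 1#)) (trans (×-congˡ 1≡q) q≈0)) 1≉0
          p , p-prime , divides m eq = prime-divisor 1<q
          m≈0⊎p≈0 = trans (sym (×1-homo-* m p)) (trans (×-congˡ (≡.sym eq)) q≈0)
          m>0 : 0 ℕ.< m
          m>0 = ℕ.n≢0⇒n>0 (λ m≡0 → ℕ.<⇒≢ 0<q (≡.sym (≡.trans eq (≡.cong (ℕ._* p) m≡0))))
          m<q : m ℕ.< q
          m<q = ≡.subst (m ℕ.<_) (≡.sym eq) (ℕ.m<m*n m p {{ℕ.>-nonZero m>0}} (ℕ.nonTrivial⇒n>1 p {{ℕ.prime⇒nonTrivial p-prime}}))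
      in p , p-prime , *≈0 (λ m≈0 → min m<q (m>0 , m≈0)) m≈0⊎p≈0

  separable-element : ∀ {m} (gs : Vec (Generator base) m) {α} → Subfield.Mem (chain base gs) α → IsSeparableElement L α
  separable-element gs {α} α∈ = from (degree base α (proj₂ (chain-closes base gs α∈)))
    where
    open Evaluation L α
    from : ∃[ d ] (d ℕ.≤ proj₁ (chain-closes base gs α∈) × HasDegreeOver base α d) → IsSeparableElement L α
    from (zero  , _ , D) = contradiction (HasDegreeOver.degree>0 D) (ℕ.<-irrefl ≡.refl)
    from (suc d , _ , D) =
      let v , minimal@(root , _) = minimal-polynomial D
      in suc d , v , minimal , separable D v root (f′≉0 v root)
      where
      f′≉0 : ∀ v → monic v ⟨α⟩ ≈ 0# → monic v ′⟨α⟩ ≉ 0#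
      f′≉0 v root = case em {P = suc d ×ᴿ 1# ≈ 0#} of λ where
        (no  d≉0) → derivative≉0-char0 D d≉0 v
        (yes d≈0) → case first-zero (suc d , s≤s z≤n , d≈0) of λ where
          (zero  , q-prime , _)   → contradiction q-prime ℕ.¬prime[0]
          (suc q , q-prime , q≈0) → derivative≉0-charp D q q≈0
            (proj₂ (Characteristic.in-span-of-q-th-powers q-prime q≈0 base gs α∈)) v root

-- Sums of elements of U, and consequences of independence.

module UnitSubgroup (em : ∀ {a} → ExcludedMiddle a) {k kℓ l lℓ u : Level} (K : CommutativeRing k kℓ) (K-field : IsField K)
                    (L : CommutativeAlgebra K l lℓ) (L-field : IsField (CommutativeAlgebra.commutativeRing L))
                    (U : Subgroup (units (CommutativeAlgebra.commutativeRing L)) u)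
                    (Kˣ⊆U : Subgroup.member (baseUnits L) ⊆ Subgroup.member U) where
  private
    module K = CommutativeRing K
    module L = CommutativeAlgebra L
    module U = Subgroup U
    Lˣ = units L.commutativeRing
    Kˣ = baseUnits L
    module Lˣ = AbelianGroup Lˣ
  open Field em L.commutativeRing L-field
  open Subobjects (k ⊔ kℓ ⊔ u)
  open Simple em L.commutativeRing L-field (k ⊔ kℓ ⊔ u)
  open Kummer em L.commutativeRing L-field (k ⊔ kℓ ⊔ u)
  open Kneser em L.commutativeRing L-field (k ⊔ kℓ ⊔ u)
  open Independence em L.commutativeRing L-field (k ⊔ kℓ ⊔ u)
  open Chains em L.commutativeRing L-field (k ⊔ kℓ ⊔ u)
  open Extension em K K-field L L-field u
  open Algebra.Definitions _≈_ using (Invertible)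

  private
    module base = Subfield base
    P = base.subring

  unit-resp : ∀ {x y} → x ≈ y → Invertible 1# _*_ x → Invertible 1# _*_ y
  unit-resp x≈y (x′ , l , r) = x′ , trans (*-congˡ (sym x≈y)) l , trans (*-congʳ (sym x≈y)) r

  unit≉0 : (z : Lˣ.Carrier) → proj₁ z ≉ 0#
  unit≉0 (x , x′ , l , r) = *≉0⇒ˡ (1≉0 ∘ trans (sym r))

  proj-power : ∀ n (z : Lˣ.Carrier) → proj₁ (power Lˣ n z) ≈ proj₁ z ^ n
  proj-power zero    z = refl
  proj-power (suc n) z = *-congˡ (proj-power n z)

  -- Membership in U as a property of elements of L; by `U.resp` it does not depend on the inverse
  -- that is recorded.
  record InU (x : Carrier) : Set (l ⊔ lℓ ⊔ k ⊔ kℓ ⊔ u) where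
    constructor inU
    field
      invertible : Invertible 1# _*_ x
      member     : (x , invertible) ∈ U.member

  element : ∀ {x} → InU x → Lˣ.Carrier
  element {x} (inU inv _) = x , inv

  member⇒InU : (z : Lˣ.Carrier) → z ∈ U.member → InU (proj₁ z)
  member⇒InU z z∈ = inU (proj₂ z) z∈

  InU⇒member : ∀ {x} → InU x → (z : Lˣ.Carrier) → x ≈ proj₁ z → z ∈ U.member
  InU⇒member x∈@(inU inv m) z eq = U.resp {element x∈} {z} eq m

  InU-resp : ∀ {x y} → x ≈ y → InU x → InU y
  InU-resp {x} {y} eq x∈ = inU (unit-resp eq (InU.invertible x∈)) (InU⇒member x∈ (y , _) eq)

  member⇒image : (z : Lˣ.Carrier) → z ∈ Subgroup.member Kˣ → Image (proj₁ z)
  member⇒image z ((c , _) , eq) = image c eq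

  image⇒member : (z : Lˣ.Carrier) → Image (proj₁ z) → z ∈ Subgroup.member Kˣ
  image⇒member z (image c eq) = (c , proj₂ K-field c c≉0) , eq
    where
    c≉0 : ¬ (c K.≈ K.0#)
    c≉0 c≈0 = unit≉0 z (trans (sym eq) (trans (⟦⟧-cong c≈0) 0#-homo))

  unitGroup : UnitGroup base
  unitGroup = record
    { Mem   = InU
    ; resp  = InU-resp
    ; ≉0    = λ x∈ → unit≉0 (element x∈)
    ; *∈    = λ x∈ y∈ → inU (proj₂ (element x∈ Lˣ.∙ element y∈)) (U.∙-closed {element x∈} {element y∈} (InU.member x∈) (InU.member y∈))
    ; ⁻¹∈   = λ { x∈@(inU (x′ , l , r) m) → InU-resp (⁻¹-unique r) (inU (proj₂ (element x∈ Lˣ.⁻¹)) (U.⁻¹-closed {element x∈} m)) }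
    ; base∈ = λ {x} c∈ x≉0 → let z = x , proj₂ L-field x x≉0 in inU (proj₂ z) (Kˣ⊆U {z} (image⇒member z c∈))
    }

  module UG = UnitGroup unitGroup

  -‿InU : ∀ {x} → InU x → InU (- x)
  -‿InU x∈ = UG.resp (-1*x≈-x _) (UG.*∈ (UG.base∈ (base.-∈ base.1∈) (λ -1≈0 → 1≉0 (trans (sym (-‿involutive 1#)) (trans (-‿cong -1≈0) -0#≈0#)))) x∈)

  -‿Image : ∀ {x} → Image (- x) → Image x
  -‿Image p = base.resp (-‿involutive _) (base.-∈ p)

  -- E without representatives: nonzero scalars are absorbed into U, which makes closure under
  -- multiplication evident.
  record Totals (y : Carrier) : Set (l ⊔ lℓ ⊔ k ⊔ kℓ ⊔ u) where
    constructor totals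
    field
      summands  : List Carrier
      summands∈ : All InU summands
      total≈    : y ≈ total summands

  private
    total-* : ∀ {xs ys} → All InU xs → All InU ys → Totals (total xs * total ys)
    total-* []                  ys∈ = totals [] [] (zeroˡ _)
    total-* {x ∷ xs} {ys} (x∈ ∷ xs∈) ys∈ =
      let totals zs zs∈ eq = total-* xs∈ ys∈
      in totals (List.map (_* x) ys List.++ zs) (All.++⁺ (All.map⁺ (All.map (λ y∈ → UG.*∈ y∈ x∈) ys∈)) zs∈)
           (trans (distribʳ _ _ _) (trans (+-cong (trans (*-comm _ _) (total-*ʳ ys x)) eq) (sym (total-++ (List.map (_* x) ys) zs))))

  Totals-unit : ∀ {x} → InU x → Totals x
  Totals-unit {x} x∈ = totals (x ∷ []) (x∈ ∷ []) (sym (+-identityʳ x))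

  Totals-resp : ∀ {x y} → x ≈ y → Totals x → Totals y
  Totals-resp x≈y (totals us us∈ eq) = totals us us∈ (trans (sym x≈y) eq)

  Totals-* : ∀ {x y} → Totals x → Totals y → Totals (x * y)
  Totals-* (totals us us∈ eq) (totals vs vs∈ eq′) = Totals-resp (*-cong (sym eq) (sym eq′)) (total-* us∈ vs∈)

  totalsRing : Subring
  totalsRing = record
    { Mem  = Totals
    ; resp = Totals-resp
    ; 1∈   = Totals-unit (UG.base∈ base.1∈ 1≉0)
    ; +∈   = λ { (totals us us∈ eq) (totals vs vs∈ eq′) → totals (us List.++ vs) (All.++⁺ us∈ vs∈) (trans (+-cong eq eq′) (sym (total-++ us vs))) }
    ; *∈   = Totals-*
    ; -∈   = λ p → Totals-resp (-1*x≈-x _) (Totals-* (Totals-unit (-‿InU (UG.base∈ base.1∈ 1≉0))) p)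
    }

  module TR = Subring totalsRing

  image⇒Totals : ∀ {x} → Image x → Totals x
  image⇒Totals {x} x∈ = case em {P = x ≈ 0#} of λ where
    (yes x≈0) → TR.resp (sym x≈0) TR.0∈
    (no  x≉0) → Totals-unit (UG.base∈ x∈ x≉0)

  total-tabulate : ∀ {n} (f : Fin n → Carrier) → total (List.tabulate f) ≈ sum f
  total-tabulate {zero}  f = refl
  total-tabulate {suc n} f = +-congˡ (total-tabulate (f ∘ suc))

  module Torsion (conditions : KneserConditions base unitGroup) where
    open KneserConditions conditions

    generator : ∀ {x} → InU x → Generator base
    generator {x} x∈ = record { u = x ; u≉0 = UG.≉0 x∈ ; exponent = proj₁ (torsion x∈)
                              ; exponent≉0 = proj₁ (proj₂ (torsion x∈)) ; power∈ = proj₂ (proj₂ (torsion x∈)) }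

    generators : ∀ {xs} → All InU xs → Vec (Generator base) (List.length xs)
    generators []         = Vec.[]
    generators (x∈ ∷ xs∈) = generator x∈ Vec.∷ generators xs∈

    generators-Totals : ∀ {xs} (xs∈ : All InU xs) → VecAll.All (λ g → Totals (Generator.u g)) (generators xs∈)
    generators-Totals []         = VecAll.[]
    generators-Totals (x∈ ∷ xs∈) = Totals-unit x∈ VecAll.∷ generators-Totals xs∈

    total∈ : ∀ (Q : Subring) {xs} (xs∈ : All InU xs) → VecAll.All (λ g → Q ∋ Generator.u g) (generators xs∈) → Q ∋ total xs
    total∈ Q []         VecAll.[]         = Subring.0∈ Q
    total∈ Q (x∈ ∷ xs∈) (p VecAll.∷ ps) = Subring.+∈ Q p (total∈ Q xs∈ ps)

    module _ {y : Carrier} (y∈ : Totals y) where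
      open Totals y∈

      Totals-chain : Subfield
      Totals-chain = chain base (generators summands∈)

      ∈Totals-chain : Subfield.Mem Totals-chain y
      ∈Totals-chain = Subfield.resp Totals-chain (sym total≈)
        (total∈ (Subfield.subring Totals-chain) summands∈ (generators∈chain base (generators summands∈)))

      -- The chain on the summands is a field containing y, and by `chain⊆` all its elements are
      -- sums of elements of U.
      Totals-⁻¹ : Totals (y ⁻¹)
      Totals-⁻¹ = chain⊆ base (generators summands∈) totalsRing image⇒Totals (generators-Totals summands∈)
        (Subfield.⁻¹∈ Totals-chain ∈Totals-chain)

      Totals-separable : IsSeparableElement L y
      Totals-separable = separable-element (generators summands∈) ∈Totals-chain

  module FromIndependence (unitTotals : UnitTotals base unitGroup) where

    sum-units : ∀ {n} (f : Fin n → Carrier) → (∀ i → InU (f i)) → sum f ≈ 1# → ∃[ i ] Image (f i)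
    sum-units f f∈ eq = Any.tabulate⁻ (unitTotals (List.tabulate f) (All.tabulate⁺ f∈) (trans (total-tabulate f) eq))

    -- The quotient of the two given elements of K is w^(j-i): if z shares its coset with two powers
    -- of w, some positive power of w lies in K.
    image-power-difference : ∀ {w} → InU w → ∀ {i j} → i ℕ.< j → ∀ {z} → z ≉ 0# → Image (z * (w ^ i) ⁻¹) → Image (z * (w ^ j) ⁻¹) →
                             ∃[ m ] (0 ℕ.< m × Image (w ^ m))
    image-power-difference {w} w∈ {i} {j} i<j {z} z≉0 p q = j ℕ.∸ i , ℕ.m<n⇒0<n∸m i<j , base.resp eq (base.*∈ p (base.⁻¹∈ q))
      where
      w^≉0 : ∀ m → w ^ m ≉ 0#
      w^≉0 m = ^≉0 m (UG.≉0 w∈)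
      d = j ℕ.∸ i
      q≉0 : z * (w ^ j) ⁻¹ ≉ 0#
      q≉0 = *≉0 z≉0 (⁻¹≉0 (w^≉0 j))
      eq : z * (w ^ i) ⁻¹ * (z * (w ^ j) ⁻¹) ⁻¹ ≈ w ^ d
      eq = trans (*-congʳ (begin
        z * (w ^ i) ⁻¹  ≈⟨ trans (*-congˡ (⁻¹-inverseˡ (w^≉0 j))) (*-identityʳ _) ⟨
        z * (w ^ i) ⁻¹ * ((w ^ j) ⁻¹ * w ^ j)  ≈⟨ *-congˡ (*-congˡ (trans (^-congʳ w (≡.sym (ℕ.m+[n∸m]≡n (ℕ.<⇒≤ i<j)))) (^-homo-* w i d))) ⟩
        z * (w ^ i) ⁻¹ * ((w ^ j) ⁻¹ * (w ^ i * w ^ d))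
          ≈⟨ solve 5 (λ z a b c d → z :* a :* (b :* (c :* d)) := (a :* c) :* (d :* (z :* b))) refl z ((w ^ i) ⁻¹) ((w ^ j) ⁻¹) (w ^ i) (w ^ d) ⟩
        ((w ^ i) ⁻¹ * w ^ i) * (w ^ d * (z * (w ^ j) ⁻¹))
          ≈⟨ trans (*-congʳ (⁻¹-inverseˡ (w^≉0 i))) (*-identityˡ _) ⟩
        w ^ d * (z * (w ^ j) ⁻¹) ∎))
        (trans (*-assoc _ _ _) (trans (*-congˡ (⁻¹-inverseʳ q≉0)) (*-identityʳ _)))

    -- With y = (1 − w)⁻¹ = ∑ us we have 1 + w + … + w^(n−1) = y − wⁿ y. If no power of w lay in K, independence would
    -- put the n cosets of the wᵏ among the 2 |us| cosets of the summands on the right.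
    torsion-from-inverse : ∀ {w} → InU w → w ≉ 1# → Totals ((1# - w) ⁻¹) → ∃[ m ] (0 ℕ.< m × Image (w ^ m))
    torsion-from-inverse {w} w∈ w≉1 (totals us us∈ y≈) = by-contradiction em none⇒⊥
      where
      y = (1# - w) ⁻¹
      m = List.length us ℕ.+ List.length us
      n = suc m
      vs = us List.++ List.map (_* - (w ^ n)) us
      vs∈ : All InU vs
      vs∈ = All.++⁺ us∈ (All.map⁺ (All.map (λ v∈ → UG.*∈ v∈ (-‿InU (UG.^∈ n w∈))) us∈))
      length-vs : List.length vs ≡ m
      length-vs = ≡.trans (List.length-++ us) (≡.cong (List.length us ℕ.+_) (List.length-map (_* - (w ^ n)) us))
      1-w≉0 : 1# - w ≉ 0#
      1-w≉0 eq = w≉1 (sym (x-y≈0⇒x≈y eq))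
      total-vs : total vs ≈ sum (pow w n)
      total-vs = *-cancelˡ 1-w≉0 (begin
        (1# - w) * total vs  ≈⟨ *-congˡ (trans (total-++ us _) (+-cong (sym y≈) (trans (sym (total-*ʳ us _)) (*-congʳ (sym y≈))))) ⟩
        (1# - w) * (y + y * - (w ^ n))  ≈⟨ solve 3 (λ w y v → (:1 :- w) :* (y :+ y :* :- v) := (:1 :- w) :* y :* (:1 :- v)) refl w y (w ^ n) ⟩
        (1# - w) * y * (1# - w ^ n)  ≈⟨ trans (*-congʳ (⁻¹-inverseʳ 1-w≉0)) (*-identityˡ _) ⟩
        1# - w ^ n  ≈⟨ solve 1 (λ v → :1 :- v := :- (v :- :1)) refl (w ^ n) ⟩
        - (w ^ n - 1#)  ≈⟨ -‿cong (geometric w n) ⟨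
        - ((w - 1#) * sum (pow w n))  ≈⟨ solve 2 (λ w s → :- ((w :- :1) :* s) := (:1 :- w) :* s) refl w (sum (pow w n)) ⟩
        (1# - w) * sum (pow w n)  ∎)
      none⇒⊥ : ¬ ¬ (∃[ m ] (0 ℕ.< m × Image (w ^ m)))
      -- n = m + 1 exponents choose among m summands, so two exponents choose the same v, and v w⁻ⁱ
      -- and v w⁻ʲ both lie in K.
      none⇒⊥ none = collide (Fin.pigeonhole (ℕ.≤-reflexive (≡.cong suc length-vs)) (λ j → proj₁ (choose j)))
        where
        module _ (j : Fin n) where
          w^j⁻¹ = (w ^ toℕ j) ⁻¹
          w^j⁻¹∈ : InU w^j⁻¹
          w^j⁻¹∈ = UG.⁻¹∈ (UG.^∈ (toℕ j) w∈)
          others : Fin m → Carrier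
          others i = - pow w n (punchIn j i) * w^j⁻¹
          others-sum : sum others ≈ - (sum (λ i → pow w n (punchIn j i))) * w^j⁻¹
          others-sum = trans (sym (*-distribʳ-sum w^j⁻¹ (λ i → - pow w n (punchIn j i)))) (*-congʳ (sum-neg (λ i → pow w n (punchIn j i))))
          -- The relation ∑ wᵏ = ∑ vs, solved for wʲ and divided by it.
          one : total (List.map (_* w^j⁻¹) vs List.++ List.tabulate others) ≈ 1#
          one = begin
            total (List.map (_* w^j⁻¹) vs List.++ List.tabulate others)  ≈⟨ total-++ (List.map (_* w^j⁻¹) vs) (List.tabulate others) ⟩
            total (List.map (_* w^j⁻¹) vs) + total (List.tabulate others) ≈⟨ +-cong (trans (sym (total-*ʳ vs w^j⁻¹)) (*-congʳ total-vs)) (trans (total-tabulate others) others-sum) ⟩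
            sum (pow w n) * w^j⁻¹ + - s * w^j⁻¹  ≈⟨ +-congʳ (*-congʳ (sum-remove {i = j} (pow w n))) ⟩
            (pow w n j + s) * w^j⁻¹ + - s * w^j⁻¹  ≈⟨ solve 3 (λ p s v → (p :+ s) :* v :+ :- s :* v := p :* v) refl (pow w n j) s w^j⁻¹ ⟩
            pow w n j * w^j⁻¹  ≈⟨ ⁻¹-inverseʳ (^≉0 (toℕ j) (UG.≉0 w∈)) ⟩
            1#  ∎
            where
            s = sum (λ i → pow w n (punchIn j i))
          all∈ : All InU (List.map (_* w^j⁻¹) vs List.++ List.tabulate others)
          all∈ = All.++⁺ (All.map⁺ (All.map (λ v∈ → UG.*∈ v∈ w^j⁻¹∈) vs∈))
                         (All.tabulate⁺ (λ i → UG.*∈ (-‿InU (UG.^∈ (toℕ (punchIn j i)) w∈)) w^j⁻¹∈))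
          not-others : ∀ i → ¬ Image (others i)
          not-others i p = distinct (ℕ.<-cmp (toℕ (punchIn j i)) (toℕ j))
            where
            w^i = pow w n (punchIn j i)
            w^i≉0 = ^≉0 (toℕ (punchIn j i)) (UG.≉0 w∈)
            p′ : Image (w^i * w^j⁻¹)
            p′ = -‿Image (base.resp (sym (-‿distribˡ-* _ _)) p)
            one′ : Image (w^i * (w ^ toℕ (punchIn j i)) ⁻¹)
            one′ = base.resp (sym (⁻¹-inverseʳ w^i≉0)) base.1∈
            distinct : Tri (toℕ (punchIn j i) ℕ.< toℕ j) (toℕ (punchIn j i) ≡ toℕ j) (toℕ j ℕ.< toℕ (punchIn j i)) → ⊥
            distinct (tri< i<j _ _) = none (image-power-difference w∈ i<j w^i≉0 one′ p′)
            distinct (tri≈ _ i≡j _) = Fin.punchInᵢ≢i j i (Fin.toℕ-injective i≡j)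
            distinct (tri> _ _ j<i) = none (image-power-difference w∈ j<i w^i≉0 p′ one′)
          choose : Σ[ i ∈ Fin (List.length vs) ] Image (List.lookup vs i * w^j⁻¹)
          choose = case Any.++⁻ (List.map (_* w^j⁻¹) vs) (unitTotals _ all∈ one) of λ where
            (inj₁ p) → Any.index (Any.map⁻ p) , Any.lookup-index (Any.map⁻ p)
            (inj₂ p) → contradiction (proj₂ (Any.tabulate⁻ p)) (not-others (proj₁ (Any.tabulate⁻ p)))
        collide : ∃[ i ] ∃[ j ] (i Fin.< j × proj₁ (choose i) ≡ proj₁ (choose j)) → ⊥
        collide (i , j , i<j , eq) = none (image-power-difference w∈ i<j (UG.≉0 (All.lookup vs∈ (∈-lookup (proj₁ (choose j)))))
          (≡.subst (λ t → Image (List.lookup vs t * w^j⁻¹ i)) eq (proj₂ (choose i))) (proj₂ (choose j)))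

    -- The relation 1 + w + … + w^(n−1) = 0 contradicts independence.
    no-root-of-unity : ∀ {w n} → InU w → w ≉ 1# → w ^ n ≈ 1# → 0 ℕ.< n → ∃[ m ] (0 ℕ.< m × m ℕ.< n × Image (w ^ m))
    no-root-of-unity {w} {suc n} w∈ w≉1 w^n≈1 _ =
      let i , p = sum-units (λ i → - (w * pow w n i)) (λ i → -‿InU (UG.*∈ w∈ (UG.^∈ (toℕ i) w∈))) sum≈1
      in suc (toℕ i) , s≤s z≤n , s≤s (Fin.toℕ<n i) , -‿Image p
      where
      sum≈0 : sum (pow w (suc n)) ≈ 0#
      sum≈0 = *≈0 (w≉1 ∘ x-y≈0⇒x≈y) (trans (geometric w (suc n)) (trans (+-congʳ w^n≈1) (-‿inverseʳ 1#)))
      sum≈1 : sum (λ (i : Fin n) → - (w * pow w n i)) ≈ 1#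
      sum≈1 = trans (sum-neg (λ i → w * pow w n i)) (sym (+-inverseˡ-unique 1# (sum (λ (i : Fin n) → w * pow w n i)) sum≈0))

    -- Dividing v = 1 + ζ by v writes 1 as v⁻¹ + ζ v⁻¹. Independence puts one summand in K, hence
    -- both, and hence their quotient ζ.
    not-1+ζ : ∀ {ζ v} → InU ζ → InU v → ¬ Image ζ → v ≉ 1# + ζ
    not-1+ζ {ζ} {v} ζ∈ v∈ ζ∉K v≈ = case unitTotals (v ⁻¹ ∷ ζ * v ⁻¹ ∷ []) (UG.⁻¹∈ v∈ ∷ UG.*∈ ζ∈ (UG.⁻¹∈ v∈) ∷ []) one of λ where
        (here p)         → ζ∉K (base.resp (trans (+-congʳ v≈) (solve 1 (λ z → :1 :+ z :- :1 := z) refl ζ))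
                             (base.+∈ (base.cancel∈ (⁻¹≉0 v≉0) p (base.resp (sym (⁻¹-inverseˡ v≉0)) base.1∈)) (base.-∈ base.1∈)))
        (there (here p)) → ζ∉K (base.cancel∈ 1-p≉0 (base.+∈ base.1∈ (base.-∈ p)) (base.resp (sym (trans (*-congʳ 1-p≈) (*-comm _ _))) p))
      where
      v≉0 = UG.≉0 v∈
      p = ζ * v ⁻¹
      one : v ⁻¹ + (p + 0#) ≈ 1#
      one = trans (solve 2 (λ z w → w :+ (z :* w :+ :0) := (:1 :+ z) :* w) refl ζ (v ⁻¹)) (trans (*-congʳ (sym v≈)) (⁻¹-inverseʳ v≉0))
      1-p≈ : 1# - p ≈ v ⁻¹
      1-p≈ = trans (+-congʳ (sym one)) (solve 2 (λ w p → w :+ (p :+ :0) :- p := w) refl (v ⁻¹) p)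
      1-p≉0 : 1# - p ≉ 0#
      1-p≉0 eq = ⁻¹≉0 v≉0 (trans (sym 1-p≈) eq)

-- Condition 2 and its formulation by elements.

module Conditions (em : ∀ {a} → ExcludedMiddle a) {k kℓ l lℓ u : Level} (K : CommutativeRing k kℓ) (K-field : IsField K)
                  (L : CommutativeAlgebra K l lℓ) (L-field : IsField (CommutativeAlgebra.commutativeRing L))
                  (U : Subgroup (units (CommutativeAlgebra.commutativeRing L)) u)
                  (Kˣ⊆U : Subgroup.member (baseUnits L) ⊆ Subgroup.member U) where
  private
    module L = CommutativeAlgebra L
    module U = Subgroup U
    Lˣ = units L.commutativeRing
    Kˣ = baseUnits L
    module Lˣ = AbelianGroup Lˣ
    Uᵍ = subgroupGroup Lˣ U
    Kˣ≤U = restrict U Kˣ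
    module Uᵍ = AbelianGroup Uᵍ
    Lˣ/Kˣ = quotientGroup Lˣ Kˣ
  open Field em L.commutativeRing L-field
  open Subobjects (k ⊔ kℓ ⊔ u)
  open Kummer em L.commutativeRing L-field (k ⊔ kℓ ⊔ u)
  open Kneser em L.commutativeRing L-field (k ⊔ kℓ ⊔ u)
  open Independence em L.commutativeRing L-field (k ⊔ kℓ ⊔ u)
  open Extension em K K-field L L-field u
  open UnitSubgroup em K K-field L L-field U Kˣ⊆U
  private
    module base = Subfield base

  TorsionFree : Set (l ⊔ lℓ ⊔ k ⊔ kℓ)
  TorsionFree = ∀ q → 0 ℕ.< q → HasCharacteristic K q → IsTrivial Lˣ/Kˣ (Lˣ/Kˣ [ q ^∞])

  NoEighthRoot : Set (l ⊔ lℓ ⊔ k ⊔ kℓ ⊔ u)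
  NoEighthRoot = ∀ (ζ : Lˣ.Carrier) → ζ ∈ U.member → HasOrder Lˣ ζ 4 → ζ ∉ Subgroup.member Kˣ →
    ¬ (∃[ v ] (v ∈ U.member × proj₁ v ≈ 1# + proj₁ ζ))

  value : Uᵍ.Carrier → Carrier
  value z = proj₁ (proj₁ z)

  value∈ : ∀ z → InU (value z)
  value∈ (z , z∈) = member⇒InU z z∈

  toUᵍ : ∀ {x} → InU x → Uᵍ.Carrier
  toUᵍ x∈ = element x∈ , InU.member x∈

  module _ (torsion-free : TorsionFree) (essential : IsEssential Uᵍ Kˣ≤U) (no-eighth-root : NoEighthRoot) where

    -- Otherwise the group generated by w would meet Kˣ trivially. It is presented as the set of z with
    -- w^a = z w^b to avoid negative exponents.
    nontrivial-power∈K : ∀ {w} → InU w → w ≉ 1# → ∃[ n ] (Image (w ^ n) × w ^ n ≉ 1#)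
    nontrivial-power∈K {w} w∈ w≉1 = by-contradiction em λ none →
        w≉1 (essential cyclic (λ { {z} (z∈ , z∈K) → trivial none {z} z∈ z∈K })
               {toUᵍ w∈} (liftˡ (1 , 0 , solve 1 (λ w → w :* :1 := w :* :1) refl w)))
      where
      w^≉0 : ∀ n → w ^ n ≉ 0#
      w^≉0 n = ^≉0 n (UG.≉0 w∈)
      cyclic : Subgroup Uᵍ (l ⊔ lℓ ⊔ u)
      cyclic = record
        -- Lifted to the level of the subgroups over which `IsEssential` quantifies.
        { member    = λ z → Lift (l ⊔ lℓ ⊔ u) (∃[ a ] ∃[ b ] w ^ a ≈ value z * w ^ b)
        ; resp      = λ { z≈z′ (liftˡ (a , b , eq)) → liftˡ (a , b , trans eq (*-congʳ z≈z′)) }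
        ; ∙-closed  = λ { {z} {z′} (liftˡ (a , b , eq)) (liftˡ (a′ , b′ , eq′)) → liftˡ (a ℕ.+ a′ , b ℕ.+ b′ , (begin
            w ^ (a ℕ.+ a′)  ≈⟨ ^-homo-* w a a′ ⟩
            w ^ a * w ^ a′  ≈⟨ *-cong eq eq′ ⟩
            (value z * w ^ b) * (value z′ * w ^ b′)  ≈⟨ solve 4 (λ x y z t → (x :* y) :* (z :* t) := (x :* z) :* (y :* t)) refl (value z) (w ^ b) (value z′) (w ^ b′) ⟩
            value z * value z′ * (w ^ b * w ^ b′)  ≈⟨ *-congˡ (^-homo-* w b b′) ⟨
            value z * value z′ * w ^ (b ℕ.+ b′)  ∎)) }
        ; ε-closed  = liftˡ (0 , 0 , sym (*-identityˡ 1#))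
        ; ⁻¹-closed = λ { {((x , x′ , x′x≈1 , _) , _)} (liftˡ (a , b , eq)) → liftˡ (b , a , (begin
            w ^ b  ≈⟨ *-identityˡ _ ⟨
            1# * w ^ b  ≈⟨ *-congʳ x′x≈1 ⟨
            x′ * x * w ^ b  ≈⟨ *-assoc _ _ _ ⟩
            x′ * (x * w ^ b)  ≈⟨ *-congˡ eq ⟨
            x′ * w ^ a  ∎)) }
        }
      difference : ∀ {a b x} → b ℕ.< a → w ^ a ≈ x * w ^ b → w ^ (a ℕ.∸ b) ≈ x
      difference {a} {b} {x} b<a eq = *-cancelˡ (w^≉0 b) (begin
        w ^ b * w ^ (a ℕ.∸ b)  ≈⟨ ^-homo-* w b (a ℕ.∸ b) ⟨
        w ^ (b ℕ.+ (a ℕ.∸ b))  ≈⟨ ^-congʳ w (ℕ.m+[n∸m]≡n (ℕ.<⇒≤ b<a)) ⟩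
        w ^ a  ≈⟨ trans eq (*-comm _ _) ⟩
        w ^ b * x  ∎)
      trivial : ¬ (∃[ n ] (Image (w ^ n) × w ^ n ≉ 1#)) → ∀ {z} → z ∈ Subgroup.member cyclic → z ∈ Subgroup.member Kˣ≤U → value z ≈ 1#
      trivial none {z} (liftˡ (a , b , eq)) z∈K = by-contradiction em λ z≉1 → case ℕ.<-cmp a b of λ where
          (tri≈ _ a≡b _) → z≉1 (*-cancelˡ (w^≉0 b) (trans (*-comm _ _) (trans (sym eq) (trans (^-congʳ w a≡b) (sym (*-identityʳ _))))))
          (tri> _ _ b<a) → let w^≈ = difference b<a eq in none (a ℕ.∸ b , base.resp (sym w^≈) z∈K′ , z≉1 ∘ trans (sym w^≈))
          (tri< a<b _ _) → let w^≈ = difference {b} {a} {value z ⁻¹} a<b (flip-eq eq)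
                           in none (b ℕ.∸ a , base.resp (sym w^≈) (base.⁻¹∈ z∈K′) , λ w^≈1 → z≉1 (trans (sym (*-identityʳ _))
                                (trans (*-congˡ (sym (trans (sym w^≈) w^≈1))) (⁻¹-inverseʳ z≉0))))
        where
        z∈K′ : Image (value z)
        z∈K′ = member⇒image (proj₁ z) z∈K
        z≉0 : value z ≉ 0#
        z≉0 = unit≉0 (proj₁ z)
        flip-eq : w ^ a ≈ value z * w ^ b → w ^ b ≈ value z ⁻¹ * w ^ a
        flip-eq eq = sym (trans (*-congˡ eq) (trans (sym (*-assoc _ _ _)) (trans (*-congʳ (⁻¹-inverseˡ z≉0)) (*-identityˡ _))))

    private
      K-characteristic : ∀ {q} → Prime q → q ×ᴿ 1# ≈ 0# → ∀ {n} → n ×ᴿ 1# ≈ 0# → q ∣ n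
      K-characteristic {q} q-prime q≈0 {n} n≈0 = case prime⇒coprime⊎∣ q-prime n of λ where
          (inj₂ q∣n) → q∣n
          (inj₁ cop) → contradiction (one≈0 (Coprime.coprime-Bézout cop)) 1≉0
        where
        multiple : ∀ x {m} → m ×ᴿ 1# ≈ 0# → (x ℕ.* m) ×ᴿ 1# ≈ 0#
        multiple x {m} m≈0 = trans (×1-homo-* x m) (trans (*-congˡ m≈0) (zeroʳ _))
        one : ∀ x m y t → m ×ᴿ 1# ≈ 0# → t ×ᴿ 1# ≈ 0# → 1 ℕ.+ y ℕ.* t ≡ x ℕ.* m → 1# ≈ 0#
        one x m y t m≈0 t≈0 eq = trans (sym (trans (+-congˡ (multiple y t≈0)) (+-identityʳ 1#))) (trans (×-congˡ eq) (multiple x m≈0))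
        one≈0 : Bézout.Identity 1 n q → 1# ≈ 0#
        one≈0 (Bézout.+- x y eq) = one x n y q n≈0 q≈0 eq
        one≈0 (Bézout.-+ x y eq) = one y q x n q≈0 n≈0 eq

      hasCharacteristic : ∀ {q} → Prime q → q ×ᴿ 1# ≈ 0# → HasCharacteristic K q
      hasCharacteristic q-prime q≈0 n = mk⇔
        (λ n≈0 → K-characteristic q-prime q≈0 (trans (sym (⟦×1⟧ n)) (trans (⟦⟧-cong n≈0) 0#-homo)))
        (λ { (divides t ≡.refl) → ⟦⟧≈0 (trans (⟦×1⟧ n) (trans (×1-homo-* t _) (trans (*-congˡ q≈0) (zeroʳ _)))) })

      proj-quotient-power : ∀ n (z : Lˣ.Carrier) → proj₁ (power Lˣ/Kˣ n z) ≈ proj₁ z ^ n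
      proj-quotient-power zero    z = refl
      proj-quotient-power (suc n) z = *-congˡ (proj-quotient-power n z)

      -- Here the hypothesis on q-power torsion of Lˣ/Kˣ enters, with exponent q¹. The factors
      -- `Lˣ.ε Lˣ.⁻¹` come from the definition of equality of cosets.
      root∈K : ∀ {q w} → Prime q → q ×ᴿ 1# ≈ 0# → InU w → Image (w ^ q) → Image w
      root∈K {q} {w} q-prime q≈0 w∈ w^q∈ = base.resp (*-identityʳ _) (member⇒image (element w∈ Lˣ.∙ Lˣ.ε Lˣ.⁻¹) (torsion-free q (prime>0 q-prime) (hasCharacteristic q-prime q≈0)
        {element w∈} (1 , ℕ.≤-refl , image⇒member (power Lˣ/Kˣ (q ℕ.^ 1) (element w∈) Lˣ.∙ Lˣ.ε Lˣ.⁻¹)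
          (base.resp (sym (trans (*-identityʳ _) (trans (proj-quotient-power (q ℕ.^ 1) (element w∈)) (^-congʳ w (ℕ.*-identityʳ q))))) w^q∈))))

    conditions : KneserConditions base unitGroup
    conditions = record { torsion = torsion ; prime-roots = prime-roots ; fourth-root = fourth-root }
      where
      torsion : ∀ {w} → InU w → ∃[ n ] (n ×ᴿ 1# ≉ 0# × Image (w ^ n))
      torsion {w} w∈ = case em {P = w ≈ 1#} of λ where
          (yes w≈1) → 1 , 1≉0 ∘ trans (sym (+-identityʳ 1#)) , base.resp (sym (trans (*-identityʳ w) w≈1)) base.1∈
          (no  w≉1) → let n , w^n∈ , w^n≉1 = nontrivial-power∈K w∈ w≉1
                          d , _ , (0<d , w^d∈) , min = least em (λ n → 0 ℕ.< n × Image (w ^ n)) {n}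
                            (ℕ.n≢0⇒n>0 (λ n≡0 → w^n≉1 (^-congʳ w n≡0)) , w^n∈)
                      in d , exponent≉0 d 0<d w^d∈ min , w^d∈
        where
        -- d is the least positive exponent bringing w into K. If d = t q with q the characteristic,
        -- the q-th power of wᵗ is in K, hence so is wᵗ, although t < d.
        exponent≉0 : ∀ d → 0 ℕ.< d → Image (w ^ d) → (∀ {m} → m ℕ.< d → ¬ (0 ℕ.< m × Image (w ^ m))) → d ×ᴿ 1# ≉ 0#
        exponent≉0 d 0<d w^d∈ min d≈0 = case first-zero (d , 0<d , d≈0) of λ where
          (q , q-prime , q≈0) → case K-characteristic q-prime q≈0 d≈0 of λ where
            (divides t eq) →
              let t>0 : 0 ℕ.< t
                  t>0 = ℕ.n≢0⇒n>0 (λ t≡0 → ℕ.<⇒≢ 0<d (≡.sym (≡.trans eq (≡.cong (ℕ._* q) t≡0))))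
                  t<d : t ℕ.< d
                  t<d = ≡.subst (t ℕ.<_) (≡.sym eq) (ℕ.m<m*n t q {{ℕ.>-nonZero t>0}} (ℕ.nonTrivial⇒n>1 q {{ℕ.prime⇒nonTrivial q-prime}}))
              in min t<d (t>0 , root∈K q-prime q≈0 (UG.^∈ t w∈) (base.resp (trans (^-congʳ w eq) (sym (^-assocʳ w t q))) w^d∈))

      -- Some ζⁿ ≠ 1 lies in K; then p does not divide n, so ζ is a power of ζⁿ up to sign of the
      -- exponent.
      prime-roots : ∀ {p ζ} → Prime p → InU ζ → ζ ^ p ≈ 1# → Image ζ
      prime-roots {p} {ζ} p-prime ζ∈ ζ^p≈1 = case em {P = ζ ≈ 1#} of λ where
          (yes ζ≈1) → base.resp (sym ζ≈1) base.1∈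
          (no  ζ≉1) → let n , ζ^n∈ , ζ^n≉1 = nontrivial-power∈K ζ∈ ζ≉1
                      in case prime⇒coprime⊎∣ p-prime n of λ where
                        (inj₂ (divides t n≡)) → contradiction (trans (^-congʳ ζ n≡) (ζ^*p t)) ζ^n≉1
                        (inj₁ cop) → from-Bézout n ζ^n∈ (Coprime.coprime-Bézout cop)
        where
        ζ^*p : ∀ t → ζ ^ (t ℕ.* p) ≈ 1#
        ζ^*p t = trans (^-congʳ ζ (ℕ.*-comm t p)) (trans (sym (^-assocʳ ζ p t)) (trans (^-congˡ t ζ^p≈1) (1^ t)))
        from-Bézout : ∀ n → Image (ζ ^ n) → Bézout.Identity 1 n p → Image ζ
        from-Bézout n ζ^n∈ (Bézout.+- x y eq) = base.resp (begin
          (ζ ^ n) ^ x  ≈⟨ trans (^-assocʳ ζ n x) (^-congʳ ζ (≡.trans (ℕ.*-comm n x) (≡.sym eq))) ⟩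
          ζ * ζ ^ (y ℕ.* p)  ≈⟨ trans (*-congˡ (ζ^*p y)) (*-identityʳ ζ) ⟩
          ζ  ∎) (base.^∈ x ζ^n∈)
        from-Bézout n ζ^n∈ (Bézout.-+ x y eq) = base.cancel∈ (^≉0 x (^≉0 n (UG.≉0 ζ∈))) (base.^∈ x ζ^n∈) (base.resp (sym (begin
          (ζ ^ n) ^ x * ζ  ≈⟨ *-comm _ _ ⟩
          ζ * (ζ ^ n) ^ x  ≈⟨ *-congˡ (trans (^-assocʳ ζ n x) (^-congʳ ζ (ℕ.*-comm n x))) ⟩
          ζ ^ (1 ℕ.+ x ℕ.* n)  ≈⟨ trans (^-congʳ ζ eq) (ζ^*p y) ⟩
          1#  ∎)) base.1∈)

      fourth-root : ∀ {ζ} → InU ζ → ζ * ζ ≈ - 1# → InU (1# + ζ) → Image ζ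
      fourth-root {ζ} ζ∈ ζ² 1+ζ∈ = by-contradiction em λ ζ∉K →
          no-eighth-root Z (InU.member ζ∈) (fourth-power , λ m 0<m m<4 eq → lower ζ∉K m 0<m m<4 (trans (sym (proj-power m Z)) eq))
            (ζ∉K ∘ member⇒image Z) (element 1+ζ∈ , InU.member 1+ζ∈ , refl)
        where
        Z = element ζ∈
        ζ²≈ : ζ ^ 2 ≈ - 1#
        ζ²≈ = trans (*-congˡ (*-identityʳ ζ)) ζ²
        ζ⁴≈1 : ζ ^ 4 ≈ 1#
        ζ⁴≈1 = trans (sym (^-assocʳ ζ 2 2)) (trans (^-congˡ 2 ζ²≈) (trans (*-congˡ (*-identityʳ _)) (trans (-1*x≈-x _) (-‿involutive 1#))))
        fourth-power : proj₁ (power Lˣ 4 Z) ≈ 1#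
        fourth-power = trans (proj-power 4 Z) ζ⁴≈1
        -- The order must be exactly 4: ζ² = 1 gives ζ = ±1, and ζ³ = 1 together with ζ⁴ = 1 gives ζ
        -- = 1.
        lower : ¬ Image ζ → ∀ m → 0 ℕ.< m → m ℕ.< 4 → ζ ^ m ≉ 1#
        lower ζ∉K 1 _ _ eq = ζ∉K (base.resp (trans (sym eq) (*-identityʳ ζ)) base.1∈)
        lower ζ∉K 2 _ _ eq = ζ∉K ([ (λ e → base.resp (sym e) base.1∈) , (λ e → base.resp (sym e) (base.-∈ base.1∈)) ]′
          (square-roots {ζ} {1#} (trans (sym (*-congˡ (*-identityʳ ζ))) (trans eq (sym (*-identityˡ 1#))))))
        lower ζ∉K 3 _ _ eq = ζ∉K (base.resp (trans (sym ζ⁴≈1) (trans (*-congˡ eq) (*-identityʳ ζ))) base.1∈)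
        lower ζ∉K (suc (suc (suc (suc m)))) _ (s≤s (s≤s (s≤s (s≤s ()))))

  module _ (unitTotals : UnitTotals base unitGroup) (Totals-⁻¹ : ∀ {y} → y ≉ 0# → Totals y → Totals (y ⁻¹)) where
    open FromIndependence unitTotals

    -- Let d be the least positive exponent with w^d ∈ K. As w^d also lies in F, it is 1, and the
    -- vanishing sum of the powers of w produces a smaller such exponent.
    essential : IsEssential Uᵍ Kˣ≤U
    essential F trivial {z} z∈F = by-contradiction em λ w≉1 →
        let n , 0<n , w^n∈ = torsion-from-inverse w∈ w≉1 (Totals-⁻¹ (λ eq → w≉1 (sym (x-y≈0⇒x≈y eq))) (TR.+∈ TR.1∈ (TR.-∈ (Totals-unit w∈))))
            d , _ , (0<d , w^d∈) , min = least em (λ n → 0 ℕ.< n × Image (w ^ n)) {n} (0<n , w^n∈)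
            m , 0<m , m<d , w^m∈ = no-root-of-unity w∈ w≉1 (power-trivial d w^d∈) 0<d
        in min m<d (0<m , w^m∈)
      where
      w = value z
      w∈ = value∈ z
      power∈F : ∀ n → power Uᵍ n z ∈ Subgroup.member F
      power∈F zero    = Subgroup.ε-closed F
      power∈F (suc n) = Subgroup.∙-closed F z∈F (power∈F n)
      value-power : ∀ n → value (power Uᵍ n z) ≈ w ^ n
      value-power zero    = refl
      value-power (suc n) = *-congˡ (value-power n)
      power-trivial : ∀ n → Image (w ^ n) → w ^ n ≈ 1#
      power-trivial n w^n∈ = trans (sym (value-power n))
        (trivial {power Uᵍ n z} (power∈F n , image⇒member (proj₁ (power Uᵍ n z)) (base.resp (sym (value-power n)) w^n∈)))

    no-eighth-root : NoEighthRoot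
    no-eighth-root ζ ζ∈ _ ζ∉K (v , v∈ , v≈) = not-1+ζ (member⇒InU ζ ζ∈) (member⇒InU v v∈) (ζ∉K ∘ image⇒member ζ) v≈

-- Representatives: the algebra E, independence and degree.

module Representatives (em : ∀ {a} → ExcludedMiddle a) {k kℓ l lℓ u i iℓ : Level} (K : CommutativeRing k kℓ) (K-field : IsField K)
                       (L : CommutativeAlgebra K l lℓ) (L-field : IsField (CommutativeAlgebra.commutativeRing L))
                       (U : Subgroup (units (CommutativeAlgebra.commutativeRing L)) u)
                       (Kˣ⊆U : Subgroup.member (baseUnits L) ⊆ Subgroup.member U)
                       (I : Setoid i iℓ) (x : Func I (AbelianGroup.setoid (subgroupGroup (units (CommutativeAlgebra.commutativeRing L)) U)))
                       (x-representatives : IsRepresentativeSystem (restrict U (baseUnits L)) I x) where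
  private
    module K = CommutativeRing K
    module L = CommutativeAlgebra L
    module I = Setoid I
    Lˣ = units L.commutativeRing
    Kˣ = baseUnits L
    module Lˣ = AbelianGroup Lˣ
    Uᵍ = subgroupGroup Lˣ U
    Kˣ≤U = restrict U Kˣ
    U/Kˣ = quotientGroup Uᵍ Kˣ≤U
    module Uᵍ = AbelianGroup Uᵍ
    module U/Kˣ = AbelianGroup U/Kˣ
  open Field em L.commutativeRing L-field
  open Subobjects (k ⊔ kℓ ⊔ u)
  open Independence em L.commutativeRing L-field (k ⊔ kℓ ⊔ u)
  open Extension em K K-field L L-field u
  open UnitSubgroup em K K-field L L-field U Kˣ⊆U
  open Conditions em K K-field L L-field U Kˣ⊆U using (value; value∈; toUᵍ)
  private
    module base = Subfield base
    P = base.subring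

  xᴸ : I.Carrier → Carrier
  xᴸ j = value (Func.to x j)

  xᴸ∈ : ∀ j → InU (xᴸ j)
  xᴸ∈ j = value∈ (Func.to x j)

  x-injective : ∀ {i j} → Func.to x i U/Kˣ.≈ Func.to x j → i I.≈ j
  x-injective = proj₁ x-representatives

  representative : Uᵍ.Carrier → I.Carrier
  representative z = proj₁ (proj₂ x-representatives z)

  representative≈ : ∀ z → Func.to x (representative z) U/Kˣ.≈ z
  representative≈ z = proj₂ (proj₂ x-representatives z) I.refl

  same-coset : ∀ {z z′ : Uᵍ.Carrier} → Image (value z * value z′ ⁻¹) → z U/Kˣ.≈ z′
  same-coset {z} {z′@((_ , y , _ , r) , _)} p = image⇒member (proj₁ z Lˣ.∙ proj₁ z′ Lˣ.⁻¹) (base.resp (*-congˡ (sym (⁻¹-unique r))) p)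

  coset-ratio : ∀ {z z′ : Uᵍ.Carrier} → z U/Kˣ.≈ z′ → Image (value z * value z′ ⁻¹)
  coset-ratio {z} {z′@((_ , y , _ , r) , _)} p = base.resp (*-congˡ (⁻¹-unique r)) (member⇒image (proj₁ z Lˣ.∙ proj₁ z′ Lˣ.⁻¹) p)

  scaled-representative : ∀ {y} → InU y → ∃[ j ] ∃[ c ] ⟦ c ⟧ * xᴸ j ≈ y
  scaled-representative {y} y∈ =
    let z = toUᵍ y∈
        j = representative z
        image c eq = base.⁻¹∈ (coset-ratio {Func.to x j} {z} (representative≈ z))
        y≉0 = UG.≉0 y∈
        q≉0 = *≉0 (UG.≉0 (xᴸ∈ j)) (⁻¹≉0 y≉0)
    in j , c , *-cancelˡ (⁻¹≉0 y≉0) (begin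
      y ⁻¹ * (⟦ c ⟧ * xᴸ j)  ≈⟨ *-congˡ (*-congʳ eq) ⟩
      y ⁻¹ * ((xᴸ j * y ⁻¹) ⁻¹ * xᴸ j)  ≈⟨ solve 3 (λ a b x → a :* (b :* x) := b :* (x :* a)) refl (y ⁻¹) ((xᴸ j * y ⁻¹) ⁻¹) (xᴸ j) ⟩
      (xᴸ j * y ⁻¹) ⁻¹ * (xᴸ j * y ⁻¹)  ≈⟨ ⁻¹-inverseˡ q≉0 ⟩
      1#  ≈⟨ ⁻¹-inverseˡ y≉0 ⟨
      y ⁻¹ * y  ∎)

  scalar≉0 : ∀ {y c j} → InU y → ⟦ c ⟧ * xᴸ j ≈ y → ⟦ c ⟧ ≉ 0#
  scalar≉0 y∈ eq = *≉0⇒ˡ (UG.≉0 y∈ ∘ trans (sym eq))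

  xᴸ-cong : ∀ {i j} → i I.≈ j → xᴸ i ≈ xᴸ j
  xᴸ-cong = Func.cong x

  -- The span of the representatives

  term-Totals : ∀ c j → Totals (⟦ c ⟧ * xᴸ j)
  term-Totals c j = TR.*∈ (image⇒Totals (image c refl)) (Totals-unit (xᴸ∈ j))

  lincomb-Totals : ∀ n (c : Vector K.Carrier n) (σ : Vector I.Carrier n) → Totals (lincomb L c (xᴸ ∘ σ))
  lincomb-Totals n c σ = TR.sum∈ (λ t → term-Totals (c t) (σ t))

  span⇒Totals : ∀ {y} → y ∈ Span L I xᴸ → Totals y
  span⇒Totals (n , c , σ , eq) = TR.resp (sym eq) (lincomb-Totals n c σ)

  total⇒span : ∀ {us} → All InU us → total us ∈ Span L I xᴸ
  total⇒span []         = 0 , (λ ()) , (λ ()) , refl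
  total⇒span (u∈ ∷ us∈) =
    let j , c , eq = scaled-representative u∈
        n , d , σ , eq′ = total⇒span us∈
    in suc n , c Vector.∷ d , j Vector.∷ σ , +-cong (sym eq) eq′

  Totals⇒span : ∀ {y} → Totals y → y ∈ Span L I xᴸ
  Totals⇒span (totals us us∈ eq) = let n , c , σ , eq′ = total⇒span us∈ in n , c , σ , trans eq eq′

  E-isSubalgebra : IsSubalgebra L (Span L I xᴸ)
  E-isSubalgebra = record
    { resp      = λ { x≈y (n , c , σ , eq) → n , c , σ , trans (sym x≈y) eq }
    ; +-closed  = λ p q → Totals⇒span (TR.+∈ (span⇒Totals p) (span⇒Totals q))
    ; *-closed  = λ p q → Totals⇒span (TR.*∈ (span⇒Totals p) (span⇒Totals q))
    ; -‿closed  = λ p → Totals⇒span (TR.-∈ (span⇒Totals p))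
    ; 0-closed  = Totals⇒span TR.0∈
    ; 1-closed  = Totals⇒span TR.1∈
    ; ⟦⟧-closed = λ c → Totals⇒span (image⇒Totals (image c refl))
    }

  E : CommutativeAlgebra K _ _
  E = subalgebra L E-isSubalgebra

  private
    module E = CommutativeAlgebra E

  -- Linear independence of the representatives

  -- If no term lay in K, collecting the terms by cosets would write 1 as a combination of
  -- representatives other than that of the coset Kˣ, whereas 1 is also a multiple of the latter.
  independent⇒unitTotals : IsLinearlyIndependent L I xᴸ → UnitTotals base unitGroup
  independent⇒unitTotals independent-x us us∈ total≈1 = by-contradiction em λ ¬any →
      let collected σ σ-injective σ-avoids p = collect us∈ (All.¬Any⇒All¬ us ¬any)
          e = xᴸ ∘ (j₀ Vector.∷ σ)
          ind = independent-family (j₀ Vector.∷ σ) (extend σ-injective σ-avoids)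
          c₀x₀ : InSpan P e 1#
          c₀x₀ = span-resp c₀x₀≈1 (span-* (image c₀ refl) (span-gen zero))
          rest : InSpan P e 1#
          rest = span-resp total≈1 (span-trans (λ t → span-gen (suc t)) p)
          vanishing = independent-unique ind {λ t → ⟦ c₀ ⟧ * δ zero t} {0# Vector.∷ coefficient p} (λ t → base.*∈ (image c₀ refl) (base.δ∈ zero t)) (λ { zero → base.0∈ ; (suc t) → coefficient∈ p t })
            (trans (trans (sym (sum-scale ⟦ c₀ ⟧ (δ zero) e)) (trans (*-congˡ (sum-δ zero e)) c₀x₀≈1))
                   (trans (sym total≈1) (trans (expansion p) (sym (trans (+-congʳ (zeroˡ _)) (+-identityˡ _))))))
            zero
      in scalar≉0 (UG.base∈ base.1∈ 1≉0) c₀x₀≈1 (trans (sym (*-identityʳ _)) vanishing)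
    where
    unit-1 = scaled-representative (UG.base∈ base.1∈ 1≉0)
    j₀ = proj₁ unit-1
    c₀ = proj₁ (proj₂ unit-1)
    c₀x₀≈1 : ⟦ c₀ ⟧ * xᴸ j₀ ≈ 1#
    c₀x₀≈1 = proj₂ (proj₂ unit-1)

    independent-family : ∀ {n} (σ : Vector I.Carrier n) → Injective _≡_ I._≈_ σ → Independent P (xᴸ ∘ σ)
    independent-family σ σ-injective = independent λ a a∈ eq t →
      trans (sym (image≈ (a∈ t))) (trans (⟦⟧-cong (independent-x σ σ-injective (preimage ∘ a∈)
        (trans (sum-cong (λ s → *-congʳ (image≈ (a∈ s)))) eq) t)) 0#-homo)

    extend : ∀ {n j} {σ : Vector I.Carrier n} → Injective _≡_ I._≈_ σ → (∀ t → ¬ (σ t I.≈ j)) → Injective _≡_ I._≈_ (j Vector.∷ σ)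
    extend inj avoid {zero}  {zero}  _  = ≡.refl
    extend inj avoid {zero}  {suc t} eq = contradiction (I.sym eq) (avoid t)
    extend inj avoid {suc s} {zero}  eq = contradiction eq (avoid s)
    extend inj avoid {suc s} {suc t} eq = ≡.cong suc (inj eq)

    -- Linear independence concerns pairwise distinct indices, so terms in the same coset have to be
    -- merged; `j₀` is the index of the coset of 1.
    record Collected (y : Carrier) : Set (l ⊔ lℓ ⊔ k ⊔ kℓ ⊔ u ⊔ i ⊔ iℓ) where
      constructor collected
      eta-equality
      field
        {size}    : ℕ
        indices   : Vector I.Carrier size
        injective : Injective _≡_ I._≈_ indices
        avoids    : ∀ t → ¬ (indices t I.≈ j₀)
        in-span   : InSpan P (xᴸ ∘ indices) y

    add : ∀ {y v} → InU v → ¬ Image v → Collected y → Collected (v + y)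
    add {y} {v} v∈ v∉K (collected σ σ-injective σ-avoids p) = case em {P = ∃[ t ] (σ t I.≈ j)} of λ where
        (yes (t , σt≈j)) → collected σ σ-injective σ-avoids
          (span-+ (span-resp (trans (*-congˡ (xᴸ-cong σt≈j)) eq) (span-* (image c refl) (span-gen t))) p)
        (no  none)       → collected (j Vector.∷ σ) (extend σ-injective (λ t σt≈j → none (t , σt≈j)))
          (λ { zero → j≉j₀ ; (suc t) → σ-avoids t })
          (span-+ (span-resp eq (span-* (image c refl) (span-gen zero))) (span-trans (λ t → span-gen (suc t)) p))
      where
      j = proj₁ (scaled-representative v∈)
      c = proj₁ (proj₂ (scaled-representative v∈))
      eq : ⟦ c ⟧ * xᴸ j ≈ v
      eq = proj₂ (proj₂ (scaled-representative v∈))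
      j≉j₀ : ¬ (j I.≈ j₀)
      j≉j₀ j≈j₀ = v∉K (base.resp (trans (*-congˡ (sym (xᴸ-cong j≈j₀))) eq) (base.*∈ (image c refl)
        (base.cancel∈ (scalar≉0 (UG.base∈ base.1∈ 1≉0) c₀x₀≈1) (image c₀ refl) (base.resp (sym c₀x₀≈1) base.1∈))))

    collect : ∀ {vs} → All InU vs → All (λ v → ¬ Image v) vs → Collected (total vs)
    collect []         []         = collected {size = 0} (λ ()) (λ { {()} }) (λ ()) span-0
    collect (v∈ ∷ vs∈) (v∉ ∷ vs∉) = add v∈ v∉ (collect vs∈ vs∉)

  -- Dividing a relation by the negative of a nonzero term writes 1 as the sum of the other terms.
  -- One of these lies in K, so two distinct representatives share a coset. Zero terms are not in U
  -- and are dropped first.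
  unitTotals⇒independent : UnitTotals base unitGroup → IsLinearlyIndependent L I xᴸ
  unitTotals⇒independent unitTotals {suc n} σ σ-injective c eq j = by-contradiction em λ cj≉0 →
      let t≉0 = *≉0 (⟦⟧≉0 cj≉0) (UG.≉0 (xᴸ∈ (σ j)))
          us , us≈ , source = nonzero-terms n (others t≉0) (others-units t≉0)
      in impossible t≉0 source (unitTotals us (All.map proj₁ source) (trans us≈ (others-sum t≉0)))
    where
    term : Fin (suc n) → Carrier
    term t = ⟦ c t ⟧ * xᴸ (σ t)
    module _ (t≉0 : term j ≉ 0#) where
      others : Fin n → Carrier
      others t = term (punchIn j t) * - (term j ⁻¹)
      others-units : ∀ t → others t ≈ 0# ⊎ InU (others t)
      others-units t = case em {P = c (punchIn j t) K.≈ K.0#} of λ where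
        (yes c≈0) → inj₁ (trans (*-congʳ (trans (*-congʳ (trans (⟦⟧-cong c≈0) 0#-homo)) (zeroˡ _))) (zeroˡ _))
        (no  c≉0) → inj₂ (UG.*∈ (UG.*∈ (UG.base∈ (image _ refl) (⟦⟧≉0 c≉0)) (xᴸ∈ _))
                           (-‿InU (UG.⁻¹∈ (UG.*∈ (UG.base∈ (image _ refl) (*≉0⇒ˡ t≉0)) (xᴸ∈ _)))))
      others-sum : sum others ≈ 1#
      others-sum = begin
        sum others  ≈⟨ *-distribʳ-sum (- (term j ⁻¹)) (λ t → term (punchIn j t)) ⟨
        s * - (term j ⁻¹)  ≈⟨ solve 3 (λ t v s → s :* :- v := v :* t :- v :* (t :+ s)) refl (term j) (term j ⁻¹) s ⟩
        term j ⁻¹ * term j - term j ⁻¹ * (term j + s) ≈⟨ +-cong (⁻¹-inverseˡ t≉0) (-‿cong (trans (*-congˡ (trans (sym (sum-remove {i = j} term)) eq)) (zeroʳ _))) ⟩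
        1# - 0#  ≈⟨ trans (+-congˡ -0#≈0#) (+-identityʳ 1#) ⟩
        1#  ∎
        where s = sum (λ t → term (punchIn j t))

    nonzero-terms : ∀ n (f : Fin n → Carrier) → (∀ t → f t ≈ 0# ⊎ InU (f t)) →
                    Σ[ us ∈ List Carrier ] (total us ≈ sum f × All (λ v → InU v × ∃[ t ] v ≈ f t) us)
    nonzero-terms zero    f f∈ = [] , refl , []
    nonzero-terms (suc n) f f∈ with nonzero-terms n (f ∘ suc) (f∈ ∘ suc) | f∈ zero
    ... | us , us≈ , source | inj₁ f0≈0 =
      us , trans us≈ (sym (trans (+-congʳ f0≈0) (+-identityˡ _))) , All.map (λ { (v∈ , t , eq) → v∈ , suc t , eq }) source
    ... | us , us≈ , source | inj₂ f0∈ =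
      f zero ∷ us , +-congˡ us≈ , (f0∈ , zero , refl) ∷ All.map (λ { (v∈ , t , eq) → v∈ , suc t , eq }) source

    impossible : ∀ (t≉0 : term j ≉ 0#) {us} → All (λ v → InU v × ∃[ t ] v ≈ others t≉0 t) us → Any Image us → ⊥
    impossible t≉0 (_ ∷ source) (there any) = impossible t≉0 source any
    impossible t≉0 ((v∈ , t , eq) ∷ _) (here p) = Fin.punchInᵢ≢i j t (σ-injective (x-injective (same-coset {Func.to x s} {Func.to x (σ j)} ratio)))
      where
      s = σ (punchIn j t)
      b = ⟦ c (punchIn j t) ⟧
      d = ⟦ c j ⟧
      v≈ : _ ≈ - (b * (xᴸ s * (d * xᴸ (σ j)) ⁻¹))
      v≈ = trans eq (solve 3 (λ b x v → b :* x :* :- v := :- (b :* (x :* v))) refl b (xᴸ s) ((d * xᴸ (σ j)) ⁻¹))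
      b≉0 : b ≉ 0#
      b≉0 b≈0 = UG.≉0 v∈ (trans v≈ (trans (-‿cong (trans (*-congʳ b≈0) (zeroˡ _))) -0#≈0#))
      inverse : (d * xᴸ (σ j)) ⁻¹ * d ≈ xᴸ (σ j) ⁻¹
      inverse = ⁻¹-unique (trans (solve 3 (λ x v d → x :* (v :* d) := v :* (d :* x)) refl (xᴸ (σ j)) ((d * xᴸ (σ j)) ⁻¹) d) (⁻¹-inverseˡ t≉0))
      ratio : Image (xᴸ s * xᴸ (σ j) ⁻¹)
      ratio = base.resp (trans (*-assoc _ _ _) (*-congˡ inverse))
        (base.*∈ (base.cancel∈ b≉0 (image _ refl) (-‿Image (base.resp v≈ p))) (image _ refl))

  -- The field E

  eval-E : ∀ f (y : E.Carrier) → proj₁ (eval E f y) ≈ eval L f (proj₁ y)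
  eval-E []      y = refl
  eval-E (c ∷ f) y = +-congˡ (*-congˡ (eval-E f y))

  separable-E : ∀ y → IsSeparableElement L (proj₁ y) → IsSeparableElement E y
  separable-E y (n , v , (root , min) , sep) =
    n , v , (trans (eval-E (monic v) y) root , λ w m<n root′ → min w m<n (trans (sym (eval-E (monic w) y)) root′)) , sep
    where open Polynomial K using (monic)

  algebraic-E : ∀ y → IsSeparableElement E y → IsAlgebraicElement E y
  algebraic-E y (n , v , (root , _) , _) = monic v , (λ eq → proj₁ K-field (K.trans (K.sym (eq n)) (leading v))) , root
    where
    open Polynomial K using (monic; coeff)
    leading : ∀ {n} (v : Vec K.Carrier n) → coeff (monic v) n K.≈ K.1#
    leading Vec.[]      = K.refl
    leading (c Vec.∷ v) = leading v

  lincomb-E : ∀ {n} (c : Vector K.Carrier n) (f : Vector E.Carrier n) → proj₁ (lincomb E c f) ≈ lincomb L c (proj₁ ∘ f)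
  lincomb-E {zero}  c f = refl
  lincomb-E {suc n} c f = +-congˡ (lincomb-E (c ∘ suc) (f ∘ suc))

  -- Each coset is sent to its chosen representative; that the cosets themselves index the basis is
  -- what makes the degree [U : Kˣ].
  degree-E : IsLinearlyIndependent L I xᴸ → HasDegree E (AbelianGroup.setoid U/Kˣ)
  degree-E independent-x = basis , linearly-independent , spanning
    where
    j : Uᵍ.Carrier → I.Carrier
    j = representative
    b : Uᵍ.Carrier → E.Carrier
    b z = xᴸ (j z) , Totals⇒span (Totals-unit (xᴸ∈ (j z)))
    j-cong : ∀ {z z′} → z U/Kˣ.≈ z′ → j z I.≈ j z′
    j-cong {z} {z′} eq = x-injective (U/Kˣ.trans {Func.to x (j z)} {z} {Func.to x (j z′)} (representative≈ z)
      (U/Kˣ.trans {z} {z′} {Func.to x (j z′)} eq (U/Kˣ.sym {Func.to x (j z′)} {z′} (representative≈ z′))))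
    x-coset : ∀ {i j} → i I.≈ j → Func.to x i U/Kˣ.≈ Func.to x j
    x-coset {i} {j} i≈j = same-coset {Func.to x i} {Func.to x j}
      (base.resp (sym (trans (*-congʳ (xᴸ-cong i≈j)) (⁻¹-inverseʳ (UG.≉0 (xᴸ∈ j))))) base.1∈)
    j-injective : ∀ {z z′} → j z I.≈ j z′ → z U/Kˣ.≈ z′
    j-injective {z} {z′} eq = U/Kˣ.trans {z} {Func.to x (j z)} {z′} (U/Kˣ.sym {Func.to x (j z)} {z} (representative≈ z))
      (U/Kˣ.trans {Func.to x (j z)} {Func.to x (j z′)} {z′} (x-coset eq) (representative≈ z′))
    basis : Func (AbelianGroup.setoid U/Kˣ) E.setoid
    basis = record { to = b ; cong = λ {z} {z′} eq → xᴸ-cong (j-cong {z} {z′} eq) }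
    linearly-independent : IsLinearlyIndependent E (AbelianGroup.setoid U/Kˣ) b
    linearly-independent σ σ-injective c eq = independent-x (j ∘ σ) (λ e → σ-injective (j-injective e)) c
      (trans (sym (lincomb-E c (b ∘ σ))) eq)
    spanning : ∀ y → y ∈ Span E (AbelianGroup.setoid U/Kˣ) b
    spanning (y , n , c , σ , eq) = n , c , Func.to x ∘ σ , trans eq (trans
      (sum-cong (λ t → *-congˡ {⟦ c t ⟧} (sym (xᴸ-cong (x-injective (representative≈ (Func.to x (σ t))))))))
      (sym (lincomb-E c (b ∘ Func.to x ∘ σ))))

  E-field : (∀ {y} → y ≉ 0# → Totals y → Totals (y ⁻¹)) → IsField E.commutativeRing
  E-field inverse = proj₁ L-field , λ { (y , y∈) y≉0 →
    (y ⁻¹ , Totals⇒span (inverse y≉0 (span⇒Totals y∈))) , ⁻¹-inverseˡ y≉0 , ⁻¹-inverseʳ y≉0 }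

  E-inverse : IsField E.commutativeRing → ∀ {y} → y ≉ 0# → Totals y → Totals (y ⁻¹)
  E-inverse (_ , inverse) {y} y≉0 y∈ with inverse (y , Totals⇒span y∈) y≉0
  ... | (z , z∈) , _ , yz≈1 = TR.resp (⁻¹-unique yz≈1) (span⇒Totals z∈)

theorem3p1 :
  (∀ {a} → ExcludedMiddle a) →
  ∀ {k kℓ l lℓ u i iℓ}
  (K : CommutativeRing k kℓ) → IsField K →
  (L : CommutativeAlgebra K l lℓ) → IsField (CommutativeAlgebra.commutativeRing L) →
  let module L = CommutativeAlgebra L
      Lˣ = units L.commutativeRing
      Kˣ = baseUnits L
  in
  (∀ (ℓ : ℕ) → 0 < ℓ → HasCharacteristic K ℓ →
    let Lˣ/Kˣ = quotientGroup Lˣ Kˣ in IsTrivial Lˣ/Kˣ (Lˣ/Kˣ [ ℓ ^∞])) →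
  (U : Subgroup Lˣ u) → Subgroup.member Kˣ ⊆ Subgroup.member U →
  let Uᵍ = subgroupGroup Lˣ U
      Kˣ≤U = restrict U Kˣ
      U/Kˣ = quotientGroup Uᵍ Kˣ≤U
  in
  (I : Setoid i iℓ) (x : Func I (AbelianGroup.setoid Uᵍ)) →
  IsRepresentativeSystem Kˣ≤U I x →
  let xᴸ = λ (j : Setoid.Carrier I) → proj₁ (proj₁ (Func.to x j)) in
  Σ (IsSubalgebra L (Span L I xᴸ)) λ E-isSubalgebra →
  let E = subalgebra L E-isSubalgebra
      Condition₁ =
        IsField (CommutativeAlgebra.commutativeRing E) × IsLinearlyIndependent L I xᴸ
      Condition₂ =
        IsEssential Uᵍ Kˣ≤U ×
        (∀ (ζ : AbelianGroup.Carrier Lˣ) → ζ ∈ Subgroup.member U →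
          HasOrder Lˣ ζ 4 → ζ ∉ Subgroup.member Kˣ →
          ¬ (∃[ v ] (v ∈ Subgroup.member U × proj₁ v L.≈ L.1# L.+ proj₁ ζ)))
  in
  (Condition₁ ⇔ Condition₂) ×
  (Condition₁ →
    IsField (CommutativeAlgebra.commutativeRing E) × IsAlgebraic E × IsSeparable E ×
    HasDegree E (AbelianGroup.setoid U/Kˣ))
theorem3p1 em {u = u} K K-field L L-field torsion-free U Kˣ⊆U I x x-representatives =
  E-isSubalgebra , mk⇔ to from , λ condition₁ →
    -- Torsion of U/Kˣ, and with it separability, is reached from condition 1 by way of condition 2.
    let module T = Torsion (conditions torsion-free (proj₁ (to condition₁)) (proj₂ (to condition₁)))
        separable = λ y → separable-E y (T.Totals-separable (span⇒Totals (proj₂ y)))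
    in proj₁ condition₁ , (λ y → algebraic-E y (separable y)) , separable , degree-E (proj₂ condition₁)
  where
  open Representatives em K K-field L L-field U Kˣ⊆U I x x-representatives
  open Conditions em K K-field L L-field U Kˣ⊆U
  open UnitSubgroup em K K-field L L-field U Kˣ⊆U
  open Independence em (CommutativeAlgebra.commutativeRing L) L-field _ using (kneser)

  to : _ → _
  to (field-E , independent-x) =
    essential (independent⇒unitTotals independent-x) (E-inverse field-E) ,
    no-eighth-root (independent⇒unitTotals independent-x) (E-inverse field-E)

  from : _ → _
  from (ess , no-root) =
    E-field (λ _ → Torsion.Totals-⁻¹ C) , unitTotals⇒independent (kneser C)
    where C = conditions torsion-free ess no-root
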